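{- The following decision problem (the decision version of Strong Majority Game Chromatic Number) is PSPACE-complete: given a finite graph $G$ on $n$ vertices and an integer $k \ge 3$, does Alice have a winning strategy in the strong majority coloring game on $G$ with $k$ colors?
   Context: Strong majority coloring game: given a graph $G$ and a palette of $k$ colors, two players Alice and Bob alternately (Alice first) choose an uncolored vertex of $G$ and assign it a color from the palette, so that after every move the strong majority condition holds: for every vertex $v$ (colored or uncolored) and every color $c$, at most $\deg(v)/2$ of the neighbors of $v$ have color $c$. Alice wins if all vertices get colored; Bob wins if at some point there is an uncolored vertex to which no color of the palette can be legally assigned. PSPACE-completeness is with respect to polynomial-time many-one reductions. A known result that may be assumed: it is PSPACE-hard, given a finite graph $G$ and an integer $k\ge 3$, to decide whether Alice has a winning strategy with $k$ colors in the (proper) coloring game on $G$, in which Alice and Bob alternately (Alice first) color an uncolored vertex with one of $k$ colors not used on any of its neighbors, Alice winning if and only if the whole graph gets colored. -}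

module Defs where

open import Data.Bool.Base using (Bool; true; false)
open import Data.Fin.Base using (Fin)
open import Data.Fin.Subset using (Subset; _∈_; _∉_; _∩_; ∣_∣)
import Data.Fin.Properties as Fin
open import Data.List.Base as List using (List; []; _∷_; _++_; length; foldr)
open import Data.Maybe.Base as Maybe using (Maybe; just; nothing)
open import Data.Maybe.Properties using (≡-dec)
open import Data.Nat.Base using (ℕ; zero; suc; _+_; _*_; _≤_)
open import Data.Product.Base using (∃; ∃-syntax; _×_; _,_)
open import Data.Vec.Base as Vec using (Vec; _∷_; lookup; _[_]≔_)
open import Function.Bundles using (_↔_; _⇔_)
open import Level using (0ℓ)
open import Relation.Binary.PropositionalEquality using (_≡_; _≢_)
open import Relation.Nullary.Decidable.Core using (does)
open import Relation.Nullary.Negation.Core using (¬_)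
open import Relation.Unary using (Pred)

record Graph (n : ℕ) : Set where
  field
    neighborhoods : Vec (Subset n) n

  N : Fin n → Subset n
  N = lookup neighborhoods

  deg : Fin n → ℕ
  deg v = ∣ N v ∣

  field
    symmetric   : ∀ {u v} → u ∈ N v → v ∈ N u
    irreflexive : ∀ {v} → v ∉ N v

-- Partial colorings; `nothing` marks an uncolored vertex.
Coloring : ℕ → ℕ → Set
Coloring n k = Vec (Maybe (Fin k)) n

Uncolored : ∀ {n k} → Coloring n k → Fin n → Set
Uncolored col v = lookup col v ≡ nothing

Complete : ∀ {n k} → Coloring n k → Set
Complete col = ∀ v → ¬ Uncolored col v

uncolored : ∀ {n k} → Coloring n k
uncolored = Vec.replicate _ nothing

colorClass : ∀ {n k} → Coloring n k → Fin k → Subset n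
colorClass col c = Vec.map (λ x → does (≡-dec Fin._≟_ x (just c))) col

data Player : Set where
  alice bob : Player

-- An element of `AliceWins Legal BobHasWon p col` is a winning strategy
-- of Alice from the position `col` with player `p` to move: a tree with
-- one move of Alice at each of her turns and a subtree for each legal
-- move of Bob at each of his.  Every play is finite, as each move colors
-- a vertex.
data AliceWins {n k : ℕ} (Legal : Coloring n k → Fin n → Fin k → Set)
               (BobHasWon : Coloring n k → Set) :
               Player → Coloring n k → Set where
  complete : ∀ {p col} → Complete col → AliceWins Legal BobHasWon p col
  aliceMoves : ∀ {col} → ¬ BobHasWon col → ∀ v c → Legal col v c →
               AliceWins Legal BobHasWon bob (col [ v ]≔ just c) →
               AliceWins Legal BobHasWon alice col
  bobMoves : ∀ {col} → ¬ BobHasWon col →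
             (∀ v c → Legal col v c →
              AliceWins Legal BobHasWon alice (col [ v ]≔ just c)) →
             AliceWins Legal BobHasWon bob col

module _ {n : ℕ} (G : Graph n) where
  open Graph G

  -- The bound deg v / 2 is the exact rational half, hence the factor 2.
  StrongMajority : ∀ {k} → Coloring n k → Set
  StrongMajority col = ∀ v c → 2 * ∣ N v ∩ colorClass col c ∣ ≤ deg v

  LegalStrongMajority : ∀ {k} → Coloring n k → Fin n → Fin k → Set
  LegalStrongMajority col v c =
    Uncolored col v × StrongMajority (col [ v ]≔ just c)

  SomeVertexStuck : ∀ {k} → Coloring n k → Set
  SomeVertexStuck col =
    ∃[ v ] Uncolored col v × (∀ c → ¬ LegalStrongMajority col v c)

  AliceWinsStrongMajority : ℕ → Set
  AliceWinsStrongMajority k =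
    AliceWins {k = k} LegalStrongMajority SomeVertexStuck alice uncolored

  LegalProper : ∀ {k} → Coloring n k → Fin n → Fin k → Set
  LegalProper col v c =
    Uncolored col v × (∀ u → u ∈ N v → lookup col u ≢ just c)

  NoProperMove : ∀ {k} → Coloring n k → Set
  NoProperMove col = ¬ Complete col × (∀ v c → ¬ LegalProper col v c)

  AliceWinsProper : ℕ → Set
  AliceWinsProper k =
    AliceWins {k = k} LegalProper NoProperMove alice uncolored

Finite : Set → Set
Finite A = ∃[ n ] A ↔ Fin n

data Symbol (Work : Set) : Set where
  blank : Symbol Work
  bit   : Bool → Symbol Work
  work  : Work → Symbol Work

data Direction : Set where
  left stay right : Direction

-- Deterministic machines with one or more two-way infinite tapes; the
-- machine halts when `δ` yields `nothing`.
record TM : Set₁ where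
  field
    extraTapes  : ℕ
    State       : Set
    Work        : Set
    finiteState : Finite State
    finiteWork  : Finite Work
    start       : State
    accepting   : State → Bool

  tapes : ℕ
  tapes = suc extraTapes

  Γ : Set
  Γ = Symbol Work

  field
    δ : State → Vec Γ tapes → Maybe (State × Vec (Γ × Direction) tapes)

-- The part of a tape explored so far: the cells to the left of the head
-- (nearest first), the scanned cell, and the cells to its right (nearest
-- first).  All other cells are blank.
record Tape (W : Set) : Set where
  constructor tape
  field
    before : List (Symbol W)
    head   : Symbol W
    after  : List (Symbol W)

module _ {W : Set} where

  blankTape : Tape W
  blankTape = tape [] blank []

  moveHead : Direction → Tape W → Tape W
  moveHead left  (tape []       x rs)       = tape [] blank (x ∷ rs)
  moveHead left  (tape (l ∷ ls) x rs)       = tape ls l (x ∷ rs)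
  moveHead stay  t                          = t
  moveHead right (tape ls       x [])       = tape (x ∷ ls) blank []
  moveHead right (tape ls       x (r ∷ rs)) = tape (x ∷ ls) r rs

  act : Symbol W × Direction → Tape W → Tape W
  act (y , d) (tape ls _ rs) = moveHead d (tape ls y rs)

  cells : Tape W → ℕ
  cells (tape ls _ rs) = length ls + suc (length rs)

  writeWord : List Bool → Tape W
  writeWord []       = blankTape
  writeWord (b ∷ bs) = tape [] (bit b) (List.map bit bs)

  leadingBits : List (Symbol W) → List Bool
  leadingBits (bit b ∷ xs) = b ∷ leadingBits xs
  leadingBits _            = []

  -- The word starting at the head and ending before the first non-bit.
  readWord : Tape W → List Bool
  readWord (tape _ x rs) = leadingBits (x ∷ rs)

module _ (M : TM) where
  open TM M

  record Config : Set where
    constructor config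
    field
      state    : State
      contents : Vec (Tape Work) tapes

  open Config

  initial : List Bool → Config
  initial w = config start (writeWord w ∷ Vec.replicate _ blankTape)

  step : Config → Maybe Config
  step (config q ts) =
    Maybe.map (λ (q′ , as) → config q′ (Vec.zipWith act as ts))
              (δ q (Vec.map Tape.head ts))

  Halted : Config → Set
  Halted C = step C ≡ nothing

  data Run : Config → ℕ → Config → Set where
    done : ∀ {C} → Run C 0 C
    next : ∀ {C C′ C″ t} → step C ≡ just C′ → Run C′ t C″ → Run C (suc t) C″

  output : Config → List Bool
  output C = readWord (Vec.head (contents C))

  -- The cells explored on all tapes, including those of the input.
  space : Config → ℕ
  space C = Vec.sum (Vec.map cells (contents C))

Language : Set₁
Language = Pred (List Bool) 0ℓ

-- Coefficients in ℕ, constant term first.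
Polynomial : Set
Polynomial = List ℕ

⟦_⟧ : Polynomial → ℕ → ℕ
⟦ p ⟧ n = foldr (λ a r → a + n * r) 0 p

Decides : TM → Language → Set
Decides M L = ∀ w → ∃[ t ] ∃[ C ] Run M (initial M w) t C × Halted M C ×
                    (TM.accepting M (Config.state C) ≡ true ⇔ L w)

RunsInSpace : TM → Polynomial → Set
RunsInSpace M p =
  ∀ w {t C} → Run M (initial M w) t C → space M C ≤ ⟦ p ⟧ (length w)

PSPACE : Language → Set₁
PSPACE L = ∃[ M ] ∃[ p ] Decides M L × RunsInSpace M p

ComputesInTime : TM → (List Bool → List Bool) → Polynomial → Set
ComputesInTime M f p =
  ∀ w → ∃[ t ] ∃[ C ] Run M (initial M w) t C × Halted M C ×
        output M C ≡ f w × t ≤ ⟦ p ⟧ (length w)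

PolyTime : (List Bool → List Bool) → Set₁
PolyTime f = ∃[ M ] ∃[ p ] ComputesInTime M f p

infix 4 _≤ₚ_

_≤ₚ_ : Language → Language → Set₁
L ≤ₚ L′ = ∃[ f ] PolyTime f × (∀ w → L w ⇔ L′ (f w))

PSPACE-hard : Language → Set₁
PSPACE-hard L = ∀ L′ → PSPACE L′ → L′ ≤ₚ L

PSPACE-complete : Language → Set₁
PSPACE-complete L = PSPACE L × PSPACE-hard L

-- Binary numerals without leading zeros, least significant bit first.
increment : List Bool → List Bool
increment []           = true ∷ []
increment (false ∷ bs) = true ∷ bs
increment (true  ∷ bs) = false ∷ increment bs

binary : ℕ → List Bool
binary zero    = []
binary (suc n) = increment (binary n)

-- The order in unary, the adjacency matrix row by row, then k in binary.
encode : ∀ {n} → Graph n → ℕ → List Bool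
encode {n} G k =
  List.replicate n true ++ false ∷
  Vec.toList (Vec.concat (Graph.neighborhoods G)) ++ binary k

GameProblem : (∀ {n} → Graph n → ℕ → Set) → Language
GameProblem Wins w =
  ∃[ n ] ∃[ G ] ∃[ k ] 3 ≤ k × w ≡ encode {n} G k × Wins G k

ProperColoringGame : Language
ProperColoringGame = GameProblem AliceWinsProper

StrongMajorityColoringGame : Language
StrongMajorityColoringGame = GameProblem AliceWinsStrongMajority

{-# OPTIONS --safe #-}
-- Hardness. Subdivide every edge of G several times in parallel, an even number
-- of new vertices altogether. A new vertex allows no color on both of its
-- neighbors, so the old vertices see the proper coloring game. Conversely, since
-- the old vertices have even degree, each of them forbids at most one color on an
-- uncolored new neighbor, and with k ≥ 3 colors new vertices never get stuck.
-- Hence a move on a new vertex only passes the turn, and it can be answered in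
-- kind: the two games have the same winner.
--
-- Membership. A play is a word of polynomial length and its outcome is a
-- first-order property of that word with bounded quantifiers and counting, so the
-- winner is the value of a quantified Boolean formula, found by depth-first search
-- in polynomial space.
--
-- Machines. A tape represents a stack of bits; structured programs on stacks are
-- compiled to Turing machines, and bounded queries on lists of bits to such
-- programs, with time bounds read off the syntax.
module Submission where

open import Data.Bool.Base using (Bool; true; false; T; not; _∧_; _∨_; if_then_else_)
open import Data.Bool.Properties using (¬-not)
open import Data.Empty using (⊥; ⊥-elim)
open import Data.Fin.Base as Fin using (Fin; zero; suc; toℕ; fromℕ<; _↑ˡ_; _↑ʳ_; splitAt; remQuot)
import Data.Fin.Properties as Fin
open import Data.Fin.Subset using (Subset; _∈_; _∩_; ∣_∣)
open import Data.List.Base as List using (List; []; _∷_; _++_; _ʳ++_; length)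
import Data.List.Properties as List
open import Data.Maybe.Base as Maybe using (Maybe; just; nothing; maybe′)
import Data.Maybe.Properties as Maybe
open import Data.Nat.Base using (ℕ; zero; suc; _+_; _*_; _∸_; _≤_; _<_; _<ᵇ_; _⊓_; pred; >-nonZero; z≤n; s≤s)
open import Data.Nat.Properties as ℕ using (≤-refl; ≤-trans; ≤-reflexive; +-mono-≤; m≤m+n; m≤n+m)
open import Data.Nat.Tactic.RingSolver using (solve-∀)
open import Data.Product.Base using (∃; ∃-syntax; _×_; _,_; proj₁; proj₂; map₁)
open import Data.Sum.Base as Sum using (_⊎_; inj₁; inj₂; [_,_]′)
open import Data.Unit.Base using (⊤; tt)
open import Data.Vec.Base as Vec using (Vec; []; _∷_; lookup; _[_]≔_; toList; tabulate)
import Data.Vec.Properties as Vec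
open import Function.Base using (_∘_; id)
open import Function.Bundles using (_↔_; _⇔_; mk⇔; Equivalence)
import Function.Properties.Inverse as ↔
open import Data.Sum.Function.Propositional using (_⊎-↔_)
open import Relation.Binary.PropositionalEquality
open import Relation.Binary.Definitions using (tri<; tri≈; tri>)
open import Relation.Nullary.Decidable.Core using (Dec; yes; no; does)
import Relation.Nullary.Decidable as Dec
open import Relation.Nullary.Negation.Core using (¬_; contradiction)

open import Defs

-- Turing machine fragments and stack programs

-- Three mismatches shape the proof. Bob wins the majority game as soon as one vertex is stuck, but
-- the proper game only when no move is left; the two agree because a vertex without an available
-- color never regains one. Next, an edge occurs as two ordered pairs and each pair is taken twice:
-- doubling makes every old degree even, and pairs that are not edges become isolated new vertices,
-- harmless for passing turns, which keep the indexing uniform. Finally, the quantified formula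
-- deals out blocks of bits of a fixed length, and many blocks spell no legal move. An illegal block
-- of Alice loses, but one of Bob must not simply lose, since it is his only way to report a stuck
-- vertex; hence Alice's next block, judged in the same position, may refute it. The rounds
-- outnumber the vertices, so a round for the refutation always remains. On the machine side, the
-- search through all plays takes exponential time, so its space cannot be bounded by its time. The
-- semantics of stack programs therefore tracks stack heights separately from time, and the two
-- measures meet only at the leaves of the search.

record Fragment (W : Set) (K : ℕ) : Set₁ where
  field
    Point       : Set
    finitePoint : Finite Point
    entry       : Point
    move        : Point → Vec (Symbol W) K →
                  Maybe Point × Vec (Symbol W × Direction) K

open Fragment

redirect : ∀ {P Q A : Set} → (P → Q) → Maybe Q → Maybe P × A → Maybe Q × A
redirect ι e (p , as) = maybe′ (just ∘ ι) e p , as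

module _ {W : Set} {K : ℕ} where

  heads : Vec (Tape W) K → Vec (Symbol W) K
  heads = Vec.map Tape.head

  acts : Vec (Symbol W × Direction) K → Vec (Tape W) K → Vec (Tape W) K
  acts = Vec.zipWith act

  -- Leaving a fragment is itself a machine step: the exiting `move` still acts on the tapes, so a
  -- fragment of one instruction costs one step.
  data Path (F : Fragment W K) : Point F → Vec (Tape W) K → ℕ → Vec (Tape W) K → Set where
    exit : ∀ {p ts} → proj₁ (move F p (heads ts)) ≡ nothing →
           Path F p ts 1 (acts (proj₂ (move F p (heads ts))) ts)
    next : ∀ {p q ts ts′ t} → proj₁ (move F p (heads ts)) ≡ just q →
           Path F q (acts (proj₂ (move F p (heads ts))) ts) t ts′ →
           Path F p ts (suc t) ts′

  -- What the enclosing fragment does once an inner one has left: at `nothing` it leaves as well, at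
  -- `just p` it goes on from `p`.
  data Continue (F : Fragment W K) : Maybe (Point F) → Vec (Tape W) K → ℕ → Vec (Tape W) K → Set where
    stop : ∀ {ts} → Continue F nothing ts 0 ts
    go   : ∀ {p ts ts′ t} → Path F p ts t ts′ → Continue F (just p) ts t ts′

  -- Every combinator embeds its parts by a map of points and redirects their exits to one fixed
  -- target `e`. This is the common core of the correctness of sequence, branch and loop.
  embedPath : ∀ {F G : Fragment W K} (ι : Point F → Point G) e →
              (∀ p γ → move G (ι p) γ ≡ redirect ι e (move F p γ)) →
              ∀ {p ts t ts′ u ts″} → Path F p ts t ts′ → Continue G e ts′ u ts″ →
              Path G (ι p) ts (t + u) ts″
  embedPath {F} {G} ι e eq {p} {ts} (exit h) k = go-on k
    where
    r : move G (ι p) (heads ts) ≡ (e , proj₂ (move F p (heads ts)))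
    r = trans (eq p _) (cong (λ z → maybe′ (just ∘ ι) e z , proj₂ (move F p (heads ts))) h)
    go-on : ∀ {u ts″} → Continue G e (acts (proj₂ (move F p (heads ts))) ts) u ts″ →
            Path G (ι p) ts (1 + u) ts″
    go-on stop = subst (λ z → Path G (ι p) ts 1 (acts z ts)) (cong proj₂ r) (exit (cong proj₁ r))
    go-on (go π) = next (cong proj₁ r) (subst (λ z → Path G _ (acts z ts) _ _) (sym (cong proj₂ r)) π)
  embedPath {F} {G} ι e eq {p} {ts} (next {q = q} h π) k =
    next (cong proj₁ r) (subst (λ z → Path G _ (acts z ts) _ _) (sym (cong proj₂ r)) (embedPath ι e eq π k))
    where
    r : move G (ι p) (heads ts) ≡ (just (ι q) , proj₂ (move F p (heads ts)))
    r = trans (eq p _) (cong (λ z → maybe′ (just ∘ ι) e z , proj₂ (move F p (heads ts))) h)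

act-stay : ∀ {W} (t : Tape W) → act (Tape.head t , stay) t ≡ t
act-stay (tape _ _ _) = refl

stays : ∀ {W K} → Vec (Symbol W) K → Vec (Symbol W × Direction) K
stays = Vec.map (_, stay)

acts-stays : ∀ {W K} (ts : Vec (Tape W) K) → acts (stays (heads ts)) ts ≡ ts
acts-stays []       = refl
acts-stays (t ∷ ts) = cong₂ _∷_ (act-stay t) (acts-stays ts)

acts-single : ∀ {W K} (ts : Vec (Tape W) K) x (f : Symbol W → Symbol W × Direction) →
              acts (stays (heads ts) [ x ]≔ f (lookup (heads ts) x)) ts ≡
              ts [ x ]≔ act (f (Tape.head (lookup ts x))) (lookup ts x)
acts-single (t ∷ ts) zero    f = cong (act (f (Tape.head t)) t ∷_) (acts-stays ts)
acts-single (t ∷ ts) (suc x) f = cong₂ _∷_ (act-stay t) (acts-single ts x f)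

finite-⊤ : Finite ⊤
finite-⊤ = 1 , ↔.↔-sym Fin.1↔⊤

finite-Bool : Finite Bool
finite-Bool = 2 , ↔.↔-sym Fin.2↔Bool

finite-⊎ : ∀ {A B} → Finite A → Finite B → Finite (A ⊎ B)
finite-⊎ (m , f) (n , g) = m + n , ↔.↔-trans (f ⊎-↔ g) (↔.↔-sym Fin.+↔⊎)

topBit : ∀ {W} → Symbol W → Maybe Bool
topBit (bit b) = just b
topBit _       = nothing

data Cmd (V : ℕ) : Set where
  push  : Fin V → Bool → Cmd V
  pop   : Fin V → Cmd V
  _⨾_   : Cmd V → Cmd V → Cmd V
  ifs   : Fin V → (Maybe Bool → Bool) → Cmd V → Cmd V → Cmd V
  while : Fin V → (Maybe Bool → Bool) → Cmd V → Cmd V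

infixr 5 _⨾_

-- Big-step semantics on a vector of stacks. The number bounds the running
-- time from above, and `ok` restricts the heights the stacks may reach.
data Eval {V : ℕ} (ok : ℕ → Set) : Cmd V → Vec (List Bool) V → Vec (List Bool) V → ℕ → Set where
  e-push  : ∀ {σ x b} → ok (suc (length (lookup σ x))) →
            Eval ok (push x b) σ (σ [ x ]≔ (b ∷ lookup σ x)) 2
  e-pop   : ∀ {σ x} → Eval ok (pop x) σ (σ [ x ]≔ List.drop 1 (lookup σ x)) 1
  e-seq   : ∀ {P Q σ σ₁ σ₂ t u} → Eval ok P σ σ₁ t → Eval ok Q σ₁ σ₂ u →
            Eval ok (P ⨾ Q) σ σ₂ (t + u)
  e-then  : ∀ {x c P Q σ σ₁ t} → c (List.head (lookup σ x)) ≡ true → Eval ok P σ σ₁ t →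
            Eval ok (ifs x c P Q) σ σ₁ (suc t)
  e-else  : ∀ {x c P Q σ σ₁ t} → c (List.head (lookup σ x)) ≡ false → Eval ok Q σ σ₁ t →
            Eval ok (ifs x c P Q) σ σ₁ (suc t)
  e-loop  : ∀ {x c P σ σ₁ σ₂ t u} → c (List.head (lookup σ x)) ≡ true →
            Eval ok P σ σ₁ t → Eval ok (while x c P) σ₁ σ₂ u →
            Eval ok (while x c P) σ σ₂ (suc (t + u))
  e-end   : ∀ {x c P σ} → c (List.head (lookup σ x)) ≡ false →
            Eval ok (while x c P) σ σ 1
  e-weak  : ∀ {P σ σ₁ t u} → t ≤ u → Eval ok P σ σ₁ t → Eval ok P σ σ₁ u

Free : ℕ → Set
Free _ = ⊤

length-drop1 : (xs : List Bool) → length (List.drop 1 xs) ≤ length xs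
length-drop1 []       = z≤n
length-drop1 (x ∷ xs) = ℕ.n≤1+n _

lookup-≔ : ∀ {A : Set} {n} (P : Fin n → A → Set) (xs : Vec A n) x y →
           P x y → (∀ z → z ≢ x → P z (lookup xs z)) → ∀ z → P z (lookup (xs [ x ]≔ y) z)
lookup-≔ P xs x y p q z with z Fin.≟ x
... | yes refl = subst (P x) (sym (Vec.lookup∘updateAt x xs)) p
... | no z≢x   = subst (P z) (sym (Vec.lookup∘updateAt′ z x z≢x xs)) (q z z≢x)

-- A push is charged two units and lengthens one stack by one, and nothing else lengthens a stack,
-- so time bounds growth. The sizes of generated lists are obtained from this as well.
Eval-grows : ∀ {V ok} {P : Cmd V} {σ σ′ t} → Eval ok P σ σ′ t →
             ∀ s → (∀ y → length (lookup σ y) ≤ s) → ∀ y → length (lookup σ′ y) ≤ s + t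
Eval-grows {σ = σ} (e-push {x = x} {b} _) s h = lookup-≔ (λ _ xs → length xs ≤ s + 2) σ x _
  (≤-trans (s≤s (≤-trans (h x) (m≤m+n s 1))) (≤-reflexive (sym (ℕ.+-suc s 1))))
  λ y _ → ≤-trans (h y) (m≤m+n s 2)
Eval-grows {σ = σ} (e-pop {x = x}) s h = lookup-≔ (λ _ xs → length xs ≤ s + 1) σ x _
  (≤-trans (length-drop1 (lookup σ x)) (≤-trans (h x) (m≤m+n s 1)))
  λ y _ → ≤-trans (h y) (m≤m+n s 1)
Eval-grows (e-seq {t = t} {u} e f) s h y =
  ≤-trans (Eval-grows f (s + t) (Eval-grows e s h) y) (≤-reflexive (ℕ.+-assoc s t u))
Eval-grows (e-then {t = t} _ e) s h y = ≤-trans (Eval-grows e s h y) (ℕ.+-monoʳ-≤ s (ℕ.n≤1+n t))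
Eval-grows (e-else {t = t} _ e) s h y = ≤-trans (Eval-grows e s h y) (ℕ.+-monoʳ-≤ s (ℕ.n≤1+n t))
Eval-grows (e-loop {t = t} {u} _ e f) s h y =
  ≤-trans (Eval-grows f (s + t) (Eval-grows e s h) y)
    (≤-trans (≤-reflexive (ℕ.+-assoc s t u)) (ℕ.+-monoʳ-≤ s (ℕ.n≤1+n (t + u))))
Eval-grows (e-end _) s h y = ≤-trans (h y) (m≤m+n s 1)
Eval-grows (e-weak t≤u e) s h y = ≤-trans (Eval-grows e s h y) (ℕ.+-monoʳ-≤ s t≤u)

-- Turns a time bound into a bound on heights. Polynomial-time pieces enter the height-bounded
-- search in this way.
Eval-capped : ∀ {V ok} {P : Cmd V} {σ σ′ t} → Eval ok P σ σ′ t →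
              ∀ s c → (∀ y → length (lookup σ y) ≤ s) → s + t ≤ c → Eval (_≤ c) P σ σ′ t
Eval-capped (e-push {x = x} _) s c h le =
  e-push (≤-trans (s≤s (≤-trans (h x) (m≤m+n s 1))) (≤-trans (≤-reflexive (sym (ℕ.+-suc s 1))) le))
Eval-capped e-pop s c h le = e-pop
Eval-capped (e-seq {t = t} {u} e f) s c h le = e-seq
  (Eval-capped e s c h (≤-trans (ℕ.+-monoʳ-≤ s (m≤m+n t u)) le))
  (Eval-capped f (s + t) c (Eval-grows e s h) (≤-trans (≤-reflexive (ℕ.+-assoc s t u)) le))
Eval-capped (e-then q e) s c h le = e-then q (Eval-capped e s c h (≤-trans (ℕ.+-monoʳ-≤ s (ℕ.n≤1+n _)) le))
Eval-capped (e-else q e) s c h le = e-else q (Eval-capped e s c h (≤-trans (ℕ.+-monoʳ-≤ s (ℕ.n≤1+n _)) le))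
Eval-capped (e-loop {t = t} {u} q e f) s c h le = e-loop q
  (Eval-capped e s c h (≤-trans (ℕ.+-monoʳ-≤ s (≤-trans (m≤m+n t u) (ℕ.n≤1+n _))) le))
  (Eval-capped f (s + t) c (Eval-grows e s h)
    (≤-trans (≤-reflexive (ℕ.+-assoc s t u)) (≤-trans (ℕ.+-monoʳ-≤ s (ℕ.n≤1+n _)) le)))
Eval-capped (e-end q) s c h le = e-end q
Eval-capped (e-weak t≤u e) s c h le = e-weak t≤u (Eval-capped e s c h (≤-trans (ℕ.+-monoʳ-≤ s t≤u) le))

-- Tapes as stacks

module _ {W : Set} where

  pushTape : Bool → Tape W → Tape W
  pushTape b t = act (bit b , stay) (act (Tape.head t , left) t)

  -- Nothing is erased: the popped bit ends up to the left of the head, outside the word that is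
  -- read, and the next push overwrites it.
  popAction : Symbol W → Symbol W × Direction
  popAction (bit b) = bit b , right
  popAction g       = g , stay

  popTape : Tape W → Tape W
  popTape t = act (popAction (Tape.head t)) t

  readWord-push : ∀ b (t : Tape W) → readWord (pushTape b t) ≡ b ∷ readWord t
  readWord-push b (tape []      x rs) = refl
  readWord-push b (tape (_ ∷ _) x rs) = refl

  readWord-pop : ∀ (t : Tape W) → readWord (popTape t) ≡ List.drop 1 (readWord t)
  readWord-pop (tape ls blank    rs)       = refl
  readWord-pop (tape ls (bit b)  [])       = refl
  readWord-pop (tape ls (bit b)  (r ∷ rs)) = refl
  readWord-pop (tape ls (work w) rs)       = refl

  head-readWord : ∀ (t : Tape W) → List.head (readWord t) ≡ topBit (Tape.head t)
  head-readWord (tape ls blank    rs) = refl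
  head-readWord (tape ls (bit b)  rs) = refl
  head-readWord (tape ls (work w) rs) = refl

  -- On a tape holding a stack of height m, the bottom of the stack never
  -- moves; this keeps the tape within s + 1 cells while m stays below s.
  Fits : ℕ → ℕ → Tape W → Set
  Fits s m (tape ls _ rs) = length ls + m ≤ s × length rs ≤ m

  Fits-cells : ∀ {s m} t → Fits s m t → cells t ≤ suc s
  Fits-cells {s} {m} (tape ls _ rs) (p , q) =
    ≤-trans (ℕ.+-monoʳ-≤ (length ls) (s≤s q)) (≤-trans (≤-reflexive (ℕ.+-suc (length ls) m)) (s≤s p))

  Fits-push : ∀ {s m} b t → suc m ≤ s → Fits s m t → Fits s (suc m) (pushTape b t)
  Fits-push b (tape []       x rs) le (p , q) = le , s≤s q
  Fits-push b (tape (_ ∷ ls) x rs) le (p , q) = ≤-trans (≤-reflexive (ℕ.+-suc (length ls) _)) p , s≤s q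

  Fits-pop : ∀ {s} t → Fits s (length (readWord t)) t → Fits s (length (List.drop 1 (readWord t))) (popTape t)
  Fits-pop (tape ls blank    rs)       h             = h
  Fits-pop (tape ls (bit b)  [])       (p , q)       =
    ≤-trans (≤-reflexive (sym (ℕ.+-suc (length ls) _))) p , z≤n
  Fits-pop (tape ls (bit b)  (r ∷ rs)) (p , (s≤s q)) =
    ≤-trans (≤-reflexive (sym (ℕ.+-suc (length ls) _))) p , q
  Fits-pop (tape ls (work w) rs)       h             = h

-- Compilation of stack programs

module Compilation {W : Set} {K V : ℕ} (loc : Fin V → Fin K)
                   (loc-injective : ∀ {x y} → loc x ≡ loc y → x ≡ y) where

  one : Fin K → (Symbol W → Symbol W × Direction) → Fragment W K
  one x f .Point       = ⊤
  one x f .finitePoint = finite-⊤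
  one x f .entry       = tt
  one x f .move _ γ    = nothing , stays γ [ x ]≔ f (lookup γ x)

  seqF : Fragment W K → Fragment W K → Fragment W K
  seqF F G .Point       = Point F ⊎ Point G
  seqF F G .finitePoint = finite-⊎ (finitePoint F) (finitePoint G)
  seqF F G .entry       = inj₁ (entry F)
  seqF F G .move (inj₁ p) γ = redirect inj₁ (just (inj₂ (entry G))) (move F p γ)
  seqF F G .move (inj₂ p) γ = redirect inj₂ nothing (move G p γ)

  ifF : Fin K → (Maybe Bool → Bool) → Fragment W K → Fragment W K → Fragment W K
  ifF x c F G .Point       = ⊤ ⊎ (Point F ⊎ Point G)
  ifF x c F G .finitePoint = finite-⊎ finite-⊤ (finite-⊎ (finitePoint F) (finitePoint G))
  ifF x c F G .entry       = inj₁ tt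
  ifF x c F G .move (inj₁ _) γ =
    just (inj₂ (if c (topBit (lookup γ x)) then inj₁ (entry F) else inj₂ (entry G))) , stays γ
  ifF x c F G .move (inj₂ (inj₁ p)) γ = redirect (inj₂ ∘ inj₁) nothing (move F p γ)
  ifF x c F G .move (inj₂ (inj₂ p)) γ = redirect (inj₂ ∘ inj₂) nothing (move G p γ)

  whileF : Fin K → (Maybe Bool → Bool) → Fragment W K → Fragment W K
  whileF x c F .Point       = ⊤ ⊎ Point F
  whileF x c F .finitePoint = finite-⊎ finite-⊤ (finitePoint F)
  whileF x c F .entry       = inj₁ tt
  whileF x c F .move (inj₁ _) γ =
    (if c (topBit (lookup γ x)) then just (inj₂ (entry F)) else nothing) , stays γ
  whileF x c F .move (inj₂ p) γ = redirect inj₂ (just (inj₁ tt)) (move F p γ)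

  compile : Cmd V → Fragment W K
  compile (push x b)    = seqF (one (loc x) (λ g → g , left)) (one (loc x) (λ _ → bit b , stay))
  compile (pop x)       = one (loc x) popAction
  compile (P ⨾ Q)       = seqF (compile P) (compile Q)
  compile (ifs x c P Q) = ifF (loc x) c (compile P) (compile Q)
  compile (while x c P) = whileF (loc x) c (compile P)

  -- A tape holds the stack of bits from its head to the first other symbol,
  -- so whatever an earlier computation left on the tape does no harm.
  Holds : Vec (List Bool) V → Vec (Tape W) K → Set
  Holds σ ts = ∀ x → readWord (lookup ts (loc x)) ≡ lookup σ x

  Within : ℕ → Vec (List Bool) V → Vec (Tape W) K → Set
  Within s σ ts = (∀ k → cells (lookup ts k) ≤ suc s) ×
                  (∀ x → Fits s (length (lookup σ x)) (lookup ts (loc x)))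

  Holds-≔ : ∀ σ ts x l t → Holds σ ts → readWord t ≡ l → Holds (σ [ x ]≔ l) (ts [ loc x ]≔ t)
  Holds-≔ σ ts x l t h e = lookup-≔ (λ y l → readWord (lookup (ts [ loc x ]≔ t) (loc y)) ≡ l) σ x l
    (trans (cong readWord (Vec.lookup∘updateAt (loc x) ts)) e)
    λ y y≢x → trans (cong readWord (Vec.lookup∘updateAt′ (loc y) (loc x) (y≢x ∘ loc-injective) ts)) (h y)

  Within-≔ : ∀ {s} σ ts x l t → Within s σ ts → Fits s (length l) t → Within s (σ [ x ]≔ l) (ts [ loc x ]≔ t)
  Within-≔ {s} σ ts x l t (c , f) e =
    lookup-≔ (λ _ t → cells t ≤ suc s) ts (loc x) t (Fits-cells t e) (λ k _ → c k) ,
    lookup-≔ (λ y l → Fits s (length l) (lookup (ts [ loc x ]≔ t) (loc y))) σ x l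
      (subst (Fits s (length l)) (sym (Vec.lookup∘updateAt (loc x) ts)) e)
      λ y y≢x → subst (Fits s _) (sym (Vec.lookup∘updateAt′ (loc y) (loc x) (y≢x ∘ loc-injective) ts)) (f y)

  head-topBit : ∀ σ ts x (c : Maybe Bool → Bool) {b} → Holds σ ts → c (List.head (lookup σ x)) ≡ b →
                c (topBit (lookup (heads ts) (loc x))) ≡ b
  head-topBit σ ts x c h e = trans (cong c (trans (cong (topBit {W}) (Vec.lookup-map (loc x) Tape.head ts))
    (trans (sym (head-readWord (lookup ts (loc x)))) (cong List.head (h x))))) e

  one-path : ∀ {x} {f : Symbol W → Symbol W × Direction} {ts t} → act (f (Tape.head (lookup ts x))) (lookup ts x) ≡ t →
             Path (one x f) tt ts 1 (ts [ x ]≔ t)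
  one-path {x} {f} {ts} e =
    subst (Path (one x f) tt ts 1) (trans (acts-single ts x f) (cong (ts [ x ]≔_) e)) (exit {F = one x f} {ts = ts} refl)

  seq-path : ∀ {F G : Fragment W K} {ts t ts′ u ts″} → Path F (entry F) ts t ts′ → Path G (entry G) ts′ u ts″ →
             Path (seqF F G) (inj₁ (entry F)) ts (t + u) ts″
  seq-path {F} {G} {u = u} π ρ = embedPath inj₁ (just (inj₂ (entry G))) (λ _ _ → refl) π
    (go (subst (λ v → Path (seqF F G) _ _ v _) (ℕ.+-identityʳ u) (embedPath inj₂ nothing (λ _ _ → refl) ρ stop)))

  push-path : ∀ {x} b ts → Path (compile (push x b)) (inj₁ tt) ts 2 (ts [ loc x ]≔ pushTape b (lookup ts (loc x)))
  push-path {x} b ts = subst (Path (compile (push x b)) (inj₁ tt) ts 2) (Vec.[]≔-idempotent ts (loc x))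
    (seq-path (one-path {f = λ g → g , left} refl) (one-path {f = λ _ → bit b , stay} (cong (act (bit b , stay)) (Vec.lookup∘updateAt (loc x) ts))))

  -- The semantics bounds time from above only, hence the separate actual time `t′`. The last
  -- component transports the space invariant for any `s` that dominates the allowed heights, so one
  -- simulation serves both time and space.
  Reaches : Cmd V → (ℕ → Set) → Vec (List Bool) V → Vec (Tape W) K → ℕ → Vec (List Bool) V → Set
  Reaches P ok σ ts t σ′ =
    ∃[ ts′ ] ∃[ t′ ] t′ ≤ t × Path (compile P) (entry (compile P)) ts t′ ts′ × Holds σ′ ts′ ×
      (∀ s → (∀ n → ok n → n ≤ s) → Within s σ ts → Within s σ′ ts′)

  simulate : ∀ {ok P σ σ′ t} → Eval ok P σ σ′ t → ∀ ts → Holds σ ts → Reaches P ok σ ts t σ′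
  simulate {σ = σ} (e-push {x = x} {b} o) ts h =
    _ , 2 , ≤-refl , push-path b ts ,
    Holds-≔ σ ts x _ _ h (trans (readWord-push b (lookup ts (loc x))) (cong (b ∷_) (h x))) ,
    λ s le w → Within-≔ σ ts x _ _ w (Fits-push b (lookup ts (loc x)) (le _ o) (proj₂ w x))
  simulate {σ = σ} (e-pop {x = x}) ts h =
    _ , 1 , ≤-refl , one-path {f = popAction} refl ,
    Holds-≔ σ ts x _ _ h (trans (readWord-pop (lookup ts (loc x))) (cong (List.drop 1) (h x))) ,
    λ s le w → Within-≔ σ ts x _ _ w
      (subst (λ l → Fits s (length (List.drop 1 l)) (popTape (lookup ts (loc x)))) (h x)
        (Fits-pop (lookup ts (loc x)) (subst (λ l → Fits s (length l) (lookup ts (loc x))) (sym (h x)) (proj₂ w x))))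
  simulate (e-seq e f) ts h with simulate e ts h
  ... | ts₁ , t₁ , le₁ , π₁ , h₁ , w₁ with simulate f ts₁ h₁
  ...   | ts₂ , t₂ , le₂ , π₂ , h₂ , w₂ =
    ts₂ , t₁ + t₂ , +-mono-≤ le₁ le₂ , seq-path π₁ π₂ , h₂ , λ s le w → w₂ s le (w₁ s le w)
  simulate {σ = σ} (e-then {x} {c} {P} {Q} q e) ts h with simulate e ts h
  ... | ts₁ , t₁ , le₁ , π₁ , h₁ , w₁ = ts₁ , suc t₁ , s≤s le₁ ,
    next (cong (λ b → just (inj₂ (if b then inj₁ (entry (compile P)) else inj₂ (entry (compile Q)))))
           (head-topBit σ ts x c h q))
      (subst₂ (λ us v → Path (ifF (loc x) c (compile P) (compile Q)) _ us v _) (sym (acts-stays ts)) (ℕ.+-identityʳ t₁)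
        (embedPath (inj₂ ∘ inj₁) nothing (λ _ _ → refl) π₁ stop)) ,
    h₁ , w₁
  simulate {σ = σ} (e-else {x} {c} {P} {Q} q e) ts h with simulate e ts h
  ... | ts₁ , t₁ , le₁ , π₁ , h₁ , w₁ = ts₁ , suc t₁ , s≤s le₁ ,
    next (cong (λ b → just (inj₂ (if b then inj₁ (entry (compile P)) else inj₂ (entry (compile Q)))))
           (head-topBit σ ts x c h q))
      (subst₂ (λ us v → Path (ifF (loc x) c (compile P) (compile Q)) _ us v _) (sym (acts-stays ts)) (ℕ.+-identityʳ t₁)
        (embedPath (inj₂ ∘ inj₂) nothing (λ _ _ → refl) π₁ stop)) ,
    h₁ , w₁
  simulate {σ = σ} (e-loop {x} {c} {P} q e f) ts h with simulate e ts h
  ... | ts₁ , t₁ , le₁ , π₁ , h₁ , w₁ with simulate f ts₁ h₁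
  ...   | ts₂ , t₂ , le₂ , π₂ , h₂ , w₂ =
    ts₂ , suc (t₁ + t₂) , s≤s (+-mono-≤ le₁ le₂) ,
    next (cong (λ b → if b then just (inj₂ (entry (compile P))) else nothing) (head-topBit σ ts x c h q))
      (subst (λ us → Path (whileF (loc x) c (compile P)) _ us _ _) (sym (acts-stays ts))
        (embedPath inj₂ (just (inj₁ tt)) (λ _ _ → refl) π₁ (go π₂))) ,
    h₂ , λ s le w → w₂ s le (w₁ s le w)
  simulate {σ = σ} (e-end {x} {c} {P} q) ts h =
    ts , 1 , ≤-refl ,
    subst (Path (whileF (loc x) c (compile P)) (inj₁ tt) ts 1) (acts-stays ts)
      (exit (cong (λ b → if b then just (inj₂ (entry (compile P))) else nothing) (head-topBit σ ts x c h q))) ,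
    h , λ _ _ w → w
  simulate (e-weak t≤u e) ts h with simulate e ts h
  ... | ts₁ , t₁ , le₁ , rest = ts₁ , t₁ , ≤-trans le₁ t≤u , rest

-- Running a stack program after a given machine

take-++ : ∀ {A : Set} {m n} (xs : Vec A m) (ys : Vec A n) → Vec.take m (xs Vec.++ ys) ≡ xs
take-++ {m = m} xs ys = Vec.++-injectiveˡ _ xs (Vec.take++drop≡id m (xs Vec.++ ys))

drop-++ : ∀ {A : Set} {m n} (xs : Vec A m) (ys : Vec A n) → Vec.drop m (xs Vec.++ ys) ≡ ys
drop-++ {m = m} xs ys = Vec.++-injectiveʳ _ xs (Vec.take++drop≡id m (xs Vec.++ ys))

replicate-+ : ∀ {A : Set} m n (x : A) → Vec.replicate (m + n) x ≡ Vec.replicate m x Vec.++ Vec.replicate n x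
replicate-+ zero    n x = refl
replicate-+ (suc m) n x = cong (x ∷_) (replicate-+ m n x)

map-nothing : ∀ {A B : Set} {f : A → B} (x : Maybe A) → Maybe.map f x ≡ nothing → x ≡ nothing
map-nothing nothing refl = refl

Run-snoc : ∀ {M C C₁ C₂ t} → Run M C t C₁ → step M C₁ ≡ just C₂ → Run M C (suc t) C₂
Run-snoc done       e = next e done
Run-snoc (next f r) e = next f (Run-snoc r e)

is-true : Maybe Bool → Bool
is-true (just b) = b
is-true nothing  = false

-- The machine that first runs M and then the stack program P, where the
-- stack `input` starts with the output of M and lives on the first tape;
-- it accepts when the stack `test` ends with `true` on top.
module Sequel (M : TM) {V : ℕ} (input test : Fin V) (P : Cmd V) where
  open TM M

  K : ℕ
  K = tapes + V

  place : ∀ v → Dec (v ≡ input) → Fin K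
  place v (yes _) = zero
  place v (no _)  = tapes ↑ʳ v

  loc : Fin V → Fin K
  loc v = place v (v Fin.≟ input)

  loc-injective : ∀ {x y} → loc x ≡ loc y → x ≡ y
  loc-injective {x} {y} e with x Fin.≟ input | y Fin.≟ input
  ... | yes refl | yes refl = refl
  ... | no _     | no _     = Fin.↑ʳ-injective tapes x y e
  ... | yes _    | no _     with () ← e
  ... | no _     | yes _    with () ← e

  loc-input : loc input ≡ zero
  loc-input with input Fin.≟ input
  ... | yes _ = refl
  ... | no ne = ⊥-elim (ne refl)

  open Compilation {Work} {K} {V} loc (λ {x} {y} → loc-injective {x} {y}) public

  widen : Maybe (State × Vec (Γ × Direction) tapes) → Vec Γ K → Maybe State × Vec (Γ × Direction) K
  widen nothing         γ = nothing , stays γ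
  widen (just (q , as)) γ = just q , as Vec.++ stays (Vec.drop tapes γ)

  liftF : Fragment Work K
  liftF .Point       = State
  liftF .finitePoint = finiteState
  liftF .entry       = start
  liftF .move q γ    = widen (δ q (Vec.take tapes γ)) γ

  take-heads : (ts : Vec (Tape Work) tapes) (us : Vec (Tape Work) V) →
               Vec.take tapes (heads (ts Vec.++ us)) ≡ heads ts
  take-heads ts us = trans (cong (Vec.take tapes) (Vec.map-++ Tape.head ts us)) (take-++ (heads ts) (heads us))

  drop-heads : (ts : Vec (Tape Work) tapes) (us : Vec (Tape Work) V) →
               Vec.drop tapes (heads (ts Vec.++ us)) ≡ heads us
  drop-heads ts us = trans (cong (Vec.drop tapes) (Vec.map-++ Tape.head ts us)) (drop-++ (heads ts) (heads us))

  lift-move : ∀ q ts us r → δ q (heads ts) ≡ r → move liftF q (heads (ts Vec.++ us)) ≡ widen r (heads (ts Vec.++ us))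
  lift-move q ts us r e = cong (λ z → widen z (heads (ts Vec.++ us))) (trans (cong (δ q) (take-heads ts us)) e)

  -- The additional step is the exit: where `M` has no transition, the fragment makes one idle move
  -- before it leaves.
  lift-run : ∀ {q ts t C} us → Run M (config q ts) t C → Halted M C →
             Path liftF q (ts Vec.++ us) (suc t) (Config.contents C Vec.++ us)
  lift-run {q} {ts} us done h =
    subst (Path liftF q (ts Vec.++ us) 1)
      (trans (cong (λ z → acts (proj₂ z) (ts Vec.++ us)) m) (acts-stays (ts Vec.++ us)))
      (exit (cong proj₁ m))
    where
    m = lift-move q ts us nothing (map-nothing _ h)
  lift-run {q} {ts} us (next e r) h with δ q (heads ts) in eq | e
  ... | just (q′ , as) | refl =
    next (cong proj₁ m)
      (subst (λ z → Path liftF q′ z _ _)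
        (sym (trans (cong (λ z → acts (proj₂ z) (ts Vec.++ us)) m)
          (trans (cong (λ z → acts (as Vec.++ stays z) (ts Vec.++ us)) (drop-heads ts us))
            (trans (Vec.zipWith-++ act as (stays (heads us)) ts us) (cong (acts as ts Vec.++_) (acts-stays us))))))
        (lift-run us r h))
    where
    m = lift-move q ts us _ eq

  F : Fragment Work K
  F = seqF liftF (compile P)

  -- Acceptance is a property of the state alone. So after the fragment one more step copies the top
  -- of the stack `test` into the state, and the machine halts there.
  machine : TM
  machine .TM.extraTapes  = extraTapes + V
  machine .TM.State       = Point F ⊎ (⊤ ⊎ Bool)
  machine .TM.Work        = Work
  machine .TM.finiteState = finite-⊎ (finitePoint F) (finite-⊎ finite-⊤ finite-Bool)
  machine .TM.finiteWork  = finiteWork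
  machine .TM.start       = inj₁ (entry F)
  machine .TM.accepting (inj₂ (inj₂ b)) = b
  machine .TM.accepting _               = false
  machine .TM.δ (inj₁ p)        γ = just (map₁ (maybe′ inj₁ (inj₂ (inj₁ tt))) (move F p γ))
  machine .TM.δ (inj₂ (inj₁ _)) γ = just (inj₂ (inj₂ (is-true (topBit (lookup γ (loc test))))) , stays γ)
  machine .TM.δ (inj₂ (inj₂ _)) γ = nothing

  path-run : ∀ {p ts t ts′} → Path F p ts t ts′ →
             Run machine (config (inj₁ p) ts) t (config (inj₂ (inj₁ tt)) ts′)
  path-run {ts = ts} (exit {p} e) =
    next (cong (λ z → just (config (maybe′ inj₁ (inj₂ (inj₁ tt)) z) (acts (proj₂ (move F p (heads ts))) ts))) e) done
  path-run {ts = ts} (next {p} e π) =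
    next (cong (λ z → just (config (maybe′ inj₁ (inj₂ (inj₁ tt)) z) (acts (proj₂ (move F p (heads ts))) ts))) e) (path-run π)

  initialTapes : Vec (Tape Work) tapes → Vec (Tape Work) K
  initialTapes ts = ts Vec.++ Vec.replicate V blankTape

  initialStacks : List Bool → Vec (List Bool) V
  initialStacks w = Vec.replicate V [] [ input ]≔ w

  Holds-initial : ∀ ts → Holds (initialStacks (readWord (Vec.head ts))) (initialTapes ts)
  Holds-initial (t ∷ ts) x with x Fin.≟ input
  ... | yes refl = sym (Vec.lookup∘updateAt input (Vec.replicate V []))
  ... | no x≢    = trans (cong readWord (trans (Vec.lookup-++ʳ ts (Vec.replicate V blankTape) x) (Vec.lookup-replicate x blankTape)))
                     (sym (trans (Vec.lookup∘updateAt′ x input x≢ (Vec.replicate V [])) (Vec.lookup-replicate x [])))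

  initial-machine : ∀ w → initial machine w ≡ config (inj₁ (inj₁ start)) (initialTapes (Config.contents (initial M w)))
  initial-machine w = cong (λ z → config (inj₁ (inj₁ start)) (writeWord w ∷ z)) (replicate-+ extraTapes V blankTape)

  output-zero : ∀ C → output machine C ≡ readWord (lookup (Config.contents C) (loc input))
  output-zero (config q (t ∷ ts)) = cong (λ z → readWord (lookup (t ∷ ts) z)) (sym loc-input)

  Result : (ℕ → Set) → Config M → Vec (List Bool) V → Config machine → Set
  Result ok C σ C′ =
    Halted machine C′ × TM.accepting machine (Config.state C′) ≡ is-true (List.head (lookup σ test)) ×
    output machine C′ ≡ lookup σ input ×
    (∀ s → (∀ n → ok n → n ≤ s) →
      Within s (initialStacks (output M C)) (initialTapes (Config.contents C)) →
      ∀ k → cells (lookup (Config.contents C′) k) ≤ suc s)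

  machine-run : ∀ {ok w t C u σ} → Run M (initial M w) t C → Halted M C →
                Eval ok P (initialStacks (output M C)) σ u →
                ∃[ t′ ] ∃[ C′ ] Run machine (initial machine w) t′ C′ × t′ ≤ suc (suc t + u) × Result ok C σ C′
  machine-run {ok} {w} {t} {C} {u} {σ} r h e with simulate e (initialTapes (Config.contents C)) (Holds-initial (Config.contents C))
  ... | ts , u′ , le , π , holds , within =
    suc (suc t + u′) , final ,
    subst (λ z → Run machine z (suc (suc t + u′)) final) (sym (initial-machine w))
      (Run-snoc (path-run (seq-path (lift-run _ r h) π)) (cong (just ∘ config (inj₂ (inj₂ b))) (acts-stays ts))) ,
    s≤s (ℕ.+-monoʳ-≤ (suc t) le) ,
    refl ,
    head-topBit σ ts test is-true holds refl ,
    trans (output-zero final) (holds input) ,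
    λ s os wi k → proj₁ (within s os wi) k
    where
    b = is-true (topBit (lookup (heads ts) (loc test)))
    final = config {machine} (inj₂ (inj₂ b)) ts

-- Determinism, space and output size of runs

Run-deterministic : ∀ {M C C₁ C₂ t u} → Run M C t C₁ → Halted M C₁ → Run M C u C₂ → ∃[ v ] Run M C₂ v C₁
Run-deterministic r          h done       = _ , r
Run-deterministic done       h (next e s) = contradiction (trans (sym h) e) λ ()
Run-deterministic (next e r) h (next f s) with refl ← Maybe.just-injective (trans (sym e) f) = Run-deterministic r h s

cells-act : ∀ {W} (a : Symbol W × Direction) (t : Tape W) → cells t ≤ cells (act a t)
cells-act (y , left)  (tape []       x rs)       = ℕ.n≤1+n _
cells-act (y , left)  (tape (l ∷ ls) x rs)       = ≤-reflexive (sym (ℕ.+-suc (length ls) _))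
cells-act (y , stay)  (tape ls x rs)             = ≤-refl
cells-act (y , right) (tape ls x [])             = ℕ.n≤1+n _
cells-act (y , right) (tape ls x (r ∷ rs))       = ≤-reflexive (ℕ.+-suc (length ls) _)

cells-acts : ∀ {W K} (as : Vec (Symbol W × Direction) K) (ts : Vec (Tape W) K) →
             Vec.sum (Vec.map cells ts) ≤ Vec.sum (Vec.map cells (acts as ts))
cells-acts []       []       = z≤n
cells-acts (a ∷ as) (t ∷ ts) = +-mono-≤ (cells-act a t) (cells-acts as ts)

space-step : ∀ M {C C′} → step M C ≡ just C′ → space M C ≤ space M C′
space-step M {config q ts} e with TM.δ M q (Vec.map Tape.head ts) | e
... | just (q′ , as) | refl = cells-acts as ts

-- Explored cells stay explored, so space never shrinks along a run. With determinism, a space bound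
-- for all reachable configurations reduces to one for the halting configuration.
space-run : ∀ {M C t C′} → Run M C t C′ → space M C ≤ space M C′
space-run         done       = ≤-refl
space-run {M = M} (next e r) = ≤-trans (space-step M e) (space-run r)

sum-bound : ∀ {K s} (ns : Vec ℕ K) → (∀ k → lookup ns k ≤ s) → Vec.sum ns ≤ K * s
sum-bound []       h = z≤n
sum-bound (n ∷ ns) h = +-mono-≤ (h zero) (sum-bound ns (h ∘ suc))

leadingBits-length : ∀ {W} (xs : List (Symbol W)) → length (leadingBits xs) ≤ length xs
leadingBits-length []            = z≤n
leadingBits-length (blank  ∷ xs) = z≤n
leadingBits-length (bit b  ∷ xs) = s≤s (leadingBits-length xs)
leadingBits-length (work w ∷ xs) = z≤n

readWord-length : ∀ {W} (t : Tape W) → length (readWord t) ≤ cells t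
readWord-length (tape ls x rs) = ≤-trans (leadingBits-length (x ∷ rs)) (m≤n+m _ (length ls))

leadingBits-bits : ∀ {W} w → leadingBits {W} (List.map bit w) ≡ w
leadingBits-bits []      = refl
leadingBits-bits (b ∷ w) = cong (b ∷_) (leadingBits-bits w)

readWord-writeWord : ∀ {W} w → readWord {W} (writeWord w) ≡ w
readWord-writeWord []      = refl
readWord-writeWord (b ∷ w) = cong (b ∷_) (leadingBits-bits w)

cells-act-≤ : ∀ {W} (a : Symbol W × Direction) (t : Tape W) → cells (act a t) ≤ suc (cells t)
cells-act-≤ (y , left)  (tape []       x rs)       = ≤-refl
cells-act-≤ (y , left)  (tape (l ∷ ls) x rs)       = ≤-trans (≤-reflexive (ℕ.+-suc (length ls) _)) (ℕ.n≤1+n _)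
cells-act-≤ (y , stay)  (tape ls x rs)             = ℕ.n≤1+n _
cells-act-≤ (y , right) (tape ls x [])             = ≤-refl
cells-act-≤ (y , right) (tape ls x (r ∷ rs))       = ≤-trans (≤-reflexive (sym (ℕ.+-suc (length ls) _))) (ℕ.n≤1+n _)

firstCells-step : ∀ M {C C′} → step M C ≡ just C′ →
                  cells (Vec.head (Config.contents C′)) ≤ suc (cells (Vec.head (Config.contents C)))
firstCells-step M {config q (t ∷ ts)} e with TM.δ M q (Vec.map Tape.head (t ∷ ts)) | e
... | just (q′ , a ∷ as) | refl = cells-act-≤ a t

firstCells-run : ∀ {M C t C′} → Run M C t C′ →
                 cells (Vec.head (Config.contents C′)) ≤ t + cells (Vec.head (Config.contents C))
firstCells-run done                           = ≤-refl
firstCells-run {M = M} (next {t = t} e r) = ≤-trans (firstCells-run r)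
  (≤-trans (ℕ.+-monoʳ-≤ t (firstCells-step M e)) (≤-reflexive (ℕ.+-suc t _)))

cells-writeWord : ∀ {W} w → cells {W} (writeWord w) ≤ suc (length w)
cells-writeWord []      = ≤-refl
cells-writeWord (b ∷ w) = s≤s (≤-trans (≤-reflexive (List.length-map bit w)) (ℕ.n≤1+n _))

-- A step explores at most one new cell of the first tape. This bounds the input of a program that
-- runs after a polynomial-time machine.
output-length : ∀ {M w t C} → Run M (initial M w) t C → length (output M C) ≤ t + suc (length w)
output-length {M} {w} {t} {C} r = ≤-trans (readWord-length (Vec.head (Config.contents C)))
  (≤-trans (firstCells-run r) (ℕ.+-monoʳ-≤ t (cells-writeWord {TM.Work M} w)))

-- Polynomial bounds

-- Bounds are expressions closed under composition, so that costs can be defined along the syntax of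
-- programs. Coefficients appear only when a bound is handed to the definitions of the complexity
-- classes.
data Cost : Set where
  var : Cost
  con : ℕ → Cost
  _⊞_ _⊠_ _⊚_ : Cost → Cost → Cost

infixr 6 _⊞_
infixr 7 _⊠_
infixr 8 _⊚_

_at_ : Cost → ℕ → ℕ
var     at n = n
con k   at n = k
(c ⊞ d) at n = c at n + d at n
(c ⊠ d) at n = c at n * d at n
(c ⊚ d) at n = c at (d at n)

addP : Polynomial → Polynomial → Polynomial
addP []       q       = q
addP (a ∷ p)  []      = a ∷ p
addP (a ∷ p)  (b ∷ q) = a + b ∷ addP p q

mulP : Polynomial → Polynomial → Polynomial
mulP []      q = []
mulP (a ∷ p) q = addP (List.map (a *_) q) (0 ∷ mulP p q)

compP : Polynomial → Polynomial → Polynomial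
compP []      q = []
compP (a ∷ p) q = addP (a ∷ []) (mulP q (compP p q))

⟦addP⟧ : ∀ p q n → ⟦ addP p q ⟧ n ≡ ⟦ p ⟧ n + ⟦ q ⟧ n
⟦addP⟧ []      q       n = refl
⟦addP⟧ (a ∷ p) []      n = sym (ℕ.+-identityʳ _)
⟦addP⟧ (a ∷ p) (b ∷ q) n = trans (cong (λ z → a + b + n * z) (⟦addP⟧ p q n)) (shuffle a b n (⟦ p ⟧ n) (⟦ q ⟧ n))
  where
  shuffle : ∀ a b n x y → a + b + n * (x + y) ≡ a + n * x + (b + n * y)
  shuffle = solve-∀

⟦scale⟧ : ∀ a q n → ⟦ List.map (a *_) q ⟧ n ≡ a * ⟦ q ⟧ n
⟦scale⟧ a []      n = sym (ℕ.*-zeroʳ a)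
⟦scale⟧ a (b ∷ q) n = trans (cong (λ z → a * b + n * z) (⟦scale⟧ a q n)) (shuffle a b n (⟦ q ⟧ n))
  where
  shuffle : ∀ a b n x → a * b + n * (a * x) ≡ a * (b + n * x)
  shuffle = solve-∀

⟦mulP⟧ : ∀ p q n → ⟦ mulP p q ⟧ n ≡ ⟦ p ⟧ n * ⟦ q ⟧ n
⟦mulP⟧ []      q n = refl
⟦mulP⟧ (a ∷ p) q n = trans (⟦addP⟧ (List.map (a *_) q) (0 ∷ mulP p q) n)
  (trans (cong₂ (λ x y → x + n * y) (⟦scale⟧ a q n) (⟦mulP⟧ p q n)) (shuffle a n (⟦ p ⟧ n) (⟦ q ⟧ n)))
  where
  shuffle : ∀ a n x y → a * y + n * (x * y) ≡ (a + n * x) * y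
  shuffle = solve-∀

⟦compP⟧ : ∀ p q n → ⟦ compP p q ⟧ n ≡ ⟦ p ⟧ (⟦ q ⟧ n)
⟦compP⟧ []      q n = refl
⟦compP⟧ (a ∷ p) q n = trans (⟦addP⟧ (a ∷ []) (mulP q (compP p q)) n)
  (cong₂ _+_ (trans (cong (a +_) (ℕ.*-zeroʳ n)) (ℕ.+-identityʳ a))
    (trans (⟦mulP⟧ q (compP p q) n) (cong (⟦ q ⟧ n *_) (⟦compP⟧ p q n))))

fromPoly : Polynomial → Cost
fromPoly []      = con 0
fromPoly (a ∷ p) = con a ⊞ (var ⊠ fromPoly p)

fromPoly-at : ∀ p n → fromPoly p at n ≡ ⟦ p ⟧ n
fromPoly-at []      n = refl
fromPoly-at (a ∷ p) n = cong (λ z → a + n * z) (fromPoly-at p n)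

toPoly : Cost → Polynomial
toPoly var     = 0 ∷ 1 ∷ []
toPoly (con k) = k ∷ []
toPoly (c ⊞ d) = addP (toPoly c) (toPoly d)
toPoly (c ⊠ d) = mulP (toPoly c) (toPoly d)
toPoly (c ⊚ d) = compP (toPoly c) (toPoly d)

toPoly-at : ∀ c n → ⟦ toPoly c ⟧ n ≡ c at n
toPoly-at var     n = trans (cong (n *_) (cong suc (ℕ.*-zeroʳ n))) (ℕ.*-identityʳ n)
toPoly-at (con k) n = trans (cong (k +_) (ℕ.*-zeroʳ n)) (ℕ.+-identityʳ k)
toPoly-at (c ⊞ d) n = trans (⟦addP⟧ (toPoly c) (toPoly d) n) (cong₂ _+_ (toPoly-at c n) (toPoly-at d n))
toPoly-at (c ⊠ d) n = trans (⟦mulP⟧ (toPoly c) (toPoly d) n) (cong₂ _*_ (toPoly-at c n) (toPoly-at d n))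
toPoly-at (c ⊚ d) n = trans (⟦compP⟧ (toPoly c) (toPoly d) n)
  (trans (toPoly-at c (⟦ toPoly d ⟧ n)) (cong (c at_) (toPoly-at d n)))

-- Moving, counting and looping on stacks

ones : ℕ → List Bool
ones n = List.replicate n true

nonempty : Maybe Bool → Bool
nonempty (just _) = true
nonempty nothing  = false

-- Reading past the end yields `false`; a numeral with its least significant bit first can thus be
-- read at any larger width.
nth : List Bool → ℕ → Bool
nth xs n = is-true (List.head (List.drop n xs))

positive : ℕ → Bool
positive zero    = false
positive (suc _) = true

b2n : Bool → ℕ
b2n true  = 1
b2n false = 0

count : ℕ → (ℕ → Bool) → ℕ
count zero    f = 0
count (suc n) f = b2n (f n) + count n f

concatBelow : ℕ → (ℕ → List Bool) → List Bool
concatBelow zero    g = []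
concatBelow (suc n) g = concatBelow n g ++ g n

ones-snoc : ∀ n l → ones n ++ true ∷ l ≡ true ∷ ones n ++ l
ones-snoc zero    l = refl
ones-snoc (suc n) l = cong (true ∷_) (ones-snoc n l)

reach : ∀ {V ok} {P : Cmd V} {σ σ₁ σ₂ t} → σ₁ ≡ σ₂ → Eval ok P σ σ₁ t → Eval ok P σ σ₂ t
reach refl e = e

module _ {V : ℕ} where

  moveOne moveAll : Fin V → Fin V → Cmd V
  moveOne a b = ifs a is-true (pop a ⨾ push b true) (pop a ⨾ push b false)
  moveAll a b = while a nonempty (moveOne a b)

  module _ {a b : Fin V} (a≢b : a ≢ b) where

    eval-pop-push : ∀ τ {x xs} → lookup τ a ≡ x ∷ xs →
      Eval Free (pop a ⨾ push b x) τ ((τ [ a ]≔ xs) [ b ]≔ (x ∷ lookup τ b)) 3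
    eval-pop-push τ {x} {xs} e = reach
      (trans (cong (λ l → (τ [ a ]≔ List.drop 1 (lookup τ a)) [ b ]≔ (x ∷ l)) (Vec.lookup∘updateAt′ b a (a≢b ∘ sym) τ))
             (cong (λ l → (τ [ a ]≔ List.drop 1 l) [ b ]≔ (x ∷ lookup τ b)) e))
      (e-seq e-pop (e-push tt))

    eval-moveOne : ∀ τ {x xs} → lookup τ a ≡ x ∷ xs →
      Eval Free (moveOne a b) τ ((τ [ a ]≔ xs) [ b ]≔ (x ∷ lookup τ b)) 4
    eval-moveOne τ {true}  e = e-then (cong (is-true ∘ List.head) e) (eval-pop-push τ e)
    eval-moveOne τ {false} e = e-else (cong (is-true ∘ List.head) e) (eval-pop-push τ e)

    eval-moveAll : ∀ xs τ → lookup τ a ≡ xs →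
      Eval Free (moveAll a b) τ ((τ [ a ]≔ []) [ b ]≔ (xs ʳ++ lookup τ b)) (suc (length xs * 5))
    eval-moveAll [] τ e = reach (sym restored) (e-end (cong (nonempty ∘ List.head) e))
      where
      restored : (τ [ a ]≔ []) [ b ]≔ lookup τ b ≡ τ
      restored = trans (cong (λ l → (τ [ a ]≔ l) [ b ]≔ lookup τ b) (sym e))
        (trans (cong (_[ b ]≔ lookup τ b) (Vec.[]≔-lookup τ a)) (Vec.[]≔-lookup τ b))
    eval-moveAll (x ∷ xs) τ e = reach same
      (e-loop (cong (nonempty ∘ List.head) e) (eval-moveOne τ e) (eval-moveAll xs τ₁ at-a))
      where
      τ₁ = (τ [ a ]≔ xs) [ b ]≔ (x ∷ lookup τ b)
      at-a : lookup τ₁ a ≡ xs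
      at-a = trans (Vec.lookup∘updateAt′ a b a≢b (τ [ a ]≔ xs)) (Vec.lookup∘updateAt a τ)
      same : (τ₁ [ a ]≔ []) [ b ]≔ (xs ʳ++ lookup τ₁ b) ≡ (τ [ a ]≔ []) [ b ]≔ ((x ∷ xs) ʳ++ lookup τ b)
      same = trans (cong (λ l → (τ₁ [ a ]≔ []) [ b ]≔ (xs ʳ++ l)) (Vec.lookup∘updateAt b (τ [ a ]≔ xs)))
        (trans (cong (_[ b ]≔ _) (trans (Vec.[]≔-commutes (τ [ a ]≔ xs) b a (a≢b ∘ sym))
                                        (cong (_[ b ]≔ _) (Vec.[]≔-idempotent τ a))))
               (Vec.[]≔-idempotent (τ [ a ]≔ []) b))

-- Registers: values of formulas and unary numerals, loop counters,
-- scratch, output; the last three serve the evaluation of quantifiers.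
vE vL vT vO vX vQ vY : ∀ {m} → Fin (7 + m)
vE = zero
vL = suc zero
vT = suc (suc zero)
vO = suc (suc (suc zero))
vX = suc (suc (suc (suc zero)))
vQ = suc (suc (suc (suc (suc zero))))
vY = suc (suc (suc (suc (suc (suc zero)))))

timesC : Cost → Cost
timesC c = con 6 ⊞ var ⊠ (con 14 ⊞ c)

times-cost : ∀ n c → 2 + ((suc (n * 5) + suc (n * 7)) + (suc (n * (2 + c)) + 1)) ≡ 6 + n * (14 + c)
times-cost = solve-∀

module _ {m : ℕ} where

  count⇒L : Fin (4 + m) → Cmd (7 + m)
  count⇒L j = moveAll (3 Fin.↑ʳ j) vT ⨾ while vT nonempty (moveOne vT (3 Fin.↑ʳ j) ⨾ push vL true)

  -- The register `vL` is a stack of unary loop counters, each resting on a `false`, so a single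
  -- register serves loops of any nesting. The counter is made beforehand by moving stack `j` away
  -- and back, and the body need not preserve `j`.
  times : Fin (4 + m) → Cmd (7 + m) → Cmd (7 + m)
  times j B = push vL false ⨾ count⇒L j ⨾ while vL is-true (pop vL ⨾ B) ⨾ pop vL

  eval-back : ∀ j zs {e l} (r : Vec (List Bool) (4 + m)) →
    Eval Free (while vT nonempty (moveOne vT (3 Fin.↑ʳ j) ⨾ push vL true)) (e ∷ l ∷ zs ∷ r)
      (e ∷ (ones (length zs) ++ l) ∷ [] ∷ r [ j ]≔ (zs ʳ++ lookup r j)) (suc (length zs * 7))
  eval-back j []       r = reach (cong (λ r → _ ∷ _ ∷ [] ∷ r) (sym (Vec.[]≔-lookup r j))) (e-end refl)
  eval-back j (z ∷ zs) {e} {l} r = reach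
    (cong₂ (λ l r → e ∷ l ∷ [] ∷ r) (ones-snoc (length zs) l)
      (trans (Vec.[]≔-idempotent r j) (cong (λ l → r [ j ]≔ (zs ʳ++ l)) (Vec.lookup∘updateAt j r))))
    (e-loop refl (e-seq (eval-moveOne (λ ()) (e ∷ l ∷ (z ∷ zs) ∷ r) refl) (e-push tt))
      (eval-back j zs (r [ j ]≔ (z ∷ lookup r j))))

  eval-count⇒L : ∀ j {e l} (r : Vec (List Bool) (4 + m)) n → length (lookup r j) ≡ n →
    Eval Free (count⇒L j) (e ∷ l ∷ [] ∷ r) (e ∷ (ones n ++ l) ∷ [] ∷ r) (suc (n * 5) + suc (n * 7))
  eval-count⇒L j {e} {l} r n refl = reach
    (cong₂ (λ k r → e ∷ (ones k ++ l) ∷ [] ∷ r) len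
      (trans (Vec.[]≔-idempotent r j) (trans (cong (r [ j ]≔_) same) (Vec.[]≔-lookup r j))))
    (e-seq (eval-moveAll (λ ()) xs (e ∷ l ∷ [] ∷ r) refl)
      (e-weak (≤-reflexive (cong (λ k → suc (k * 7)) len)) (eval-back j (xs ʳ++ []) (r [ j ]≔ []))))
    where
    xs = lookup r j
    len : length (xs ʳ++ []) ≡ length xs
    len = trans (List.length-ʳ++ xs) (ℕ.+-identityʳ _)
    same : (xs ʳ++ []) ʳ++ lookup (r [ j ]≔ []) j ≡ xs
    same = trans (cong ((xs ʳ++ []) ʳ++_) (Vec.lookup∘updateAt j r))
      (trans (List.ʳ++-ʳ++ xs) (List.++-identityʳ xs))

  eval-iterate : ∀ n (e : ℕ → List Bool) (r : ℕ → Vec (List Bool) (4 + m)) {B c l} →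
    (∀ k l → k < n → Eval Free B (e k ∷ l ∷ [] ∷ r k) (e (suc k) ∷ l ∷ [] ∷ r (suc k)) c) →
    Eval Free (while vL is-true (pop vL ⨾ B)) (e 0 ∷ (ones n ++ false ∷ l) ∷ [] ∷ r 0)
      (e n ∷ (false ∷ l) ∷ [] ∷ r n) (suc (n * (2 + c)))
  eval-iterate zero    e r h = e-end refl
  eval-iterate (suc n) e r {c = c} h =
    e-weak (≤-reflexive (cong suc (ℕ.+-suc (suc c) (n * (2 + c)))))
      (e-loop refl (e-seq e-pop (h 0 _ (s≤s z≤n)))
        (eval-iterate n (e ∘ suc) (r ∘ suc) (λ k l k<n → h (suc k) l (s≤s k<n))))

  eval-times : ∀ j n (e : ℕ → List Bool) (r : ℕ → Vec (List Bool) (4 + m)) {B s l} c →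
    length (lookup (r 0) j) ≡ n → n ≤ s →
    (∀ k l → k < n → Eval Free B (e k ∷ l ∷ [] ∷ r k) (e (suc k) ∷ l ∷ [] ∷ r (suc k)) (c at s)) →
    Eval Free (times j B) (e 0 ∷ l ∷ [] ∷ r 0) (e n ∷ l ∷ [] ∷ r n) (timesC c at s)
  eval-times j n e r {s = s} c eq le h =
    e-weak (≤-trans (≤-reflexive (times-cost n (c at s))) (ℕ.+-monoʳ-≤ 6 (ℕ.*-monoˡ-≤ _ le)))
      (e-seq (e-push tt) (e-seq (eval-count⇒L j (r 0) n eq) (e-seq (eval-iterate n e r h) e-pop)))

-- A query language on lists of bits

data Term (R D : ℕ) : Set where
  len     : Fin R → Term R D
  var     : Fin D → Term R D
  one     : Term R D
  _⊕_ _⊗_ : Term R D → Term R D → Term R D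

-- `fewer i r φ ψ` says that the i below the length of r that satisfy φ are
-- fewer than twice those that satisfy ψ; quantifiers are special cases.
data Formula (R D : ℕ) : Set where
  bitAt : Fin R → Term R D → Formula R D
  _≺_   : Term R D → Term R D → Formula R D
  neg   : Formula R D → Formula R D
  _&_   : Formula R D → Formula R D → Formula R D
  fewer : Fin D → Fin R → Formula R D → Formula R D → Formula R D

data Gen (R D : ℕ) : Set where
  emit : Formula R D → Gen R D
  _▸_  : Gen R D → Gen R D → Gen R D
  for  : Fin D → Fin R → Gen R D → Gen R D
  when : Formula R D → Gen R D → Gen R D

infixl 7 _⊗_
infixl 6 _⊕_
infix  5 _≺_
infixr 4 _&_
infixr 3 _▸_

module _ {R D : ℕ} (ρ : Vec (List Bool) R) where

  val : Term R D → Vec ℕ D → ℕ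
  val (len r) ι = length (lookup ρ r)
  val (var i) ι = lookup ι i
  val one     ι = 1
  val (p ⊕ q) ι = val p ι + val q ι
  val (p ⊗ q) ι = val p ι * val q ι

  -- A bound variable starts from its value outside the binder, which is 0
  -- as long as no binder is nested in another one for the same variable.
  holds : Formula R D → Vec ℕ D → Bool
  holds (bitAt r p)     ι = nth (lookup ρ r) (val p ι)
  holds (p ≺ q)         ι = val p ι <ᵇ val q ι
  holds (neg φ)         ι = not (holds φ ι)
  holds (φ & ψ)         ι = holds φ ι ∧ holds ψ ι
  holds (fewer i r φ ψ) ι =
    count (length (lookup ρ r)) (λ k → holds φ (ι [ i ]≔ (lookup ι i + k))) <ᵇ
    count (length (lookup ρ r)) (λ k → holds ψ (ι [ i ]≔ (lookup ι i + k))) +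
    count (length (lookup ρ r)) (λ k → holds ψ (ι [ i ]≔ (lookup ι i + k)))

  list : Gen R D → Vec ℕ D → List Bool
  list (emit φ)    ι = holds φ ι ∷ []
  list (G ▸ H)     ι = list G ι ++ list H ι
  list (for i r G) ι = concatBelow (length (lookup ρ r)) (λ k → list G (ι [ i ]≔ (lookup ι i + k)))
  list (when φ G)  ι = if holds φ ι then list G ι else []

-- Evaluation of queries by stack programs

Frame : Set
Frame = List Bool × List Bool × List Bool

skip1 : ∀ {m} → Fin (4 + m) → Cmd (7 + m)
skip1 j = ifs (3 Fin.↑ʳ j) nonempty (moveOne (3 Fin.↑ʳ j) vT) (pop (3 Fin.↑ʳ j))

eval-skip : ∀ {m} (j : Fin (4 + m)) n {e l ys} (r : Vec (List Bool) (4 + m)) →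
  Eval Free (while vE is-true (pop vE ⨾ skip1 j)) ((ones n ++ false ∷ e) ∷ l ∷ ys ∷ r)
    ((false ∷ e) ∷ l ∷ (List.take n (lookup r j) ʳ++ ys) ∷ r [ j ]≔ List.drop n (lookup r j)) (suc (n * 7))
eval-skip j zero r = reach (cong (λ r → _ ∷ _ ∷ _ ∷ r) (sym (Vec.[]≔-lookup r j))) (e-end refl)
eval-skip j (suc n) {e} {l} {ys} r with lookup r j in eq
... | [] = reach
  (cong₂ (λ zs r → (false ∷ e) ∷ l ∷ zs ∷ r)
    (cong (_ʳ++ ys) (trans (cong (List.take n) at-j) (List.take-[] n)))
    (trans (Vec.[]≔-idempotent r j) (cong (r [ j ]≔_) (trans (cong (List.drop n) at-j) (List.drop-[] n)))))
  (e-loop refl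
    (e-seq e-pop (e-weak {u = 5} (s≤s (s≤s z≤n)) (e-else (cong (nonempty ∘ List.head) eq) e-pop)))
    (eval-skip j n (r [ j ]≔ List.drop 1 (lookup r j))))
  where
  at-j : lookup (r [ j ]≔ List.drop 1 (lookup r j)) j ≡ []
  at-j = trans (Vec.lookup∘updateAt j r) (cong (List.drop 1) eq)
... | x ∷ xs = reach
  (cong₂ (λ zs r → (false ∷ e) ∷ l ∷ zs ∷ r)
    (cong (λ zs → List.take n zs ʳ++ (x ∷ ys)) (Vec.lookup∘updateAt j r))
    (trans (Vec.[]≔-idempotent r j) (cong (λ zs → r [ j ]≔ List.drop n zs) (Vec.lookup∘updateAt j r))))
  (e-loop refl
    (e-seq e-pop (e-then (cong (nonempty ∘ List.head) eq) (eval-moveOne (λ ()) ((ones n ++ false ∷ e) ∷ l ∷ ys ∷ r) eq)))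
    (eval-skip j n (r [ j ]≔ xs)))

nop : ∀ {m} → Cmd (7 + m)
nop = pop vT

decrement : ∀ {m} → Cmd (7 + m)
decrement = ifs vE is-true (pop vE) nop

finish : ∀ {m} → Cmd (7 + m)
finish = ifs vE is-true ((while vE is-true (pop vE) ⨾ pop vE) ⨾ push vE true) (pop vE ⨾ push vE false)

module _ {m : ℕ} {r : Vec (List Bool) (4 + m)} where

  eval-decrement : ∀ n {e l} →
    Eval Free decrement ((ones n ++ false ∷ e) ∷ l ∷ [] ∷ r) ((ones (n ∸ 1) ++ false ∷ e) ∷ l ∷ [] ∷ r) 2
  eval-decrement zero    = e-else refl e-pop
  eval-decrement (suc n) = e-then refl e-pop

  eval-clear : ∀ n {e l} →
    Eval Free (while vE is-true (pop vE)) ((ones n ++ false ∷ e) ∷ l ∷ [] ∷ r) ((false ∷ e) ∷ l ∷ [] ∷ r) (suc (n * 2))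
  eval-clear zero    = e-end refl
  eval-clear (suc n) = e-loop refl e-pop (eval-clear n)

  eval-finish : ∀ n {e l} →
    Eval Free finish ((ones n ++ false ∷ e) ∷ l ∷ [] ∷ r) ((positive n ∷ e) ∷ l ∷ [] ∷ r) (5 + n * 2)
  eval-finish zero    = e-weak (s≤s (s≤s (s≤s (s≤s z≤n)))) (e-else refl (e-seq e-pop (e-push tt)))
  eval-finish (suc n) = e-weak (≤-reflexive (arith n))
    (e-then refl (e-seq (e-seq (eval-clear (suc n)) e-pop) (e-push tt)))
    where
    arith : ∀ n → suc (suc (suc n * 2) + 1 + 2) ≡ 5 + suc n * 2
    arith = solve-∀

positive-∸ : ∀ p q → positive (q ∸ p) ≡ (p <ᵇ q)
positive-∸ zero    zero    = refl
positive-∸ zero    (suc q) = refl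
positive-∸ (suc p) zero    = refl
positive-∸ (suc p) (suc q) = positive-∸ p q

∸-suc : ∀ n k → k < n → n ∸ k ≡ suc (n ∸ suc k)
∸-suc (suc n) zero    _       = refl
∸-suc (suc n) (suc k) (s≤s h) = ∸-suc n k h

module _ {R D : ℕ} where

  valC : Term R D → Cost
  valC (len r) = var
  valC (var i) = var
  valC one     = con 1
  valC (p ⊕ q) = valC p ⊞ valC q
  valC (p ⊗ q) = valC p ⊠ valC q

  loopC : Term R D → Cost → Cost
  loopC (len r) c = timesC c
  loopC (var i) c = timesC c
  loopC one     c = c
  loopC (p ⊕ q) c = loopC p c ⊞ loopC q c
  loopC (p ⊗ q) c = loopC p (loopC q c)

  forC : Cost → Cost
  forC c = timesC (c ⊞ con 2) ⊞ timesC (con 1)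

  formulaC : Formula R D → Cost
  formulaC (bitAt r p) = con 2 ⊞ loopC p (con 2) ⊞ (con 1 ⊞ valC p ⊠ con 7) ⊞ con 1 ⊞ con 3 ⊞ (con 1 ⊞ var ⊠ con 5)
  formulaC (p ≺ q) = con 2 ⊞ loopC q (con 2) ⊞ loopC p (con 2) ⊞ (con 5 ⊞ valC q ⊠ con 2)
  formulaC (neg φ) = formulaC φ ⊞ con 4
  formulaC (φ & ψ) = formulaC φ ⊞ con 1 ⊞ (con 1 ⊞ formulaC ψ)
  formulaC (fewer i r φ ψ) =
    con 2 ⊞ forC (formulaC ψ ⊚ (var ⊞ var) ⊞ con 6) ⊞ forC (formulaC φ ⊚ (var ⊞ var) ⊞ con 4) ⊞
    (con 5 ⊞ (var ⊞ var) ⊠ con 2)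

  genC : Gen R D → Cost
  genC (emit φ)    = formulaC φ ⊞ con 4
  genC (G ▸ H)     = genC G ⊞ genC H
  genC (for i r G) = forC (genC G ⊚ (var ⊞ var))
  genC (when φ G)  = formulaC φ ⊞ con 1 ⊞ (con 1 ⊞ genC G)

  rd : Fin R → Fin (4 + (R + D))
  rd r = 4 Fin.↑ʳ (r ↑ˡ D)

  ix : Fin D → Fin (4 + (R + D))
  ix i = 4 Fin.↑ʳ (R ↑ʳ i)

  Command : Set
  Command = Cmd (7 + (R + D))

  -- Terms are never computed as numbers: a sum becomes a sequence of loops and a product a nesting.
  -- Pushing `true` as the body writes the value in unary, decrementing as the body subtracts it.
  loop : Term R D → Command → Command
  loop (len r) B = times (rd r) B
  loop (var i) B = times (ix i) B
  loop one     B = B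
  loop (p ⊕ q) B = loop p B ⨾ loop q B
  loop (p ⊗ q) B = loop p (loop q B)

  -- The index register gains one unit after each pass, and the second loop removes these units
  -- again. So the index counts up from its outer value and is restored to it.
  forEach : Fin D → Fin R → Command → Command
  forEach i r B = times (rd r) (B ⨾ push (3 Fin.↑ʳ ix i) true) ⨾ times (rd r) (pop (3 Fin.↑ʳ ix i))

  formula : Formula R D → Command
  -- The unary value of `p` is the number of bits to skip onto `vT`. Once the exposed bit has been
  -- inspected, moving them back restores the list in its order.
  formula (bitAt r p) =
    push vE false ⨾ loop p (push vE true) ⨾ while vE is-true (pop vE ⨾ skip1 (rd r)) ⨾ pop vE ⨾
    ifs (3 Fin.↑ʳ rd r) is-true (push vE true) (push vE false) ⨾ moveAll vT (3 Fin.↑ʳ rd r)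
  formula (p ≺ q) = push vE false ⨾ loop q (push vE true) ⨾ loop p decrement ⨾ finish
  formula (neg φ) = formula φ ⨾ ifs vE is-true (pop vE ⨾ push vE false) (pop vE ⨾ push vE true)
  formula (φ & ψ) = formula φ ⨾ ifs vE is-true (pop vE ⨾ formula ψ) nop
  -- On a unary counter, each witness of `ψ` adds two and each witness of `φ` removes one.
  -- Truncation at zero does no harm, since only positivity is tested in the end.
  formula (fewer i r φ ψ) =
    push vE false ⨾
    forEach i r (formula ψ ⨾ ifs vE is-true (pop vE ⨾ push vE true ⨾ push vE true) (pop vE)) ⨾
    forEach i r (formula φ ⨾ ifs vE is-true (pop vE ⨾ decrement) (pop vE)) ⨾
    finish

  generate : Gen R D → Command
  generate (emit φ)    = formula φ ⨾ ifs vE is-true (pop vE ⨾ push vO true) (pop vE ⨾ push vO false)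
  generate (G ▸ H)     = generate G ⨾ generate H
  generate (for i r G) = forEach i r (generate G)
  generate (when φ G)  = formula φ ⨾ ifs vE is-true (pop vE ⨾ generate G) (pop vE)

  -- The frame holds `vX`, `vQ` and `vY`, which formulas and generators carry along untouched.
  rest : List Bool → Frame → Vec (List Bool) R → Vec ℕ D → Vec (List Bool) (4 + (R + D))
  rest o (x , q , y) ρ ι = o ∷ x ∷ q ∷ y ∷ (ρ Vec.++ Vec.map ones ι)

  st : List Bool → List Bool → List Bool → Frame → Vec (List Bool) R → Vec ℕ D → Vec (List Bool) (7 + (R + D))
  st e l o κ ρ ι = e ∷ l ∷ [] ∷ rest o κ ρ ι

  record Bounded (s : ℕ) (ρ : Vec (List Bool) R) (ι : Vec ℕ D) : Set where
    constructor bounded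
    field
      reads   : ∀ r → length (lookup ρ r) ≤ s
      indices : ∀ i → lookup ι i ≤ s

  open Bounded

  -- An index starts at an outer value of at most `s` and advances by at most `s`. This doubling is
  -- the origin of `var ⊞ var` in the costs of binders.
  Bounded-≔ : ∀ {s ρ ι k} i → Bounded s ρ ι → k ≤ s → Bounded (s + s) ρ (ι [ i ]≔ (lookup ι i + k))
  Bounded-≔ {s} {ι = ι} i (bounded b c) k≤s = bounded (λ r → ≤-trans (b r) (m≤m+n s s))
    (lookup-≔ (λ _ v → v ≤ s + s) ι i _ (+-mono-≤ (c i) k≤s) (λ j _ → ≤-trans (c j) (m≤m+n s s)))

  lookup-rd : ∀ (ρ : Vec (List Bool) R) ι r → lookup (ρ Vec.++ Vec.map ones ι) (r ↑ˡ D) ≡ lookup ρ r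
  lookup-rd ρ ι r = Vec.lookup-++ˡ ρ (Vec.map ones ι) r

  lookup-ix : ∀ (ρ : Vec (List Bool) R) (ι : Vec ℕ D) i → lookup (ρ Vec.++ Vec.map ones ι) (R ↑ʳ i) ≡ ones (lookup ι i)
  lookup-ix ρ ι i = trans (Vec.lookup-++ʳ ρ (Vec.map ones ι) i) (Vec.lookup-map i ones ι)

  rest-ix : ∀ {o} {κ : Frame} ρ ι i v → rest o κ ρ ι [ ix i ]≔ ones v ≡ rest o κ ρ (ι [ i ]≔ v)
  rest-ix ρ ι i v = cong (λ z → _ ∷ _ ∷ _ ∷ _ ∷ z)
    (trans (Vec.[]≔-++-↑ʳ ρ (Vec.map ones ι) i) (cong (ρ Vec.++_) (sym (Vec.map-[]≔ ones ι i))))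

  eval-loop : ∀ p {s l o κ ρ ι B} c (e : ℕ → List Bool) → Bounded s ρ ι →
    (∀ k l → Eval Free B (st (e k) l o κ ρ ι) (st (e (suc k)) l o κ ρ ι) (c at s)) →
    ∀ k → Eval Free (loop p B) (st (e k) l o κ ρ ι) (st (e (val ρ p ι + k)) l o κ ρ ι) (loopC p c at s)
  eval-loop (len r) {ρ = ρ} {ι} c e b h k =
    eval-times (rd r) (length (lookup ρ r)) (λ j → e (j + k)) (λ _ → _) c
      (cong length (lookup-rd ρ ι r)) (reads b r) (λ j l _ → h (j + k) l)
  eval-loop (var i) {ρ = ρ} {ι} c e b h k =
    eval-times (ix i) (lookup ι i) (λ j → e (j + k)) (λ _ → _) c
      (trans (cong length (lookup-ix ρ ι i)) (List.length-replicate (lookup ι i))) (indices b i) (λ j l _ → h (j + k) l)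
  eval-loop one c e b h k = h k _
  eval-loop (p ⊕ q) {l = l} {o} {κ} {ρ} {ι} c e b h k = reach
    (cong (λ n → st (e n) l o κ ρ ι) (arith (val ρ p ι) (val ρ q ι) k))
    (e-seq (eval-loop p c e b h k) (eval-loop q c e b h (val ρ p ι + k)))
    where
    arith : ∀ p q k → q + (p + k) ≡ p + q + k
    arith = solve-∀
  eval-loop (p ⊗ q) {l = l} {o} {κ} {ρ} {ι} c e b h k = reach
    (cong (λ n → st (e (n * val ρ q ι + k)) l o κ ρ ι) (ℕ.+-identityʳ (val ρ p ι)))
    (eval-loop p (loopC q c) (λ j → e (j * val ρ q ι + k)) b
      (λ j l → reach (cong (λ n → st (e n) l o κ ρ ι) (sym (ℕ.+-assoc (val ρ q ι) (j * val ρ q ι) k)))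
        (eval-loop q c e b h (j * val ρ q ι + k))) 0)

  eval-forEach : ∀ i r {s l κ ρ ι B} c (e o : ℕ → List Bool) → Bounded s ρ ι →
    (∀ k l → k < length (lookup ρ r) →
      Eval Free B (st (e k) l (o k) κ ρ (ι [ i ]≔ (lookup ι i + k)))
        (st (e (suc k)) l (o (suc k)) κ ρ (ι [ i ]≔ (lookup ι i + k))) (c at s)) →
    Eval Free (forEach i r B) (st (e 0) l (o 0) κ ρ ι)
      (st (e (length (lookup ρ r))) l (o (length (lookup ρ r))) κ ρ ι) (forC c at s)
  eval-forEach i r {s} {l} {κ} {ρ} {ι} {B} c e o b h = subst
    (λ j → Eval Free (forEach i r B) (st (e 0) l (o 0) κ ρ j) (st (e n) l (o n) κ ρ ι) (forC c at s)) at-0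
    (e-seq
      (eval-times (rd r) n e (λ k → rest (o k) κ ρ (at-k k)) (c ⊞ con 2)
        (cong length (lookup-rd ρ (at-k 0) r)) (reads b r)
        (λ k l k<n → reach (cong (λ z → e (suc k) ∷ l ∷ [] ∷ z) (up k)) (e-seq (h k l k<n) (e-push tt))))
      (reach (cong (st (e n) l (o n) κ ρ) (trans (cong at-k (ℕ.n∸n≡0 n)) at-0))
        (eval-times (rd r) n (λ _ → e n) (λ k → rest (o n) κ ρ (at-k (n ∸ k))) (con 1)
          (cong length (lookup-rd ρ (at-k n) r)) (reads b r)
          (λ k l k<n → reach (cong (λ z → e n ∷ l ∷ [] ∷ z) (down k k<n)) e-pop))))
    where
    n = length (lookup ρ r)
    at-k : ℕ → Vec ℕ D
    at-k k = ι [ i ]≔ (lookup ι i + k)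
    at-0 : at-k 0 ≡ ι
    at-0 = trans (cong (ι [ i ]≔_) (ℕ.+-identityʳ _)) (Vec.[]≔-lookup ι i)
    lookup-at : ∀ k → lookup (ρ Vec.++ Vec.map ones (at-k k)) (R ↑ʳ i) ≡ ones (lookup ι i + k)
    lookup-at k = trans (lookup-ix ρ (at-k k) i) (cong ones (Vec.lookup∘updateAt i ι))
    set-at : ∀ k {o} v → rest o κ ρ (at-k k) [ ix i ]≔ ones v ≡ rest o κ ρ (ι [ i ]≔ v)
    set-at k v = trans (rest-ix ρ (at-k k) i v) (cong (rest _ κ ρ) (Vec.[]≔-idempotent ι i))
    up : ∀ k → rest (o (suc k)) κ ρ (at-k k) [ ix i ]≔ (true ∷ lookup (rest (o (suc k)) κ ρ (at-k k)) (ix i)) ≡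
               rest (o (suc k)) κ ρ (at-k (suc k))
    up k = trans (cong (λ z → rest (o (suc k)) κ ρ (at-k k) [ ix i ]≔ (true ∷ z)) (lookup-at k))
      (trans (set-at k (suc (lookup ι i + k))) (cong (λ z → rest (o (suc k)) κ ρ (ι [ i ]≔ z)) (sym (ℕ.+-suc _ k))))
    down : ∀ k → k < n → rest (o n) κ ρ (at-k (n ∸ k)) [ ix i ]≔ List.drop 1 (lookup (rest (o n) κ ρ (at-k (n ∸ k))) (ix i)) ≡
               rest (o n) κ ρ (at-k (n ∸ suc k))
    down k k<n = trans (cong (λ z → rest (o n) κ ρ (at-k (n ∸ k)) [ ix i ]≔ List.drop 1 z) (trans (lookup-at (n ∸ k))
        (cong ones (trans (cong (lookup ι i +_) (∸-suc n k k<n)) (ℕ.+-suc _ _)))))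
      (set-at (n ∸ k) _)

  val-bound : ∀ p {s ρ ι} → Bounded s ρ ι → val ρ p ι ≤ valC p at s
  val-bound (len r) b = reads b r
  val-bound (var i) b = indices b i
  val-bound one     b = ≤-refl
  val-bound (p ⊕ q) b = +-mono-≤ (val-bound p b) (val-bound q b)
  val-bound (p ⊗ q) b = ℕ.*-mono-≤ (val-bound p b) (val-bound q b)

  count-bound : ∀ n f → count n f ≤ n
  count-bound zero    f = z≤n
  count-bound (suc n) f with f n
  ... | true  = s≤s (count-bound n f)
  ... | false = ≤-trans (count-bound n f) (ℕ.n≤1+n n)

  eval-unary : ∀ p {s e l o κ ρ ι} → Bounded s ρ ι →
    Eval Free (loop p (push vE true)) (st (false ∷ e) l o κ ρ ι) (st (ones (val ρ p ι) ++ false ∷ e) l o κ ρ ι) (loopC p (con 2) at s)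
  eval-unary p {e = e} {l} {o} {κ} {ρ} {ι} b = reach (cong (λ k → st (ones k ++ false ∷ e) l o κ ρ ι) (ℕ.+-identityʳ _))
    (eval-loop p (con 2) (λ k → ones k ++ false ∷ e) b (λ _ _ → e-push tt) 0)

  eval-monus : ∀ p q {s e l o κ ρ ι} → Bounded s ρ ι →
    Eval Free (loop p decrement) (st (ones q ++ false ∷ e) l o κ ρ ι) (st (ones (q ∸ val ρ p ι) ++ false ∷ e) l o κ ρ ι)
      (loopC p (con 2) at s)
  eval-monus p q {e = e} {l} {o} {κ} {ρ} {ι} b = reach (cong (λ k → st (ones (q ∸ k) ++ false ∷ e) l o κ ρ ι) (ℕ.+-identityʳ (val ρ p ι)))
    (eval-loop p (con 2) (λ k → ones (q ∸ k) ++ false ∷ e) b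
      (λ k l → reach (cong (λ z → st (ones z ++ false ∷ e) l o κ ρ ι) (trans (ℕ.∸-+-assoc q k 1) (cong (q ∸_) (ℕ.+-comm k 1))))
        (eval-decrement (q ∸ k))) 0)

  eval-bit : ∀ b {e l o κ ρ ι} {P Q : Command} {σ t} → (b ≡ true → Eval Free P (st e l o κ ρ ι) σ t) →
    (b ≡ false → Eval Free Q (st e l o κ ρ ι) σ t) →
    Eval Free (ifs vE is-true (pop vE ⨾ P) (pop vE ⨾ Q)) (st (b ∷ e) l o κ ρ ι) σ (2 + t)
  eval-bit true  p q = e-then refl (e-seq e-pop (p refl))
  eval-bit false p q = e-else refl (e-seq e-pop (q refl))

  -- With `e` and `l` arbitrary, `vE` acts as a stack of intermediate values and `vL` as a stack of
  -- counters, so a formula can be evaluated in the middle of another evaluation.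
  eval-formula : ∀ φ {s e l o κ ρ ι} → Bounded s ρ ι →
    Eval Free (formula φ) (st e l o κ ρ ι) (st (holds ρ φ ι ∷ e) l o κ ρ ι) (formulaC φ at s)
  eval-formula (bitAt r p) {s} {e} {l} {o} {κ} {ρ} {ι} b = reach
    (cong₂ (λ b z → (b ∷ e) ∷ l ∷ [] ∷ z) refl
      (trans (Vec.[]≔-idempotent τ j) (trans (cong (τ [ j ]≔_) same) (Vec.[]≔-lookup τ j))))
    (e-seq (e-push tt)
    (e-seq (eval-unary p b)
    (e-seq (e-weak (s≤s (ℕ.*-monoˡ-≤ 7 (val-bound p b))) (eval-skip j n τ))
    (e-seq e-pop
    (e-seq branch
      (e-weak (s≤s (ℕ.*-monoˡ-≤ 5 bound)) (eval-moveAll (λ ()) _ _ refl)))))))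
    where
    n = val ρ p ι
    j = rd r
    τ = rest o κ ρ ι
    xs = lookup τ j
    at-j : lookup (τ [ j ]≔ List.drop n xs) j ≡ List.drop n xs
    at-j = Vec.lookup∘updateAt j τ
    top : is-true (List.head (lookup (τ [ j ]≔ List.drop n xs) j)) ≡ nth (lookup ρ r) n
    top = trans (cong (is-true ∘ List.head) at-j) (cong (λ z → nth z n) (lookup-rd ρ ι r))
    branch : Eval Free (ifs (3 Fin.↑ʳ j) is-true (push vE true) (push vE false))
      (e ∷ l ∷ (List.take n xs ʳ++ []) ∷ τ [ j ]≔ List.drop n xs)
      ((nth (lookup ρ r) n ∷ e) ∷ l ∷ (List.take n xs ʳ++ []) ∷ τ [ j ]≔ List.drop n xs) 3
    branch with nth (lookup ρ r) n in eq
    ... | true  = e-then (trans top eq) (e-push tt)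
    ... | false = e-else (trans top eq) (e-push tt)
    same : (List.take n xs ʳ++ []) ʳ++ lookup (τ [ j ]≔ List.drop n xs) j ≡ xs
    same = trans (cong ((List.take n xs ʳ++ []) ʳ++_) at-j)
      (trans (List.ʳ++-ʳ++ (List.take n xs)) (List.take++drop≡id n xs))
    bound : length (List.take n xs ʳ++ []) ≤ s
    bound = ≤-trans (≤-reflexive (trans (List.length-ʳ++ (List.take n xs)) (trans (ℕ.+-identityʳ _) (List.length-take n xs))))
      (≤-trans (ℕ.m⊓n≤n n _) (≤-trans (≤-reflexive (cong length (lookup-rd ρ ι r))) (reads b r)))
  eval-formula (p ≺ q) {e = e} {l} {o} {κ} {ρ} {ι} b = reach
    (cong (λ z → st (z ∷ e) l o κ ρ ι) (positive-∸ (val ρ p ι) (val ρ q ι)))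
    (e-seq (e-push tt)
    (e-seq (eval-unary q b)
    (e-seq (eval-monus p (val ρ q ι) b)
      (e-weak (ℕ.+-monoʳ-≤ 5 (ℕ.*-monoˡ-≤ 2 (≤-trans (ℕ.m∸n≤m _ (val ρ p ι)) (val-bound q b))))
        (eval-finish (val ρ q ι ∸ val ρ p ι))))))
  eval-formula (neg φ) {e = e} {l} {o} {κ} {ρ} {ι} b =
    e-seq (eval-formula φ b) (eval-bit (holds ρ φ ι) {ρ = ρ} {ι}
      (λ eq → reach (cong (λ z → st (not z ∷ e) l o κ ρ ι) (sym eq)) (e-push tt))
      (λ eq → reach (cong (λ z → st (not z ∷ e) l o κ ρ ι) (sym eq)) (e-push tt)))
  eval-formula (φ & ψ) {s} {e} {l} {o} {κ} {ρ} {ι} b = e-seq (eval-formula φ b) branch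
    where
    branch : Eval Free (ifs vE is-true (pop vE ⨾ formula ψ) nop) (st (holds ρ φ ι ∷ e) l o κ ρ ι)
      (st ((holds ρ φ ι ∧ holds ρ ψ ι) ∷ e) l o κ ρ ι) (1 + (1 + formulaC ψ at s))
    branch with holds ρ φ ι
    ... | true  = e-then refl (e-seq e-pop (eval-formula ψ b))
    ... | false = e-weak (s≤s (s≤s z≤n)) (e-else refl e-pop)
  eval-formula (fewer i r φ ψ) {s} {e} {l} {o} {κ} {ρ} {ι} b = reach
    (cong (λ z → st (z ∷ e) l o κ ρ ι) (positive-∸ (cφ n) (cψ n + cψ n)))
    (e-seq (e-push tt)
    (e-seq (eval-forEach i r (formulaC ψ ⊚ (var ⊞ var) ⊞ con 6) (λ k → ones (cψ k + cψ k) ++ false ∷ e) (λ _ → o) b count-up)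
    (e-seq (eval-forEach i r (formulaC φ ⊚ (var ⊞ var) ⊞ con 4) (λ k → ones (cψ n + cψ n ∸ cφ k) ++ false ∷ e) (λ _ → o) b count-down)
      (e-weak (ℕ.+-monoʳ-≤ 5 (ℕ.*-monoˡ-≤ 2 (≤-trans (ℕ.m∸n≤m _ (cφ n)) (+-mono-≤ small small))))
        (eval-finish (cψ n + cψ n ∸ cφ n))))))
    where
    n = length (lookup ρ r)
    cφ cψ : ℕ → ℕ
    cφ k = count k (λ k → holds ρ φ (ι [ i ]≔ (lookup ι i + k)))
    cψ k = count k (λ k → holds ρ ψ (ι [ i ]≔ (lookup ι i + k)))
    small : cψ n ≤ s
    small = ≤-trans (count-bound n _) (reads b r)
    below : ∀ {k} → k < n → k ≤ s
    below k<n = ≤-trans (ℕ.<⇒≤ k<n) (reads b r)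
    count-up : ∀ k l → k < n →
      Eval Free (formula ψ ⨾ ifs vE is-true (pop vE ⨾ push vE true ⨾ push vE true) (pop vE))
        (st (ones (cψ k + cψ k) ++ false ∷ e) l o κ ρ (ι [ i ]≔ (lookup ι i + k)))
        (st (ones (cψ (suc k) + cψ (suc k)) ++ false ∷ e) l o κ ρ (ι [ i ]≔ (lookup ι i + k)))
        (formulaC ψ at (s + s) + 6)
    count-up k l k<n = e-seq (eval-formula ψ (Bounded-≔ i b (below k<n))) branch
      where
      branch : Eval Free (ifs vE is-true (pop vE ⨾ push vE true ⨾ push vE true) (pop vE))
        (st (holds ρ ψ (ι [ i ]≔ (lookup ι i + k)) ∷ ones (cψ k + cψ k) ++ false ∷ e) l o κ ρ (ι [ i ]≔ (lookup ι i + k)))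
        (st (ones (cψ (suc k) + cψ (suc k)) ++ false ∷ e) l o κ ρ (ι [ i ]≔ (lookup ι i + k))) 6
      branch with holds ρ ψ (ι [ i ]≔ (lookup ι i + k))
      ... | true  = reach (cong (λ z → st (ones (suc z) ++ false ∷ e) l o κ ρ (ι [ i ]≔ (lookup ι i + k))) (sym (ℕ.+-suc (cψ k) (cψ k))))
                      (e-then refl (e-seq e-pop (e-seq (e-push tt) (e-push tt))))
      ... | false = e-weak (s≤s (s≤s z≤n)) (e-else refl e-pop)
    count-down : ∀ k l → k < n →
      Eval Free (formula φ ⨾ ifs vE is-true (pop vE ⨾ decrement) (pop vE))
        (st (ones (cψ n + cψ n ∸ cφ k) ++ false ∷ e) l o κ ρ (ι [ i ]≔ (lookup ι i + k)))
        (st (ones (cψ n + cψ n ∸ cφ (suc k)) ++ false ∷ e) l o κ ρ (ι [ i ]≔ (lookup ι i + k)))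
        (formulaC φ at (s + s) + 4)
    count-down k l k<n = e-seq (eval-formula φ (Bounded-≔ i b (below k<n))) branch
      where
      branch : Eval Free (ifs vE is-true (pop vE ⨾ decrement) (pop vE))
        (st (holds ρ φ (ι [ i ]≔ (lookup ι i + k)) ∷ ones (cψ n + cψ n ∸ cφ k) ++ false ∷ e) l o κ ρ (ι [ i ]≔ (lookup ι i + k)))
        (st (ones (cψ n + cψ n ∸ cφ (suc k)) ++ false ∷ e) l o κ ρ (ι [ i ]≔ (lookup ι i + k))) 4
      branch with holds ρ φ (ι [ i ]≔ (lookup ι i + k))
      ... | true  = reach (cong (λ z → st (ones z ++ false ∷ e) l o κ ρ (ι [ i ]≔ (lookup ι i + k)))
                        (trans (ℕ.∸-+-assoc (cψ n + cψ n) (cφ k) 1) (cong (cψ n + cψ n ∸_) (ℕ.+-comm (cφ k) 1))))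
                      (e-then refl (e-seq e-pop (eval-decrement (cψ n + cψ n ∸ cφ k))))
      ... | false = e-weak (s≤s (s≤s z≤n)) (e-else refl e-pop)

  eval-generate : ∀ G {s e l o κ ρ ι} → Bounded s ρ ι →
    Eval Free (generate G) (st e l o κ ρ ι) (st e l (list ρ G ι ʳ++ o) κ ρ ι) (genC G at s)
  eval-generate (emit φ) {e = e} {l} {o} {κ} {ρ} {ι} b =
    e-seq (eval-formula φ b) (eval-bit (holds ρ φ ι) {ρ = ρ} {ι}
      (λ eq → reach (cong (λ z → st e l (z ∷ o) κ ρ ι) (sym eq)) (e-push tt))
      (λ eq → reach (cong (λ z → st e l (z ∷ o) κ ρ ι) (sym eq)) (e-push tt)))
  eval-generate (G ▸ H) {e = e} {l} {o} {κ} {ρ} {ι} b = reach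
    (cong (λ z → st e l z κ ρ ι) (sym (List.++-ʳ++ (list ρ G ι))))
    (e-seq (eval-generate G b) (eval-generate H b))
  eval-generate (for i r G) {e = e} {l} {o} {κ} {ρ} {ι} b =
    eval-forEach i r (genC G ⊚ (var ⊞ var)) (λ _ → e) (λ k → concatBelow k g ʳ++ o) b
      (λ k l k<n → reach (cong (λ z → st e l z κ ρ (ι [ i ]≔ (lookup ι i + k))) (sym (List.++-ʳ++ (concatBelow k g))))
        (eval-generate G (Bounded-≔ i b (≤-trans (ℕ.<⇒≤ k<n) (reads b r)))))
    where
    g : ℕ → List Bool
    g k = list ρ G (ι [ i ]≔ (lookup ι i + k))
  eval-generate (when φ G) {s} {e} {l} {o} {κ} {ρ} {ι} b = e-seq (eval-formula φ b) branch
    where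
    branch : Eval Free (ifs vE is-true (pop vE ⨾ generate G) (pop vE)) (st (holds ρ φ ι ∷ e) l o κ ρ ι)
      (st e l ((if holds ρ φ ι then list ρ G ι else []) ʳ++ o) κ ρ ι) (1 + (1 + genC G at s))
    branch with holds ρ φ ι
    ... | true  = e-then refl (e-seq e-pop (eval-generate G b))
    ... | false = e-weak (s≤s (s≤s z≤n)) (e-else refl e-pop)

-- Straight-line programs that define lists by queries. The first list is
-- left empty; the evaluation of quantifiers stores its path there.
module Programs (R D : ℕ) where

  zeros : Vec ℕ D
  zeros = Vec.replicate D 0

  Program : Set
  Program = List (Fin R × Gen (suc R) D)

  run : Program → Vec (List Bool) R → Vec (List Bool) R
  run []            ρ = ρ
  run ((r , G) ∷ P) ρ = run P (ρ [ r ]≔ list ([] ∷ ρ) G zeros)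

  V : ℕ
  V = 7 + (suc R + D)

  rdv : Fin (suc R) → Fin V
  rdv r = 3 Fin.↑ʳ rd {suc R} {D} r

  -- The list arises in reverse order on `vO`, and moving it to its target restores the order. The
  -- target is emptied only after generation, so a query may read the list that it redefines.
  define : Fin R → Gen (suc R) D → Cmd V
  define r G = generate G ⨾ while (rdv (suc r)) nonempty (pop (rdv (suc r))) ⨾ moveAll vO (rdv (suc r))

  program : Program → Cmd V
  program []            = nop
  program ((r , G) ∷ P) = define r G ⨾ program P

  growC : Gen (suc R) D → Cost
  growC G = var ⊞ genC G

  defineC : Gen (suc R) D → Cost
  defineC G = genC G ⊞ (con 1 ⊞ var ⊠ con 2) ⊞ (con 1 ⊞ growC G ⊠ con 5)

  programC : Program → Cost
  programC []            = con 1
  programC ((r , G) ∷ P) = defineC G ⊞ programC P ⊚ growC G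

  sizeC : Program → Cost
  sizeC []            = var
  sizeC ((r , G) ∷ P) = sizeC P ⊚ growC G

  Small : ℕ → ∀ {n} → Vec (List Bool) n → Set
  Small s ρ = ∀ r → length (lookup ρ r) ≤ s

  Small-++ : ∀ {s m n} (ρ : Vec (List Bool) m) (τ : Vec (List Bool) n) → Small s ρ → Small s τ → Small s (ρ Vec.++ τ)
  Small-++ []      τ h k i       = k i
  Small-++ (l ∷ ρ) τ h k zero    = h zero
  Small-++ (l ∷ ρ) τ h k (suc i) = Small-++ ρ τ (h ∘ suc) k i

  Small-∷ : ∀ {s n l} {ρ : Vec (List Bool) n} → length l ≤ s → Small s ρ → Small s (l ∷ ρ)
  Small-∷ p h zero    = p
  Small-∷ p h (suc i) = h i

  state : List Bool → List Bool → List Bool → Frame → List Bool → Vec (List Bool) R → Vec (List Bool) V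
  state e l o κ p ρ = st e l o κ (p ∷ ρ) zeros

  lookup-zeros : ∀ i → lookup zeros i ≡ 0
  lookup-zeros i = Vec.lookup-replicate i 0

  Bounded-zeros : ∀ {s p} {ρ : Vec (List Bool) R} → length p ≤ s → Small s ρ → Bounded s (p ∷ ρ) zeros
  Bounded-zeros h k = bounded (Small-∷ h k) (λ i → ≤-trans (≤-reflexive (lookup-zeros i)) z≤n)

  Small-state : ∀ {s e l o x q y p ρ} → length e ≤ s → length l ≤ s → length o ≤ s → length x ≤ s → length q ≤ s →
                length y ≤ s → length p ≤ s → Small s ρ → Small s (state e l o (x , q , y) p ρ)
  Small-state {ρ = ρ} he hl ho hx hq hy hp hρ =
    Small-∷ he (Small-∷ hl (Small-∷ z≤n (Small-∷ ho (Small-∷ hx (Small-∷ hq (Small-∷ hy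
      (Small-∷ hp (Small-++ ρ (Vec.map ones zeros) hρ
        (λ i → ≤-trans (≤-reflexive (trans (cong length (Vec.lookup-map i ones zeros)) (cong (length ∘ ones) (lookup-zeros i)))) z≤n)))))))))

  noFrame : Frame
  noFrame = [] , [] , []

  -- The stack `vO` grows no faster than time passes, so the cost of generating a list also bounds
  -- its length.
  list-length : ∀ G {s ρ} → Small s ρ → length (list ([] ∷ ρ) G zeros) ≤ growC G at s
  list-length G {s} {ρ} h = ≤-trans
    (≤-reflexive (sym (trans (List.length-ʳ++ (list ([] ∷ ρ) G zeros)) (ℕ.+-identityʳ _))))
    (Eval-grows (eval-generate G {o = []} {κ = noFrame} (Bounded-zeros {ρ = ρ} z≤n h)) s
      (Small-state {e = []} {[]} {[]} {[]} {[]} {[]} {[]} {ρ} z≤n z≤n z≤n z≤n z≤n z≤n z≤n h) vO)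

  eval-popAll : ∀ {W} (a : Fin W) xs τ → lookup τ a ≡ xs →
                Eval Free (while a nonempty (pop a)) τ (τ [ a ]≔ []) (suc (length xs * 2))
  eval-popAll a [] τ e =
    reach (sym (trans (cong (τ [ a ]≔_) (sym e)) (Vec.[]≔-lookup τ a))) (e-end (cong (nonempty ∘ List.head) e))
  eval-popAll a (x ∷ xs) τ e = reach (Vec.[]≔-idempotent τ a) (e-loop (cong (nonempty ∘ List.head) e) e-pop
    (eval-popAll a xs (τ [ a ]≔ List.drop 1 (lookup τ a)) (trans (Vec.lookup∘updateAt a τ) (cong (List.drop 1) e))))

  reverse-twice : ∀ (xs : List Bool) → (xs ʳ++ []) ʳ++ [] ≡ xs
  reverse-twice xs = trans (List.ʳ++-ʳ++ xs) (List.++-identityʳ xs)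

  eval-define : ∀ r G {s ρ} → Small s ρ →
    Eval Free (define r G) (state [] [] [] noFrame [] ρ) (state [] [] [] noFrame [] (ρ [ r ]≔ list ([] ∷ ρ) G zeros))
      (defineC G at s)
  eval-define r G {s} {ρ} h = reach (cong (λ z → [] ∷ [] ∷ [] ∷ [] ∷ [] ∷ [] ∷ [] ∷ [] ∷ z) same)
    (e-seq (eval-generate G (Bounded-zeros {ρ = ρ} z≤n h))
    (e-seq (e-weak (s≤s (ℕ.*-monoˡ-≤ 2 (≤-trans (≤-reflexive (cong length (lookup-rd {suc R} {D} ([] ∷ ρ) zeros (suc r)))) (h r))))
             (eval-popAll (rdv (suc r)) _ (state [] [] (out ʳ++ []) noFrame [] ρ) refl))
           (e-weak (s≤s (ℕ.*-monoˡ-≤ 5 (≤-trans (≤-reflexive (trans (List.length-ʳ++ out) (ℕ.+-identityʳ _))) (list-length G h))))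
             (eval-moveAll {a = vO} {rdv (suc r)} (λ ()) (out ʳ++ []) _ refl))))
    where
    out = list ([] ∷ ρ) G zeros
    τ = ρ Vec.++ Vec.map ones zeros
    j = r ↑ˡ D
    same : (τ [ j ]≔ []) [ j ]≔ ((out ʳ++ []) ʳ++ lookup (τ [ j ]≔ []) j) ≡ (ρ [ r ]≔ out) Vec.++ Vec.map ones zeros
    same = trans (Vec.[]≔-idempotent τ j)
      (trans (cong (τ [ j ]≔_) (trans (cong ((out ʳ++ []) ʳ++_) (Vec.lookup∘updateAt j τ)) (reverse-twice out)))
        (Vec.[]≔-++-↑ˡ ρ (Vec.map ones zeros) r))

  Small-define : ∀ r G {s} ρ → Small s ρ → Small (growC G at s) (ρ [ r ]≔ list ([] ∷ ρ) G zeros)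
  Small-define r G {s} ρ h = lookup-≔ (λ _ l → length l ≤ growC G at s) ρ r _ (list-length G h)
    (λ i _ → ≤-trans (h i) (m≤m+n s _))

  eval-program : ∀ P {s ρ} → Small s ρ →
    Eval Free (program P) (state [] [] [] noFrame [] ρ) (state [] [] [] noFrame [] (run P ρ)) (programC P at s)
  eval-program []            h = e-pop
  eval-program ((r , G) ∷ P) {ρ = ρ} h = e-seq (eval-define r G h) (eval-program P (Small-define r G ρ h))

  Small-run : ∀ P {s ρ} → Small s ρ → Small (sizeC P at s) (run P ρ)
  Small-run []            h = h
  Small-run ((r , G) ∷ P) {ρ = ρ} h = Small-run P (Small-define r G ρ h)

  inputs : Fin R → List Bool → Vec (List Bool) R
  inputs i w = Vec.replicate R [] [ i ]≔ w

  Small-inputs : ∀ i {w s} → length w ≤ s → Small s (inputs i w)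
  Small-inputs i h = lookup-≔ (λ _ l → length l ≤ _) (Vec.replicate R []) i _ h
    (λ j _ → ≤-trans (≤-reflexive (cong length (Vec.lookup-replicate j []))) z≤n)

  state-inputs : ∀ i w → Vec.replicate V [] [ rdv (suc i) ]≔ w ≡ state [] [] [] noFrame [] (inputs i w)
  state-inputs i w = cong (λ z → [] ∷ [] ∷ [] ∷ [] ∷ [] ∷ [] ∷ [] ∷ [] ∷ z)
    (trans (cong (_[ i ↑ˡ D ]≔ w) (trans (replicate-+ R D [])
      (cong (Vec.replicate R [] Vec.++_) (sym (Vec.map-replicate ones 0 D)))))
      (Vec.[]≔-++-↑ˡ (Vec.replicate R []) (Vec.map ones zeros) i))

  lookup-state : ∀ i ρ → lookup (state [] [] [] noFrame [] ρ) (rdv (suc i)) ≡ lookup ρ i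
  lookup-state i ρ = lookup-rd {suc R} {D} ([] ∷ ρ) zeros (suc i)

  -- The program starts on the tape that holds the output of the machine for `g`, which composes a
  -- given reduction with a query program.
  PolyTime-run : ∀ P i {g} → PolyTime g → PolyTime (λ w → lookup (run P (inputs i (g w))) i)
  PolyTime-run P i {g} (M , p , c) = machine , toPoly cost , λ w → timed w (c w)
    where
    open Sequel M (rdv (suc i)) vE (program P)
    cost : Cost
    -- The two extra steps are the exit from the first machine and the final inspection of `test`.
    -- The argument of `programC P` bounds the output of that machine.
    cost = con 2 ⊞ (fromPoly p ⊞ programC P ⊚ (fromPoly p ⊞ (con 1 ⊞ var)))
    timed : ∀ w → (∃[ t ] ∃[ C ] Run M (initial M w) t C × Halted M C × output M C ≡ g w × t ≤ ⟦ p ⟧ (length w)) →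
      ∃[ t ] ∃[ C ] Run machine (initial machine w) t C × Halted machine C ×
        output machine C ≡ lookup (run P (inputs i (g w))) i × t ≤ ⟦ toPoly cost ⟧ (length w)
    timed w (t , C , r , h , out , le) =
      t′ , C′ , r′ , h′ , trans out′ (lookup-state i (run P (inputs i (g w)))) ,
      ≤-trans le′ (≤-trans (s≤s (s≤s (ℕ.+-monoˡ-≤ _ (≤-trans le (≤-reflexive (sym (fromPoly-at p (length w))))))))
        (≤-reflexive (sym (toPoly-at cost (length w)))))
      where
      time : t ≤ fromPoly p at length w
      time = ≤-trans le (≤-reflexive (sym (fromPoly-at p (length w))))
      s = fromPoly p at length w + suc (length w)
      size : length (g w) ≤ s
      size = ≤-trans (≤-reflexive (cong length (sym out)))
        (≤-trans (output-length {M} {w} r) (ℕ.+-monoˡ-≤ _ time))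
      ran = machine-run {w = w} r h
        (subst (λ σ → Eval Free (program P) σ (state [] [] [] noFrame [] (run P (inputs i (g w)))) (programC P at s))
          (trans (sym (state-inputs i (g w))) (cong initialStacks (sym out)))
          (eval-program P {s = s} (Small-inputs i size)))
      t′   = proj₁ ran
      C′   = proj₁ (proj₂ ran)
      r′   = proj₁ (proj₂ (proj₂ ran))
      le′  = proj₁ (proj₂ (proj₂ (proj₂ ran)))
      h′   = proj₁ (proj₂ (proj₂ (proj₂ (proj₂ ran))))
      out′ = proj₁ (proj₂ (proj₂ (proj₂ (proj₂ (proj₂ (proj₂ ran))))))

  -- Evaluation of a prefix of quantifiers (true for ∃) before φ, which
  -- reads the chosen bits in the first list. The register L holds true
  -- while descending and false while returning a value.
  module Quantified (φ : Formula (suc R) D) where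

    qeval : Vec (List Bool) R → List Bool → List Bool → Bool
    qeval ρ []          x = holds ((x ʳ++ []) ∷ ρ) φ zeros
    qeval ρ (true  ∷ y) x = qeval ρ y (false ∷ x) ∨ qeval ρ y (true ∷ x)
    qeval ρ (false ∷ y) x = qeval ρ y (false ∷ x) ∧ qeval ρ y (true ∷ x)

    read : Fin V
    read = rdv zero

    -- Evaluation is lazy: the second branch is entered only if the first value is neutral for the
    -- quantifier, so the value of the second branch is the value of the node. No value has to be
    -- stored, and the stacks stay as long as the prefix.
    leaf descend retry back return turn : Cmd V
    leaf    = moveAll vX read ⨾ formula φ ⨾ moveAll read vX
    descend = ifs vY is-true (pop vY ⨾ push vQ true ⨾ push vX false) (pop vY ⨾ push vQ false ⨾ push vX false)
    retry   = pop vX ⨾ push vX true ⨾ pop vE ⨾ pop vL ⨾ push vL true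
    back    = pop vX ⨾ ifs vQ is-true (pop vQ ⨾ push vY true) (pop vQ ⨾ push vY false)
    return  = ifs vX is-true back (ifs vQ is-true (ifs vE is-true back retry) (ifs vE is-true retry back))
    turn    = ifs vL is-true
      (ifs vY nonempty descend (leaf ⨾ pop vL ⨾ push vL false))
      (ifs vX nonempty return (pop vL))

    search : Cmd V
    search = while vL nonempty turn

    leafC : Cost
    leafC = (con 1 ⊞ var ⊠ con 5) ⊞ formulaC φ ⊞ (con 1 ⊞ var ⊠ con 5)

    eval-leaf : ∀ {s ρ x q} → Small s ρ → length x ≤ s →
      Eval Free leaf (state [] (true ∷ []) [] (x , q , []) [] ρ)
        (state (qeval ρ [] x ∷ []) (true ∷ []) [] (x , q , []) [] ρ) (leafC at s)
    eval-leaf {s} {ρ} {x} {q} h hx = reach (cong (λ z → state (qeval ρ [] x ∷ []) (true ∷ []) [] (z , q , []) [] ρ) (reverse-twice x))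
      (e-seq (e-weak (s≤s (ℕ.*-monoˡ-≤ 5 hx)) (eval-moveAll (λ ()) x _ refl))
      (e-seq (eval-formula φ {κ = [] , q , []} (Bounded-zeros {p = x ʳ++ []} {ρ} bound h))
             (e-weak (s≤s (ℕ.*-monoˡ-≤ 5 bound)) (eval-moveAll (λ ()) (x ʳ++ []) _ refl))))
      where
      bound : length (x ʳ++ []) ≤ s
      bound = ≤-trans (≤-reflexive (trans (List.length-ʳ++ x) (ℕ.+-identityʳ _))) hx

    module _ {s : ℕ} {ρ : Vec (List Bool) R} (h : Small s ρ) (1≤s : 1 ≤ s) where

      cap : ℕ
      cap = s + leafC at s

      s≤cap : s ≤ cap
      s≤cap = m≤m+n s _

      -- The time may be exponential and is left unspecified; only the cap on the heights is
      -- recorded.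
      Goes : Vec (List Bool) V → Vec (List Bool) V → Set
      Goes σ τ = ∃[ t ] Eval (_≤ cap) search σ τ t

      stepped : ∀ {a b l xs ys p σ t} →
        Eval (_≤ cap) turn (state a (l ∷ []) [] xs p ρ) (state b ys [] σ p ρ) t →
        ∀ {τ} → Goes (state b ys [] σ p ρ) τ → Goes (state a (l ∷ []) [] xs p ρ) τ
      stepped e (u , f) = _ , e-loop refl e f

      down : List Bool → List Bool → List Bool → Vec (List Bool) V
      down x q y = state [] (true ∷ []) [] (x , q , y) [] ρ

      up : Bool → List Bool → List Bool → List Bool → Vec (List Bool) V
      up v x q y = state (v ∷ []) (false ∷ []) [] (x , q , y) [] ρ

      1≤cap : 1 ≤ cap
      1≤cap = ≤-trans 1≤s s≤cap

      goes-leaf : ∀ {x q τ} → length x ≤ s → length q ≤ s → Goes (up (qeval ρ [] x) x q []) τ → Goes (down x q []) τ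
      goes-leaf {x} {q} hx hq = stepped (e-then refl (e-else refl (e-seq
        (Eval-capped (eval-leaf {q = q} h hx) s cap
          (Small-state {e = []} {true ∷ []} {[]} {x} {q} {[]} {[]} {ρ} z≤n 1≤s z≤n hx hq z≤n z≤n h) ≤-refl)
        (e-seq e-pop (e-push 1≤cap)))))

      goes-descend : ∀ {x q y} b {τ} → suc (length x) ≤ s → suc (length q) ≤ s →
        Goes (down (false ∷ x) (b ∷ q) y) τ → Goes (down x q (b ∷ y)) τ
      goes-descend true  hx hq = stepped (e-then refl (e-then refl (e-then refl
        (e-seq e-pop (e-seq (e-push (≤-trans hq s≤cap)) (e-push (≤-trans hx s≤cap)))))))
      goes-descend false hx hq = stepped (e-then refl (e-then refl (e-else refl
        (e-seq e-pop (e-seq (e-push (≤-trans hq s≤cap)) (e-push (≤-trans hx s≤cap)))))))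

      eval-ascend : ∀ {v a x y} b {q} → suc (length y) ≤ s →
        Eval (_≤ cap) back (up v (a ∷ x) (b ∷ q) y) (up v x q (b ∷ y)) 5
      eval-ascend true  hy = e-weak (s≤s (s≤s (s≤s (s≤s (s≤s z≤n))))) (e-seq e-pop (e-then refl (e-seq e-pop (e-push (≤-trans hy s≤cap)))))
      eval-ascend false hy = e-weak (s≤s (s≤s (s≤s (s≤s (s≤s z≤n))))) (e-seq e-pop (e-else refl (e-seq e-pop (e-push (≤-trans hy s≤cap)))))

      goes-back : ∀ {v x q y} b {τ} → suc (length y) ≤ s →
        Goes (up v x q (b ∷ y)) τ → Goes (up v (true ∷ x) (b ∷ q) y) τ
      goes-back b hy = stepped (e-else refl (e-then refl (e-then refl (eval-ascend b hy))))

      goes-settled : ∀ {x q y} b {τ} → suc (length y) ≤ s →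
        Goes (up b x q (b ∷ y)) τ → Goes (up b (false ∷ x) (b ∷ q) y) τ
      goes-settled true  hy = stepped (e-else refl (e-then refl (e-else refl (e-then refl (e-then refl (eval-ascend true hy))))))
      goes-settled false hy = stepped (e-else refl (e-then refl (e-else refl (e-else refl (e-else refl (eval-ascend false hy))))))

      goes-retry : ∀ {x q y} b {τ} → suc (length x) ≤ s →
        Goes (down (true ∷ x) (b ∷ q) y) τ → Goes (up (not b) (false ∷ x) (b ∷ q) y) τ
      goes-retry true  hx = stepped (e-else refl (e-then refl (e-else refl (e-then refl (e-else refl
        (e-seq e-pop (e-seq (e-push (≤-trans hx s≤cap)) (e-seq e-pop (e-seq e-pop (e-push 1≤cap))))))))))
      goes-retry false hx = stepped (e-else refl (e-then refl (e-else refl (e-else refl (e-then refl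
        (e-seq e-pop (e-seq (e-push (≤-trans hx s≤cap)) (e-seq e-pop (e-seq e-pop (e-push 1≤cap))))))))))

      -- The whole search is one `while` loop, so a subtree is not a complete evaluation of a
      -- command. Hence the continuation form: whatever is reached after returning the value is
      -- reached from the descent.
      goes-search : ∀ y x q {τ} → length x + length y ≤ s → length q + length y ≤ s →
        Goes (up (qeval ρ y x) x q y) τ → Goes (down x q y) τ
      goes-search [] x q hx hq g = goes-leaf (≤-trans (m≤m+n _ 0) hx) (≤-trans (m≤m+n _ 0) hq) g
      goes-search (b ∷ y) x q {τ} hx hq g =
        goes-descend b hx₁ hq₁ (goes-search y (false ∷ x) (b ∷ q) hx₂ hq₂ (first b g))
        where
        hx₂ : suc (length x) + length y ≤ s
        hx₂ = ≤-trans (≤-reflexive (sym (ℕ.+-suc (length x) _))) hx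
        hq₂ : suc (length q) + length y ≤ s
        hq₂ = ≤-trans (≤-reflexive (sym (ℕ.+-suc (length q) _))) hq
        hx₁ : suc (length x) ≤ s
        hx₁ = ≤-trans (m≤m+n _ (length y)) hx₂
        hq₁ : suc (length q) ≤ s
        hq₁ = ≤-trans (m≤m+n _ (length y)) hq₂
        hy : suc (length y) ≤ s
        hy = ≤-trans (m≤n+m _ (length x)) hx
        second : ∀ b → Goes (up (qeval ρ y (true ∷ x)) x q (b ∷ y)) τ → Goes (up (not b) (false ∷ x) (b ∷ q) y) τ
        second b g = goes-retry b hx₁ (goes-search y (true ∷ x) (b ∷ q) hx₂ hq₂ (goes-back b hy g))
        first : ∀ b → Goes (up (qeval ρ (b ∷ y) x) x q (b ∷ y)) τ → Goes (up (qeval ρ y (false ∷ x)) (false ∷ x) (b ∷ q) y) τ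
        first true g with qeval ρ y (false ∷ x)
        ... | true  = goes-settled true hy g
        ... | false = second true g
        first false g with qeval ρ y (false ∷ x)
        ... | true  = second false g
        ... | false = goes-settled false hy g

      eval-search : ∀ y → length y ≤ s → Goes (down [] [] y) (state (qeval ρ y [] ∷ []) [] [] ([] , [] , y) [] ρ)
      eval-search y hy = goes-search y [] [] hy hy (_ , e-loop refl (e-else refl (e-else refl e-pop)) (e-end refl))

    module _ (P : Program) (i : Fin R) (Y : Gen (suc R) D) where

      decider : Cmd V
      decider = (program P ⨾ generate Y ⨾ moveAll vO vY ⨾ push vL true) ⨾ search

      setupC searchC spaceC : Cost
      setupC  = programC P ⊞ genC Y ⊚ sizeC P ⊞ (con 1 ⊞ (growC Y ⊚ sizeC P) ⊠ con 5) ⊞ con 2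
      -- The additional unit gives `1 ≤ s`, the room for the flag on `vL`.
      searchC = con 1 ⊞ growC Y ⊚ sizeC P
      spaceC  = (var ⊞ setupC) ⊞ (searchC ⊞ leafC ⊚ searchC)

      module _ (w : List Bool) where

        ρ : Vec (List Bool) R
        ρ = run P (inputs i w)

        prefix : List Bool
        prefix = list ([] ∷ ρ) Y zeros

        private
          n = length w
          small : Small (sizeC P at n) ρ
          small = Small-run P (Small-inputs i ≤-refl)
          prefix≤ : length prefix ≤ growC Y at (sizeC P at n)
          prefix≤ = list-length Y small

        eval-setup : Eval Free (program P ⨾ generate Y ⨾ moveAll vO vY ⨾ push vL true)
          (state [] [] [] noFrame [] (inputs i w)) (state [] (true ∷ []) [] ([] , [] , prefix) [] ρ) (setupC at n)
        eval-setup = reach (cong (λ z → state [] (true ∷ []) [] ([] , [] , z) [] ρ) (reverse-twice prefix))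
          (e-seq (eval-program P (Small-inputs i ≤-refl))
          (e-seq (eval-generate Y (Bounded-zeros {ρ = ρ} z≤n small))
          (e-seq (e-weak (s≤s (ℕ.*-monoˡ-≤ 5 (≤-trans (≤-reflexive (trans (List.length-ʳ++ prefix) (ℕ.+-identityʳ _))) prefix≤)))
                   (eval-moveAll (λ ()) (prefix ʳ++ []) _ refl))
                 (e-push tt))))

        widen-cap : ∀ {c d P σ τ t} → c ≤ d → Eval {V} (_≤ c) P σ τ t → Eval (_≤ d) P σ τ t
        widen-cap le (e-push o)     = e-push (≤-trans o le)
        widen-cap le e-pop          = e-pop
        widen-cap le (e-seq e f)    = e-seq (widen-cap le e) (widen-cap le f)
        widen-cap le (e-then q e)   = e-then q (widen-cap le e)
        widen-cap le (e-else q e)   = e-else q (widen-cap le e)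
        widen-cap le (e-loop q e f) = e-loop q (widen-cap le e) (widen-cap le f)
        widen-cap le (e-end q)      = e-end q
        widen-cap le (e-weak x e)   = e-weak x (widen-cap le e)

        -- The setup is capped through its polynomial time, the search through `cap`; `spaceC` is
        -- the sum of the two caps.
        eval-decider : ∃[ t ] Eval (_≤ spaceC at n) decider (state [] [] [] noFrame [] (inputs i w))
          (state (qeval ρ prefix [] ∷ []) [] [] ([] , [] , prefix) [] ρ) t
        eval-decider = _ , e-seq
          (Eval-capped eval-setup n (spaceC at n)
            (Small-state {e = []} {[]} {[]} {[]} {[]} {[]} {[]} z≤n z≤n z≤n z≤n z≤n z≤n z≤n (Small-inputs i ≤-refl))
            (m≤m+n _ _))
          (widen-cap (m≤n+m _ (n + setupC at n))
            (proj₂ (eval-search {s = searchC at n} (λ r → ≤-trans (small r) (≤-trans (m≤m+n _ _) (ℕ.n≤1+n _))) (s≤s z≤n)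
              prefix (≤-trans prefix≤ (ℕ.n≤1+n _)))))

      idle : TM
      idle .TM.extraTapes  = 0
      idle .TM.State       = ⊤
      idle .TM.Work        = ⊥
      idle .TM.finiteState = finite-⊤
      idle .TM.finiteWork  = 0 , ↔.↔-sym Fin.0↔⊥
      idle .TM.start       = tt
      idle .TM.accepting _ = false
      idle .TM.δ _ _       = nothing

      open Sequel idle (rdv (suc i)) vE decider

      Within-initial : ∀ w {s} → length w ≤ s →
        Within s (initialStacks w) (initialTapes (writeWord w ∷ []))
      Within-initial w {s} h = cells-ok , fits
        where
        blanks : ∀ k → lookup (Vec.replicate V (blankTape {⊥})) k ≡ blankTape
        blanks k = Vec.lookup-replicate k blankTape
        cells-ok : ∀ k → cells (lookup (initialTapes (writeWord w ∷ [])) k) ≤ suc s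
        cells-ok zero    = ≤-trans (cells-writeWord {⊥} w) (s≤s h)
        cells-ok (suc k) = ≤-trans (≤-reflexive (cong cells (blanks k))) (s≤s z≤n)
        fits-word : ∀ w → length w ≤ s → Fits {⊥} s (length w) (writeWord w)
        fits-word []      h = z≤n , z≤n
        fits-word (b ∷ w) h = h , ≤-trans (≤-reflexive (List.length-map bit w)) (ℕ.n≤1+n _)
        fits : ∀ x → Fits s (length (lookup (initialStacks w) x)) (lookup (initialTapes (writeWord w ∷ [])) (loc x))
        fits x with x Fin.≟ rdv (suc i)
        ... | yes refl = subst (λ l → Fits s (length l) (writeWord w))
          (sym (Vec.lookup∘updateAt (rdv (suc i)) (Vec.replicate V []))) (fits-word w h)
        ... | no x≢    = subst₂ (λ l t → Fits s (length l) t)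
          (sym (trans (Vec.lookup∘updateAt′ x (rdv (suc i)) x≢ (Vec.replicate V [])) (Vec.lookup-replicate x [])))
          (sym (blanks x)) (z≤n , z≤n)

      Accepts : List Bool → Set
      Accepts w = qeval (ρ w) (prefix w) [] ≡ true

      decides : ∀ w → ∃[ t ] ∃[ C ] Run machine (initial machine w) t C × Halted machine C ×
        TM.accepting machine (Config.state C) ≡ qeval (ρ w) (prefix w) [] ×
        (∀ k → cells (lookup (Config.contents C) k) ≤ suc (spaceC at length w))
      decides w = t , C , r , h , acc ,
        sp (spaceC at length w) (λ _ le → le)
          (subst (λ v → Within (spaceC at length w) (initialStacks v) (initialTapes (writeWord w ∷ []))) (sym (readWord-writeWord {⊥} w))
            (Within-initial w (≤-trans (m≤m+n _ _) (m≤m+n _ _))))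
        where
        ran = machine-run {w = w} done refl
          (subst (λ σ → Eval (_≤ spaceC at length w) decider σ
                   (state (qeval (ρ w) (prefix w) [] ∷ []) [] [] ([] , [] , prefix w) [] (ρ w)) (proj₁ (eval-decider w)))
            (trans (sym (state-inputs i w)) (cong initialStacks (sym (readWord-writeWord {⊥} w))))
            (proj₂ (eval-decider w)))
        t   = proj₁ ran
        C   = proj₁ (proj₂ ran)
        r   = proj₁ (proj₂ (proj₂ ran))
        h   = proj₁ (proj₂ (proj₂ (proj₂ (proj₂ ran))))
        acc = proj₁ (proj₂ (proj₂ (proj₂ (proj₂ (proj₂ ran)))))
        sp  = proj₂ (proj₂ (proj₂ (proj₂ (proj₂ (proj₂ (proj₂ ran))))))

      PSPACE-quantified : ∀ {L : Language} → (∀ w → Accepts w ⇔ L w) → PSPACE L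
      PSPACE-quantified {L} equiv = machine , toPoly total ,
        (λ w → let t , C , r , h , acc , _ = decides w in
          t , C , r , h , subst (λ b → (b ≡ true) ⇔ L w) (sym acc) (equiv w)) ,
        λ w r → let t , C , r′ , h , _ , sp = decides w in
          ≤-trans (space-run (proj₂ (Run-deterministic r′ h r)))
            (≤-trans (sum-bound (Vec.map cells (Config.contents C))
                       (λ k → ≤-trans (≤-reflexive (Vec.lookup-map k cells (Config.contents C))) (sp k)))
              (≤-reflexive (sym (toPoly-at total (length w)))))
        where
        total : Cost
        total = con K ⊠ (con 1 ⊞ spaceC)

-- The coloring games on a subdivided graph

data Split (m n : ℕ) : Fin (m + n) → Set where
  left  : ∀ i → Split m n (i ↑ˡ n)
  right : ∀ j → Split m n (m ↑ʳ j)

split : ∀ m {n} (i : Fin (m + n)) → Split m n i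
split zero    i    = right i
split (suc m) zero = left zero
split (suc m) (suc i) with split m i
... | left i  = left (suc i)
... | right j = right j

∣++∣ : ∀ {m n} (p : Subset m) (q : Subset n) → ∣ p Vec.++ q ∣ ≡ ∣ p ∣ + ∣ q ∣
∣++∣ []          q = refl
∣++∣ (true  ∷ p) q = cong suc (∣++∣ p q)
∣++∣ (false ∷ p) q = ∣++∣ p q

∣none∣ : ∀ {n} → ∣ Vec.replicate n false ∣ ≡ 0
∣none∣ {zero}  = refl
∣none∣ {suc n} = ∣none∣ {n}

∣none∩∣ : ∀ {n} (s : Subset n) → ∣ Vec.replicate n false ∩ s ∣ ≡ 0
∣none∩∣ []      = refl
∣none∩∣ (x ∷ s) = ∣none∩∣ s

∣nowhere∩∣ : ∀ {n} (s : Subset n) → ∣ tabulate (λ _ → false) ∩ s ∣ ≡ 0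
∣nowhere∩∣ []      = refl
∣nowhere∩∣ (x ∷ s) = ∣nowhere∩∣ s

∣∷∣ : ∀ {n} (b : Bool) (p : Subset n) → ∣ b ∷ p ∣ ≡ b2n b + ∣ p ∣
∣∷∣ true  p = refl
∣∷∣ false p = refl

_==_ : ∀ {n} → Fin n → Fin n → Bool
i == j = does (i Fin.≟ j)

==-refl : ∀ {n} (i : Fin n) → (i == i) ≡ true
==-refl zero    = refl
==-refl (suc i) = ==-refl i

==-sound : ∀ {n} (i j : Fin n) → (i == j) ≡ true → i ≡ j
==-sound i j e with i Fin.≟ j
... | yes eq = eq
... | no _ with () ← e

∣single∩∣ : ∀ {n} p (s : Subset n) → ∣ tabulate (_== p) ∩ s ∣ ≡ b2n (lookup s p)
∣single∩∣ zero    (x ∷ s) = trans (∣∷∣ x (tabulate (λ _ → false) ∩ s)) (trans (cong (b2n x +_) (∣nowhere∩∣ s)) (ℕ.+-identityʳ _))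
∣single∩∣ (suc p) (x ∷ s) = ∣single∩∣ p s

pair : ∀ {n} → Fin n → Fin n → Subset n
pair p q = tabulate (λ i → (i == p) ∨ (i == q))

∣pair∩∣ : ∀ {n} p q (s : Subset n) → p ≢ q → ∣ pair p q ∩ s ∣ ≡ b2n (lookup s p) + b2n (lookup s q)
∣pair∩∣ zero    zero    s       ne = ⊥-elim (ne refl)
∣pair∩∣ zero    (suc q) (x ∷ s) ne = trans (∣∷∣ x (tabulate (_== q) ∩ s)) (cong (b2n x +_) (∣single∩∣ q s))
∣pair∩∣ (suc p) zero    (x ∷ s) ne = trans (∣∷∣ x (tabulate (λ i → (i == p) ∨ false) ∩ s))
  (trans (cong (b2n x +_) (trans (cong (λ v → ∣ v ∩ s ∣) (Vec.tabulate-cong (λ i → ∨-falseʳ (i == p)))) (∣single∩∣ p s)))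
    (ℕ.+-comm (b2n x) _))
  where
  ∨-falseʳ : ∀ b → (b ∨ false) ≡ b
  ∨-falseʳ true  = refl
  ∨-falseʳ false = refl
∣pair∩∣ (suc p) (suc q) (x ∷ s) ne = ∣pair∩∣ p q s (ne ∘ cong suc)

∣∩⊤∣ : ∀ {n} (p : Subset n) → ∣ p ∩ Vec.replicate n true ∣ ≡ ∣ p ∣
∣∩⊤∣ []          = refl
∣∩⊤∣ (true  ∷ p) = cong suc (∣∩⊤∣ p)
∣∩⊤∣ (false ∷ p) = ∣∩⊤∣ p

∣pair∣ : ∀ {n} (p q : Fin n) → p ≢ q → ∣ pair p q ∣ ≡ 2
∣pair∣ {n} p q ne = trans (sym (∣∩⊤∣ (pair p q))) (trans (∣pair∩∣ p q (Vec.replicate n true) ne)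
  (cong₂ (λ x y → b2n x + b2n y) (Vec.lookup-replicate p true) (Vec.lookup-replicate q true)))

-- Partial colorings and the sizes of color classes

module _ {k : ℕ} where

  is : Fin k → Maybe (Fin k) → Bool
  is c x = does (Maybe.≡-dec Fin._≟_ x (just c))

  is-refl : ∀ c → is c (just c) ≡ true
  is-refl c with c Fin.≟ c
  ... | yes _ = refl
  ... | no ne = ⊥-elim (ne refl)

  is-sound : ∀ c x → is c x ≡ true → x ≡ just c
  is-sound c (just d) e with d Fin.≟ c
  ... | yes refl = refl
  ... | no _ with () ← e

  is-other : ∀ {c d} → d ≢ c → is c (just d) ≡ false
  is-other {c} {d} ne with d Fin.≟ c
  ... | yes e = ⊥-elim (ne e)
  ... | no _  = refl

  uncoloredCount : ∀ {m} → Coloring m k → ℕ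
  uncoloredCount []            = 0
  uncoloredCount (nothing ∷ b) = suc (uncoloredCount b)
  uncoloredCount (just _ ∷ b)  = uncoloredCount b

  uncoloredCount-set : ∀ {m} (b : Coloring m k) x {c} → Uncolored b x → uncoloredCount b ≡ suc (uncoloredCount (b [ x ]≔ just c))
  uncoloredCount-set (nothing ∷ b) zero    u = refl
  uncoloredCount-set (nothing ∷ b) (suc x) u = cong suc (uncoloredCount-set b x u)
  uncoloredCount-set (just _ ∷ b)  (suc x) u = uncoloredCount-set b x u

  uncoloredCount-zero : ∀ {m} (b : Coloring m k) → uncoloredCount b ≡ 0 → Complete b
  uncoloredCount-zero (just c ∷ b) e (suc x) u = uncoloredCount-zero b e x u

  uncoloredCount-suc : ∀ {m t} (b : Coloring m k) → uncoloredCount b ≡ suc t → ∃ (Uncolored b)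
  uncoloredCount-suc (nothing ∷ b) e = zero , refl
  uncoloredCount-suc (just c ∷ b)  e = let x , u = uncoloredCount-suc b e in suc x , u

  uncoloredCount-uncolored : ∀ m → uncoloredCount (uncolored {m} {k}) ≡ m
  uncoloredCount-uncolored zero    = refl
  uncoloredCount-uncolored (suc m) = cong suc (uncoloredCount-uncolored m)

  class-∉ : ∀ {m} (p : Subset m) (b : Coloring m k) x c d → lookup p x ≡ false →
            ∣ p ∩ colorClass (b [ x ]≔ just c) d ∣ ≡ ∣ p ∩ colorClass b d ∣
  class-∉ (false ∷ p) (y ∷ b) zero    c d e = refl
  class-∉ (a ∷ p)     (y ∷ b) (suc x) c d e = trans (∣∷∣ (a ∧ is d y) (p ∩ colorClass (b [ x ]≔ just c) d))
    (trans (cong (b2n (a ∧ is d y) +_) (class-∉ p b x c d e)) (sym (∣∷∣ (a ∧ is d y) (p ∩ colorClass b d))))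

  class-≢ : ∀ {m} (p : Subset m) (b : Coloring m k) x {c d} → Uncolored b x → c ≢ d →
            ∣ p ∩ colorClass (b [ x ]≔ just c) d ∣ ≡ ∣ p ∩ colorClass b d ∣
  class-≢ (a ∷ p) (nothing ∷ b) zero    {c} {d} u ne = cong (λ z → ∣ (a ∧ z) ∷ p ∩ colorClass b d ∣) (is-other ne)
  class-≢ (a ∷ p) (y ∷ b)       (suc x) {c} {d} u ne = trans (∣∷∣ (a ∧ is d y) (p ∩ colorClass (b [ x ]≔ just c) d))
    (trans (cong (b2n (a ∧ is d y) +_) (class-≢ p b x u ne)) (sym (∣∷∣ (a ∧ is d y) (p ∩ colorClass b d))))

  class-≡ : ∀ {m} (p : Subset m) (b : Coloring m k) x {c} → Uncolored b x →
            ∣ p ∩ colorClass (b [ x ]≔ just c) c ∣ ≤ suc ∣ p ∩ colorClass b c ∣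
  class-≡ (a ∷ p) (nothing ∷ b) zero {c} u with a | is c (just c)
  ... | true  | true  = ≤-refl
  ... | true  | false = ℕ.n≤1+n _
  ... | false | _     = ℕ.n≤1+n _
  class-≡ (a ∷ p) (y ∷ b) (suc x) {c} u with a ∧ is c y
  ... | true  = s≤s (class-≡ p b x u)
  ... | false = class-≡ p b x u

  class-disjoint : ∀ {m} (p : Subset m) (b : Coloring m k) {c d} → c ≢ d →
                   ∣ p ∩ colorClass b c ∣ + ∣ p ∩ colorClass b d ∣ ≤ ∣ p ∣
  class-disjoint []          []      ne = z≤n
  class-disjoint (false ∷ p) (y ∷ b) ne = class-disjoint p b ne
  class-disjoint (true  ∷ p) (y ∷ b) {c} {d} ne with is c y in ec | is d y in ed
  ... | true  | true  = ⊥-elim (ne (Maybe.just-injective (trans (sym (is-sound c y ec)) (is-sound d y ed))))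
  ... | true  | false = s≤s (class-disjoint p b ne)
  ... | false | true  = ≤-trans (≤-reflexive (ℕ.+-suc _ _)) (s≤s (class-disjoint p b ne))
  ... | false | false = ≤-trans (class-disjoint p b ne) (ℕ.n≤1+n _)

  -- The two classes are disjoint and both miss the uncolored element `x` of `p`, hence the strict
  -- inequality.
  class-slack : ∀ {m} (p : Subset m) (b : Coloring m k) x {c d} → c ≢ d → lookup p x ≡ true → Uncolored b x →
                ∣ p ∩ colorClass b c ∣ + ∣ p ∩ colorClass b d ∣ < ∣ p ∣
  class-slack (true  ∷ p) (nothing ∷ b) zero    ne e u = s≤s (class-disjoint p b ne)
  class-slack (false ∷ p) (y ∷ b)       (suc x) ne e u = class-slack p b x ne e u
  class-slack (true  ∷ p) (y ∷ b)       (suc x) {c} {d} ne e u with is c y in ec | is d y in ed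
  ... | true  | true  = ⊥-elim (ne (Maybe.just-injective (trans (sym (is-sound c y ec)) (is-sound d y ed))))
  ... | true  | false = s≤s (class-slack p b x ne e u)
  ... | false | true  = ≤-trans (≤-reflexive (cong suc (ℕ.+-suc _ _))) (s≤s (class-slack p b x ne e u))
  ... | false | false = ≤-trans (class-slack p b x ne e u) (ℕ.n≤1+n _)

  lookup-class : ∀ {m} (b : Coloring m k) c i → lookup (colorClass b c) i ≡ is c (lookup b i)
  lookup-class b c i = Vec.lookup-map i (is c) b

  set-same : ∀ {m} (b : Coloring m k) i {c} → lookup (b [ i ]≔ just c) i ≡ just c
  set-same b i = Vec.lookup∘updateAt i b

  set-other : ∀ {m} (b : Coloring m k) i j {c} → j ≢ i → lookup (b [ i ]≔ just c) j ≡ lookup b j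
  set-other b i j ne = Vec.lookup∘updateAt′ j i ne b

-- The new vertices are two copies of all pairs (a , b), isolated unless ab
-- is an edge. So each edge is subdivided four times, and M is even.
module Subdivision {n : ℕ} (G : Graph n) where
  open Graph G

  M : ℕ
  M = n * n + n * n

  incident : Fin n → Fin n × Fin n → Bool
  incident i (a , b) = lookup (N a) b ∧ ((i == a) ∨ (i == b))

  ends : Fin M → Fin n × Fin n
  ends = [ remQuot n , remQuot n ]′ ∘ splitAt (n * n)

  half : Fin n → Subset (n * n)
  half i = tabulate (λ y → incident i (remQuot n y))

  -- Two equal halves, so that the degree of the old vertex is visibly even.
  edgesAt : Fin n → Subset M
  edgesAt i = half i Vec.++ half i

  endsOf : Fin n × Fin n → Subset n
  endsOf e = tabulate (λ i → incident i e)

  edgeRow : Fin (n * n) → Subset (n + M)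
  edgeRow y = endsOf (remQuot n y) Vec.++ Vec.replicate M false

  rows : Vec (Subset (n + M)) (n + M)
  rows = tabulate (λ i → Vec.replicate n false Vec.++ edgesAt i) Vec.++ (tabulate edgeRow Vec.++ tabulate edgeRow)

  lookup-edgesAt : ∀ i x → lookup (edgesAt i) x ≡ incident i (ends x)
  lookup-edgesAt i x = trans (Vec.lookup-splitAt (n * n) (half i) (half i) x) (cases (splitAt (n * n) x))
    where
    cases : ∀ s → [ lookup (half i) , lookup (half i) ]′ s ≡ incident i ([ remQuot n , remQuot n ]′ s)
    cases (inj₁ y) = Vec.lookup∘tabulate _ y
    cases (inj₂ y) = Vec.lookup∘tabulate _ y

  rows-left : ∀ i → lookup rows (i ↑ˡ M) ≡ Vec.replicate n false Vec.++ edgesAt i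
  rows-left i = trans (Vec.lookup-++ˡ (tabulate _) _ i) (Vec.lookup∘tabulate _ i)

  rows-right : ∀ x → lookup rows (n ↑ʳ x) ≡ endsOf (ends x) Vec.++ Vec.replicate M false
  rows-right x = trans (Vec.lookup-++ʳ (tabulate (λ i → Vec.replicate n false Vec.++ edgesAt i)) _ x)
    (trans (Vec.lookup-splitAt (n * n) (tabulate edgeRow) (tabulate edgeRow) x) (cases (splitAt (n * n) x)))
    where
    cases : ∀ s → [ lookup (tabulate edgeRow) , lookup (tabulate edgeRow) ]′ s ≡
                  endsOf ([ remQuot n , remQuot n ]′ s) Vec.++ Vec.replicate M false
    cases (inj₁ y) = Vec.lookup∘tabulate edgeRow y
    cases (inj₂ y) = Vec.lookup∘tabulate edgeRow y

  at-left-left : ∀ i j → lookup (lookup rows (i ↑ˡ M)) (j ↑ˡ M) ≡ false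
  at-left-left i j = trans (cong (λ r → lookup r (j ↑ˡ M)) (rows-left i))
    (trans (Vec.lookup-++ˡ (Vec.replicate n false) (edgesAt i) j) (Vec.lookup-replicate j false))

  at-left-right : ∀ i x → lookup (lookup rows (i ↑ˡ M)) (n ↑ʳ x) ≡ incident i (ends x)
  at-left-right i x = trans (cong (λ r → lookup r (n ↑ʳ x)) (rows-left i))
    (trans (Vec.lookup-++ʳ (Vec.replicate n false) (edgesAt i) x) (lookup-edgesAt i x))

  at-right-left : ∀ x i → lookup (lookup rows (n ↑ʳ x)) (i ↑ˡ M) ≡ incident i (ends x)
  at-right-left x i = trans (cong (λ r → lookup r (i ↑ˡ M)) (rows-right x))
    (trans (Vec.lookup-++ˡ (endsOf (ends x)) (Vec.replicate M false) i) (Vec.lookup∘tabulate _ i))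

  at-right-right : ∀ x y → lookup (lookup rows (n ↑ʳ x)) (n ↑ʳ y) ≡ false
  at-right-right x y = trans (cong (λ r → lookup r (n ↑ʳ y)) (rows-right x))
    (trans (Vec.lookup-++ʳ (endsOf (ends x)) (Vec.replicate M false) y) (Vec.lookup-replicate y false))

  rows-symmetric : ∀ u v → lookup (lookup rows v) u ≡ true → lookup (lookup rows u) v ≡ true
  rows-symmetric u v e with split n u | split n v
  ... | left i  | left j  with () ← trans (sym e) (at-left-left j i)
  ... | left i  | right y = trans (at-left-right i y) (trans (sym (at-right-left y i)) e)
  ... | right x | left j  = trans (at-right-left x j) (trans (sym (at-left-right j x)) e)
  ... | right x | right y with () ← trans (sym e) (at-right-right y x)

  rows-irreflexive : ∀ u → lookup (lookup rows u) u ≢ true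
  rows-irreflexive u e with split n u
  ... | left i  with () ← trans (sym e) (at-left-left i i)
  ... | right x with () ← trans (sym e) (at-right-right x x)

  subdivided : Graph (n + M)
  subdivided .Graph.neighborhoods = rows
  subdivided .Graph.symmetric {u} {v} h =
    Vec.lookup⇒[]= v _ (rows-symmetric u v (Vec.[]=⇒lookup h))
  subdivided .Graph.irreflexive {v} h = rows-irreflexive v (Vec.[]=⇒lookup h)

  module _ {k : ℕ} where

    Proper : Coloring n k → Set
    Proper a = ∀ u v c → lookup (N u) v ≡ true → lookup a u ≡ just c → lookup a v ≢ just c

    Balanced : Coloring M k → Set
    Balanced b = ∀ i c → 2 * ∣ edgesAt i ∩ colorClass b c ∣ ≤ ∣ edgesAt i ∣

    class-++ : ∀ (a : Coloring n k) (b : Coloring M k) c → colorClass (a Vec.++ b) c ≡ colorClass a c Vec.++ colorClass b c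
    class-++ a b c = Vec.map-++ _ a b

    count-left : ∀ (a : Coloring n k) (b : Coloring M k) i c → ∣ lookup rows (i ↑ˡ M) ∩ colorClass (a Vec.++ b) c ∣ ≡ ∣ edgesAt i ∩ colorClass b c ∣
    count-left a b i c = trans (cong₂ (λ r s → ∣ r ∩ s ∣) (rows-left i) (class-++ a b c))
      (trans (cong ∣_∣ (Vec.zipWith-++ _∧_ (Vec.replicate n false) (edgesAt i) (colorClass a c) (colorClass b c)))
        (trans (∣++∣ (Vec.replicate n false ∩ colorClass a c) _) (cong (_+ _) (∣none∩∣ (colorClass a c)))))

    count-right : ∀ (a : Coloring n k) (b : Coloring M k) x c → ∣ lookup rows (n ↑ʳ x) ∩ colorClass (a Vec.++ b) c ∣ ≡ ∣ endsOf (ends x) ∩ colorClass a c ∣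
    count-right a b x c = trans (cong₂ (λ r s → ∣ r ∩ s ∣) (rows-right x) (class-++ a b c))
      (trans (cong ∣_∣ (Vec.zipWith-++ _∧_ (endsOf (ends x)) (Vec.replicate M false) (colorClass a c) (colorClass b c)))
        (trans (∣++∣ (endsOf (ends x) ∩ colorClass a c) _)
          (trans (cong (∣ endsOf (ends x) ∩ colorClass a c ∣ +_) (∣none∩∣ (colorClass b c))) (ℕ.+-identityʳ _))))

    degree-left : ∀ i → ∣ lookup rows (i ↑ˡ M) ∣ ≡ ∣ edgesAt i ∣
    degree-left i = trans (cong ∣_∣ (rows-left i)) (trans (∣++∣ (Vec.replicate n false) (edgesAt i)) (cong (_+ ∣ edgesAt i ∣) (∣none∣ {n})))

    degree-right : ∀ x → ∣ lookup rows (n ↑ʳ x) ∣ ≡ ∣ endsOf (ends x) ∣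
    degree-right x = trans (cong ∣_∣ (rows-right x)) (trans (∣++∣ (endsOf (ends x)) _)
      (trans (cong (∣ endsOf (ends x) ∣ +_) (∣none∣ {M})) (ℕ.+-identityʳ _)))

    endsOf-edge : ∀ {p q} → lookup (N p) q ≡ true → endsOf (p , q) ≡ pair p q
    endsOf-edge {p} {q} e = Vec.tabulate-cong (λ i → cong (_∧ ((i == p) ∨ (i == q))) e)

    endsOf-none : ∀ {p q} → lookup (N p) q ≡ false → endsOf (p , q) ≡ tabulate (λ _ → false)
    endsOf-none {p} {q} e = Vec.tabulate-cong (λ i → cong (_∧ ((i == p) ∨ (i == q))) e)

    edge-≢ : ∀ {p q} → lookup (N p) q ≡ true → p ≢ q
    edge-≢ {p} e refl = irreflexive (Vec.lookup⇒[]= p _ e)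

    pair-≤ : ∀ (a : Coloring n k) {p q} c → lookup (N p) q ≡ true → ¬ (lookup a p ≡ just c × lookup a q ≡ just c) →
             2 * ∣ endsOf (p , q) ∩ colorClass a c ∣ ≤ ∣ endsOf (p , q) ∣
    pair-≤ a {p} {q} c e distinct = subst₂ (λ x y → 2 * x ≤ y)
      (sym (trans (cong (λ v → ∣ v ∩ colorClass a c ∣) (endsOf-edge e))
        (trans (∣pair∩∣ p q (colorClass a c) (edge-≢ e))
          (cong₂ (λ x y → b2n x + b2n y) (lookup-class a c p) (lookup-class a c q)))))
      (sym (trans (cong ∣_∣ (endsOf-edge e)) (∣pair∣ p q (edge-≢ e)))) at-most
      where
      at-most : 2 * (b2n (is c (lookup a p)) + b2n (is c (lookup a q))) ≤ 2
      at-most with is c (lookup a p) in ep | is c (lookup a q) in eq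
      ... | true  | true  = ⊥-elim (distinct (is-sound c _ ep , is-sound c _ eq))
      ... | true  | false = ≤-refl
      ... | false | true  = ≤-refl
      ... | false | false = z≤n

    pair-distinct : ∀ (a : Coloring n k) {p q} c → lookup (N p) q ≡ true → 2 * ∣ endsOf (p , q) ∩ colorClass a c ∣ ≤ ∣ endsOf (p , q) ∣ →
                    ¬ (lookup a p ≡ just c × lookup a q ≡ just c)
    pair-distinct a {p} {q} c e le (ep , eq) with subst₂ (λ x y → 2 * x ≤ y)
      (trans (cong (λ v → ∣ v ∩ colorClass a c ∣) (endsOf-edge e))
        (trans (∣pair∩∣ p q (colorClass a c) (edge-≢ e))
          (cong₂ (λ x y → b2n x + b2n y)
            (trans (lookup-class a c p) (trans (cong (is c) ep) (is-refl c)))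
            (trans (lookup-class a c q) (trans (cong (is c) eq) (is-refl c))))))
      (trans (cong ∣_∣ (endsOf-edge e)) (∣pair∣ p q (edge-≢ e))) le
    ... | s≤s (s≤s ())

    -- The subdivided graph is bipartite, so the condition falls into two independent parts. An old
    -- vertex sees only `b`. A new vertex on an edge has degree two, and its bound of one neighbor
    -- per color says that the ends of the edge differ.
    majority⇒ : ∀ a b → StrongMajority subdivided (a Vec.++ b) → Proper a × Balanced b
    majority⇒ a b h = proper , λ i c → subst₂ (λ x y → 2 * x ≤ y) (count-left a b i c) (degree-left i) (h (i ↑ˡ M) c)
      where
      proper : Proper a
      proper u v c e eu ev = pair-distinct a c e
        (subst (λ z → 2 * ∣ endsOf z ∩ colorClass a c ∣ ≤ ∣ endsOf z ∣) ends-x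
          (subst₂ (λ x y → 2 * x ≤ y) (count-right a b x c) (degree-right x) (h (n ↑ʳ x) c)))
        (eu , ev)
        where
        x : Fin M
        x = Fin.combine u v ↑ˡ (n * n)
        ends-x : ends x ≡ (u , v)
        ends-x = trans (cong [ remQuot n , remQuot n ]′ (Fin.splitAt-↑ˡ (n * n) (Fin.combine u v) (n * n))) (Fin.remQuot-combine u v)

    ⇒majority : ∀ a b → Proper a → Balanced b → StrongMajority subdivided (a Vec.++ b)
    ⇒majority a b pr ba u c with split n u
    ... | left i  = subst₂ (λ x y → 2 * x ≤ y) (sym (count-left a b i c)) (sym (degree-left i)) (ba i c)
    ... | right x = subst₂ (λ x y → 2 * x ≤ y) (sym (count-right a b x c)) (sym (degree-right x)) (pair-ok _ refl)
      where
      p = proj₁ (ends x)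
      q = proj₂ (ends x)
      pair-ok : ∀ e → lookup (N p) q ≡ e → 2 * ∣ endsOf (p , q) ∩ colorClass a c ∣ ≤ ∣ endsOf (p , q) ∣
      pair-ok true  e = pair-≤ a c e (λ (ep , eq) → pr p q c e ep eq)
      pair-ok false e = ≤-trans (≤-reflexive (cong (2 *_)
        (trans (cong (λ v → ∣ v ∩ colorClass a c ∣) (endsOf-none e)) (∣nowhere∩∣ (colorClass a c))))) z≤n

    proper-set : ∀ a i c → Proper a → (∀ u → u ∈ N i → lookup a u ≢ just c) → Proper (a [ i ]≔ just c)
    proper-set a i c pr ok u v d e eu ev with u Fin.≟ i | v Fin.≟ i
    ... | yes refl | yes refl = edge-≢ e refl
    ... | yes refl | no v≢    with refl ← trans (sym (set-same a i)) eu =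
      ok v (Vec.lookup⇒[]= v _ e) (trans (sym (set-other a i v v≢)) ev)
    ... | no u≢    | yes refl with refl ← trans (sym (set-same a i)) ev =
      ok u (symmetric (Vec.lookup⇒[]= i _ e)) (trans (sym (set-other a i u u≢)) eu)
    ... | no u≢    | no v≢    = pr u v d e (trans (sym (set-other a i u u≢)) eu) (trans (sym (set-other a i v v≢)) ev)

    set-proper : ∀ a i c → Uncolored a i → Proper (a [ i ]≔ just c) → ∀ u → u ∈ N i → lookup a u ≢ just c
    set-proper a i c un pr u h e = pr i u c (Vec.[]=⇒lookup h) (set-same a i)
      (trans (set-other a i u λ { refl → contradiction (trans (sym un) e) λ () }) e)

    Roomy : Coloring M k → Fin M → Fin n → Fin k → Set
    Roomy b x i c = lookup (edgesAt i) x ≡ true → 2 * suc ∣ edgesAt i ∩ colorClass b c ∣ ≤ ∣ edgesAt i ∣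

    -- If neither color had room at `i`, each would occupy at least half of the edges there, because
    -- the degree is even. Being disjoint, they would cover all of them, including the uncolored
    -- `x`.
    roomy-either : ∀ b x i {c d} → Uncolored b x → c ≢ d → Roomy b x i c ⊎ Roomy b x i d
    roomy-either b x i {c} {d} un ne
      with 2 * suc ∣ edgesAt i ∩ colorClass b c ∣ ℕ.≤? ∣ edgesAt i ∣ | 2 * suc ∣ edgesAt i ∩ colorClass b d ∣ ℕ.≤? ∣ edgesAt i ∣
    ... | yes h | _     = inj₁ (λ _ → h)
    ... | no _  | yes h = inj₂ (λ _ → h)
    ... | no h  | no h′ = inj₁ λ e → ⊥-elim (ℕ.<-irrefl refl (ℕ.<-≤-trans
      (≤-trans (class-slack (edgesAt i) b x ne e un) (≤-reflexive (∣++∣ (half i) (half i))))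
      (+-mono-≤ (tight _ h) (tight _ h′))))
      where
      tight : ∀ s → ¬ (2 * suc s ≤ ∣ edgesAt i ∣) → ∣ half i ∣ ≤ s
      tight s h = ℕ.≮⇒≥ λ lt → h (≤-trans (ℕ.*-monoʳ-≤ 2 lt)
        (≤-reflexive (trans (cong (∣ half i ∣ +_) (ℕ.+-identityʳ _)) (sym (∣++∣ (half i) (half i))))))

    roomy⇒balanced : ∀ b x c → Uncolored b x → Balanced b → (∀ i → Roomy b x i c) → Balanced (b [ x ]≔ just c)
    roomy⇒balanced b x c un ba room i d with c Fin.≟ d
    ... | no c≢ = ≤-trans (≤-reflexive (cong (2 *_) (class-≢ (edgesAt i) b x un c≢))) (ba i d)
    ... | yes refl with lookup (edgesAt i) x in e
    ...   | true  = ≤-trans (ℕ.*-monoʳ-≤ 2 (class-≡ (edgesAt i) b x un)) (room i e)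
    ...   | false = ≤-trans (≤-reflexive (cong (2 *_) (class-∉ (edgesAt i) b x c c e))) (ba i c)

    roomy-ends : ∀ b x c → Roomy b x (proj₁ (ends x)) c → Roomy b x (proj₂ (ends x)) c → ∀ i → Roomy b x i c
    roomy-ends b x c rp rq i e
      with i == proj₁ (ends x) in ep | i == proj₂ (ends x) in eq
         | lookup (N (proj₁ (ends x))) (proj₂ (ends x)) | trans (sym (lookup-edgesAt i x)) e
    ... | true  | _     | _     | _ with refl ← ==-sound i _ ep = rp e
    ... | false | true  | _     | _ with refl ← ==-sound i _ eq = rq e
    ... | false | false | true  | ()
    ... | false | false | false | ()

    -- Only the two ends restrict a new vertex. Among the colors 0, 1, 2 at least two have room at
    -- the first end, and of these two at least one has room at the second.
    extend : 3 ≤ k → ∀ b x → Uncolored b x → Balanced b → ∃[ c ] Balanced (b [ x ]≔ just c)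
    extend (s≤s (s≤s (s≤s _))) b x un ba = let c , p , q = choose in c , roomy⇒balanced b x c un ba (roomy-ends b x c p q)
      where
      P Q : Fin k → Set
      P = Roomy b x (proj₁ (ends x))
      Q = Roomy b x (proj₂ (ends x))
      pick : ∀ {c d} → c ≢ d → P c → P d → ∃[ c ] P c × Q c
      pick ne p p′ with roomy-either b x (proj₂ (ends x)) un ne
      ... | inj₁ q = _ , p , q
      ... | inj₂ q = _ , p′ , q
      choose : ∃[ c ] P c × Q c
      choose with roomy-either b x (proj₁ (ends x)) {zero} {suc zero} un (λ ())
                | roomy-either b x (proj₁ (ends x)) {zero} {suc (suc zero)} un (λ ())
                | roomy-either b x (proj₁ (ends x)) {suc zero} {suc (suc zero)} un (λ ())
      ... | inj₁ p₀ | _       | inj₁ p₁ = pick {zero} {suc zero} (λ ()) p₀ p₁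
      ... | inj₁ p₀ | _       | inj₂ p₂ = pick {zero} {suc (suc zero)} (λ ()) p₀ p₂
      ... | inj₂ p₁ | inj₁ p₀ | _       = pick {zero} {suc zero} (λ ()) p₀ p₁
      ... | inj₂ p₁ | inj₂ p₂ | _       = pick {suc zero} {suc (suc zero)} (λ ()) p₁ p₂

    WinsSM : Player → Coloring (n + M) k → Set
    WinsSM     = AliceWins (LegalStrongMajority subdivided {k}) (SomeVertexStuck subdivided)

    WinsProper : Player → Coloring n k → Set
    WinsProper = AliceWins (LegalProper G {k}) (NoProperMove G)

    legal-left : ∀ a b i c → Proper a → Balanced b → LegalProper G a i c → LegalStrongMajority subdivided (a Vec.++ b) (i ↑ˡ M) c
    legal-left a b i c pr ba (un , ok) = trans (Vec.lookup-++ˡ a b i) un ,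
      subst (StrongMajority subdivided) (sym (Vec.[]≔-++-↑ˡ a b i))
        (⇒majority (a [ i ]≔ just c) b (proper-set a i c pr ok) ba)

    left-legal : ∀ a b i c → LegalStrongMajority subdivided (a Vec.++ b) (i ↑ˡ M) c → LegalProper G a i c × Proper (a [ i ]≔ just c)
    left-legal a b i c (un , sm) = (un′ , set-proper a i c un′ pr) , pr
      where
      un′ = trans (sym (Vec.lookup-++ˡ a b i)) un
      pr = proj₁ (majority⇒ (a [ i ]≔ just c) b (subst (StrongMajority subdivided) (Vec.[]≔-++-↑ˡ a b i) sm))

    legal-right : ∀ a b x c → Proper a → Uncolored b x → Balanced (b [ x ]≔ just c) →
                  LegalStrongMajority subdivided (a Vec.++ b) (n ↑ʳ x) c
    legal-right a b x c pr un ba = trans (Vec.lookup-++ʳ a b x) un ,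
      subst (StrongMajority subdivided) (sym (Vec.[]≔-++-↑ʳ a b x)) (⇒majority a (b [ x ]≔ just c) pr ba)

    right-legal : ∀ a b x c → LegalStrongMajority subdivided (a Vec.++ b) (n ↑ʳ x) c → Uncolored b x × Balanced (b [ x ]≔ just c)
    right-legal a b x c (un , sm) = trans (sym (Vec.lookup-++ʳ a b x)) un ,
      proj₂ (majority⇒ a (b [ x ]≔ just c) (subst (StrongMajority subdivided) (Vec.[]≔-++-↑ʳ a b x) sm))

    -- Colors of neighbors are never taken back, so the vertex stays without a proper color and the
    -- graph is never completed. This reconciles the two winning conditions of Bob.
    stuck-loses : ∀ {p a i} → WinsProper p a → Uncolored a i → (∀ c → ¬ LegalProper G a i c) → ⊥
    stuck-loses {i = i} (complete full) un none = full i un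
    stuck-loses {a = a} {i} (aliceMoves nb j c legal w) un none with i Fin.≟ j
    ... | yes refl = none c legal
    ... | no i≢j = stuck-loses w (trans (set-other a j i i≢j) un) (stays-stuck a i j c i≢j un (proj₁ legal) none)
      where
      stays-stuck : ∀ a i j c → i ≢ j → Uncolored a i → Uncolored a j → (∀ c → ¬ LegalProper G a i c) →
                    ∀ d → ¬ LegalProper G (a [ j ]≔ just c) i d
      stays-stuck a i j c i≢j un un′ none d (_ , ok) = none d (un , λ u h e →
        ok u h (trans (set-other a j u λ { refl → contradiction (trans (sym un′) e) λ () }) e))
    stuck-loses {a = a} {i} (bobMoves nb f) un none = nb ((λ full → full i un) , λ j c legal →
      stuck-loses (f j c legal)
        (trans (set-other a j i λ { refl → none c legal }) un)
        λ d (_ , ok) → none d (un , λ u h e → ok u h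
          (trans (set-other a j u λ { refl → contradiction (trans (sym (proj₁ legal)) e) λ () }) e)))

    module _ (3≤k : 3 ≤ k) where

      never-stuck : ∀ a b → Proper a → Balanced b → (∀ i → Uncolored a i → ¬ (∀ c → ¬ LegalProper G a i c)) →
                    ¬ SomeVertexStuck subdivided {k} (a Vec.++ b)
      never-stuck a b pr ba h (v , un , none) with split n v
      ... | left i  = h i (trans (sym (Vec.lookup-++ˡ a b i)) un) λ c legal → none c (legal-left a b i c pr ba legal)
      ... | right x = let un′ = trans (sym (Vec.lookup-++ʳ a b x)) un
                          c , ba′ = extend 3≤k b x un′ ba in none c (legal-right a b x c pr un′ ba′)

      -- Once the old vertices are colored, `extend` colors the remaining new ones whatever the
      -- players do.
      finish-edges : ∀ m p a b → uncoloredCount b ≡ m → Complete a → Proper a → Balanced b → WinsSM p (a Vec.++ b)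
      finish-edges zero p a b e full pr ba = complete λ v un → done? v un
        where
        done? : Complete (a Vec.++ b)
        done? v un with split n v
        ... | left i  = full i (trans (sym (Vec.lookup-++ˡ a b i)) un)
        ... | right x = uncoloredCount-zero b e x (trans (sym (Vec.lookup-++ʳ a b x)) un)
      finish-edges (suc m) alice a b e full pr ba = aliceMoves
        (never-stuck a b pr ba (λ i un _ → full i un)) (n ↑ʳ x) c (legal-right a b x c pr un ba′)
        (subst (WinsSM bob) (sym (Vec.[]≔-++-↑ʳ a b x))
          (finish-edges m bob a (b [ x ]≔ just c) (ℕ.suc-injective (trans (sym (uncoloredCount-set b x un)) e)) full pr ba′))
        where
        found = uncoloredCount-suc b e
        x  = proj₁ found
        un = proj₂ found
        c   = proj₁ (extend 3≤k b x un ba)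
        ba′ = proj₂ (extend 3≤k b x un ba)
      finish-edges (suc m) bob a b e full pr ba = bobMoves (never-stuck a b pr ba (λ i un _ → full i un)) reply
        where
        reply : ∀ v c → LegalStrongMajority subdivided (a Vec.++ b) v c → WinsSM alice ((a Vec.++ b) [ v ]≔ just c)
        reply v c legal with split n v
        ... | left i  = ⊥-elim (full i (proj₁ (proj₁ (left-legal a b i c legal))))
        ... | right x = let un , ba′ = right-legal a b x c legal in
          subst (WinsSM alice) (sym (Vec.[]≔-++-↑ʳ a b x))
            (finish-edges m alice a (b [ x ]≔ just c) (ℕ.suc-injective (trans (sym (uncoloredCount-set b x un)) e)) full pr ba′)

      -- The uncolored new vertices remain even in number between exchanges, so a move of Bob on one
      -- of them leaves another for Alice's answer.
      proper⇒majority : ∀ m {p} a b → uncoloredCount b ≡ m + m → WinsProper p a → Proper a → Balanced b → WinsSM p (a Vec.++ b)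
      proper⇒majority m {p} a b e (complete full) pr ba = finish-edges (m + m) p a b e full pr ba
      proper⇒majority m a b e t@(aliceMoves nb i c legal w) pr ba = aliceMoves
        (never-stuck a b pr ba (λ i → stuck-loses t)) (i ↑ˡ M) c (legal-left a b i c pr ba legal)
        (subst (WinsSM bob) (sym (Vec.[]≔-++-↑ˡ a b i))
          (proper⇒majority m (a [ i ]≔ just c) b e w (proper-set a i c pr (proj₂ legal)) ba))
      proper⇒majority m a b e t@(bobMoves nb f) pr ba = bobMoves (never-stuck a b pr ba (λ i → stuck-loses t)) reply
        where
        answer : ∀ m x c → uncoloredCount b ≡ m + m → Uncolored b x → Balanced (b [ x ]≔ just c) →
                 (∀ m′ b′ → m ≡ suc m′ → uncoloredCount b′ ≡ m′ + m′ → Balanced b′ → WinsSM bob (a Vec.++ b′)) →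
                 WinsSM alice (a Vec.++ (b [ x ]≔ just c))
        answer zero    x c e un ba′ go-on = ⊥-elim (uncoloredCount-zero b e x un)
        answer (suc m) x c e un ba′ go-on = aliceMoves
          (never-stuck a b₁ pr ba′ (λ i → stuck-loses t)) (n ↑ʳ y) d (legal-right a b₁ y d pr un₂ ba″)
          (subst (WinsSM bob) (sym (Vec.[]≔-++-↑ʳ a b₁ y))
            (go-on m _ refl (ℕ.suc-injective (trans (sym (uncoloredCount-set b₁ y un₂)) odd)) ba″))
          where
          b₁ = b [ x ]≔ just c
          odd : uncoloredCount b₁ ≡ suc (m + m)
          odd = ℕ.suc-injective (trans (sym (uncoloredCount-set b x un)) (trans e (cong suc (ℕ.+-suc m m))))
          found = uncoloredCount-suc b₁ odd
          y   = proj₁ found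
          un₂ = proj₂ found
          d   = proj₁ (extend 3≤k b₁ y un₂ ba′)
          ba″ = proj₂ (extend 3≤k b₁ y un₂ ba′)
        reply : ∀ v c → LegalStrongMajority subdivided (a Vec.++ b) v c → WinsSM alice ((a Vec.++ b) [ v ]≔ just c)
        reply v c legal with split n v
        ... | left i  = let legal′ , pr′ = left-legal a b i c legal in
          subst (WinsSM alice) (sym (Vec.[]≔-++-↑ˡ a b i)) (proper⇒majority m (a [ i ]≔ just c) b e (f i c legal′) pr′ ba)
        ... | right x = let un , ba′ = right-legal a b x c legal in
          subst (WinsSM alice) (sym (Vec.[]≔-++-↑ʳ a b x))
            -- After such an exchange the strategy `t` is resumed unchanged; the recursion descends
            -- because `m` drops to `m′`.
            (answer m x c e un ba′ λ { m′ b′ refl e′ ba″ → proper⇒majority m′ a b′ e′ t pr ba″ })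

      some-move : ∀ a b → Proper a → Balanced b → ¬ SomeVertexStuck subdivided {k} (a Vec.++ b) → ¬ NoProperMove G a
      some-move a b pr ba ns (partial , none) with uncoloredCount a in e
      ... | zero  = partial (uncoloredCount-zero a e)
      ... | suc _ = let i , un = uncoloredCount-suc a e in
        ns (i ↑ˡ M , trans (Vec.lookup-++ˡ a b i) un , λ c legal → none i c (proj₁ (left-legal a b i c legal)))

      -- A move of the given strategy on a new vertex has no counterpart in the proper game. It is
      -- followed by an imagined reply of Bob on another new vertex, which exists by parity, and the
      -- strategy is consulted again at the same `a`.
      majority⇒proper : ∀ {p col} → WinsSM p col → ∀ m a b → col ≡ a Vec.++ b → uncoloredCount b ≡ m + m →
                        Proper a → Balanced b → WinsProper p a
      majority⇒proper (complete full) m a b refl e pr ba =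
        complete λ i un → full (i ↑ˡ M) (trans (Vec.lookup-++ˡ a b i) un)
      majority⇒proper (aliceMoves ns v c legal w) m a b refl e pr ba with split n v
      ... | left i = let legal′ , pr′ = left-legal a b i c legal in
        aliceMoves (some-move a b pr ba ns) i c legal′
          (majority⇒proper w m (a [ i ]≔ just c) b (Vec.[]≔-++-↑ˡ a b i) e pr′ ba)
      ... | right x = respond m e w
        where
        un  = proj₁ (right-legal a b x c legal)
        ba′ = proj₂ (right-legal a b x c legal)
        b₁  = b [ x ]≔ just c
        respond : ∀ m → uncoloredCount b ≡ m + m → WinsSM bob ((a Vec.++ b) [ n ↑ʳ x ]≔ just c) → WinsProper alice a
        respond zero    e _ = ⊥-elim (uncoloredCount-zero b e x un)
        respond (suc m) e w = pass w
          where
          odd : uncoloredCount b₁ ≡ suc (m + m)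
          odd = ℕ.suc-injective (trans (sym (uncoloredCount-set b x un)) (trans e (cong suc (ℕ.+-suc m m))))
          y   = proj₁ (uncoloredCount-suc b₁ odd)
          un₂ = proj₂ (uncoloredCount-suc b₁ odd)
          d   = proj₁ (extend 3≤k b₁ y un₂ ba′)
          ba″ = proj₂ (extend 3≤k b₁ y un₂ ba′)
          legal₂ : LegalStrongMajority subdivided ((a Vec.++ b) [ n ↑ʳ x ]≔ just c) (n ↑ʳ y) d
          legal₂ = subst (λ col → LegalStrongMajority subdivided col (n ↑ʳ y) d) (sym (Vec.[]≔-++-↑ʳ a b x))
            (legal-right a b₁ y d pr un₂ ba″)
          pass : WinsSM bob ((a Vec.++ b) [ n ↑ʳ x ]≔ just c) → WinsProper alice a
          pass (complete full) = ⊥-elim (full (n ↑ʳ y) (proj₁ legal₂))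
          pass (bobMoves _ f)  = majority⇒proper (f (n ↑ʳ y) d legal₂) m a (b₁ [ y ]≔ just d)
            (trans (cong (_[ n ↑ʳ y ]≔ just d) (Vec.[]≔-++-↑ʳ a b x)) (Vec.[]≔-++-↑ʳ a b₁ y))
            (ℕ.suc-injective (trans (sym (uncoloredCount-set b₁ y un₂)) odd)) pr ba″
      majority⇒proper (bobMoves ns f) m a b refl e pr ba = bobMoves (some-move a b pr ba ns) λ i c legal →
        majority⇒proper (f (i ↑ˡ M) c (legal-left a b i c pr ba legal)) m (a [ i ]≔ just c) b (Vec.[]≔-++-↑ˡ a b i) e
          (proper-set a i c pr (proj₂ legal)) ba

      proper-uncolored : Proper (uncolored {n} {k})
      proper-uncolored u v c _ e _ with () ← trans (sym (Vec.lookup-replicate u nothing)) e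

      balanced-uncolored : Balanced (uncolored {M} {k})
      balanced-uncolored i c = ≤-trans (≤-reflexive (cong (2 *_) (nobody (edgesAt i)))) z≤n
        where
        nobody : ∀ {m} (p : Subset m) → ∣ p ∩ colorClass (uncolored {m} {k}) c ∣ ≡ 0
        nobody []          = refl
        nobody (true  ∷ p) = nobody p
        nobody (false ∷ p) = nobody p

      subdivision-wins : AliceWinsProper G k ⇔ AliceWinsStrongMajority subdivided k
      subdivision-wins = mk⇔
        (λ t → subst (WinsSM alice) (sym start)
          (proper⇒majority (n * n) uncolored uncolored (uncoloredCount-uncolored M) t proper-uncolored balanced-uncolored))
        (λ t → majority⇒proper t (n * n) uncolored uncolored start (uncoloredCount-uncolored M) proper-uncolored balanced-uncolored)
        where
        start : uncolored {n + M} {k} ≡ uncolored {n} Vec.++ uncolored {M}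
        start = replicate-+ n M nothing

-- Truth of formulas, lists of bits and binary numerals

infix 0 _⟺_

_⟺_ : Bool → Set → Set
b ⟺ P = (b ≡ true → P) × (P → b ≡ true)

⟺-id : ∀ {b} → b ⟺ (b ≡ true)
⟺-id = id , id

⟺-map : ∀ {b P Q} → (P → Q) → (Q → P) → b ⟺ P → b ⟺ Q
⟺-map f g (s , c) = f ∘ s , c ∘ g

⟺-∧ : ∀ {a b P Q} → a ⟺ P → b ⟺ Q → a ∧ b ⟺ P × Q
⟺-∧ {true}  {b} (s , c) (s′ , c′) = (λ e → s refl , s′ e) , c′ ∘ proj₂
⟺-∧ {false} {b} (s , c) (s′ , c′) = (λ ()) , λ (p , _) → c p

⟺-not : ∀ {a P} → a ⟺ P → not a ⟺ ¬ P
⟺-not {true}  (s , c) = (λ ()) , λ np → ⊥-elim (np (s refl))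
⟺-not {false} (s , c) = (λ _ p → contradiction (c p) λ ()) , λ _ → refl

⟺-false : ∀ {a P} → a ⟺ P → a ≡ false → ¬ P
⟺-false (s , c) e p = contradiction (trans (sym (c p)) e) λ ()

⟺-⇒ : ∀ {a b P Q} → a ⟺ P → b ⟺ Q → not (a ∧ not b) ⟺ (P → Q)
⟺-⇒ {true}  {true}  p q = (λ _ _ → proj₁ q refl) , λ _ → refl
⟺-⇒ {true}  {false} p q = (λ ()) , λ f → ⊥-elim (⟺-false q refl (f (proj₁ p refl)))
⟺-⇒ {false} {b}     p q = (λ _ x → ⊥-elim (⟺-false p refl x)) , λ _ → refl

⟺-∨ : ∀ {a b P Q} → a ⟺ P → b ⟺ Q → not (not a ∧ not b) ⟺ P ⊎ Q
⟺-∨ {true}  {b}     p q = (λ _ → inj₁ (proj₁ p refl)) , λ _ → refl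
⟺-∨ {false} {true}  p q = (λ _ → inj₂ (proj₁ q refl)) , λ _ → refl
⟺-∨ {false} {false} p q = (λ ()) , [ (λ x → ⊥-elim (⟺-false p refl x)) , (λ x → ⊥-elim (⟺-false q refl x)) ]′

⟺-≡ : ∀ {a b} → not (a ∧ not b) ∧ not (b ∧ not a) ⟺ (a ≡ b)
⟺-≡ {true}  {true}  = (λ _ → refl) , λ _ → refl
⟺-≡ {true}  {false} = (λ ()) , λ ()
⟺-≡ {false} {true}  = (λ ()) , λ ()
⟺-≡ {false} {false} = (λ _ → refl) , λ _ → refl

⟺-< : ∀ {x y} → (x <ᵇ y) ⟺ x < y
⟺-< {x} {y} = (λ e → ℕ.<ᵇ⇒< x y (subst T (sym e) tt)) , λ l → to-true (ℕ.<⇒<ᵇ l)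
  where
  to-true : ∀ {b} → T b → b ≡ true
  to-true {true} _ = refl

⟺-= : ∀ {x y} → not (x <ᵇ y) ∧ not (y <ᵇ x) ⟺ x ≡ y
⟺-= {x} {y} = ⟺-map (λ (h , k) → ℕ.≤-antisym (ℕ.≮⇒≥ k) (ℕ.≮⇒≥ h)) (λ { refl → ℕ.<-irrefl refl , ℕ.<-irrefl refl })
  (⟺-∧ (⟺-not (⟺-< {x} {y})) (⟺-not (⟺-< {y} {x})))

⟺-unique : ∀ {a b P} → a ⟺ P → b ⟺ P → a ≡ b
⟺-unique {true}  {b}     p q = sym (proj₂ q (proj₁ p refl))
⟺-unique {false} {true}  p q = proj₂ p (proj₁ q refl)
⟺-unique {false} {false} p q = refl

count-cong : ∀ n {f g} → (∀ x → x < n → f x ≡ g x) → count n f ≡ count n g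
count-cong zero    h = refl
count-cong (suc n) h = cong₂ _+_ (cong b2n (h n ≤-refl)) (count-cong n (λ x x<n → h x (ℕ.m<n⇒m<1+n x<n)))

count-none : ∀ n {f} → (∀ x → x < n → f x ≡ false) → count n f ≡ 0
count-none zero    h = refl
count-none (suc n) h = cong₂ _+_ (cong b2n (h n ≤-refl)) (count-none n (λ x x<n → h x (ℕ.m<n⇒m<1+n x<n)))

count-some : ∀ n {f} x → x < n → f x ≡ true → 0 < count n f
count-some (suc n) {f} x x<n e with x ℕ.≟ n
... | yes refl rewrite e = s≤s z≤n
... | no x≢n   = ≤-trans (count-some n x (ℕ.≤∧≢⇒< (ℕ.≤-pred x<n) x≢n) e) (m≤n+m _ (b2n (f n)))

count-witness : ∀ n f → 0 < count n f → ∃[ x ] x < n × f x ≡ true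
count-witness (suc n) f h with f n in e
... | true  = n , ≤-refl , e
... | false = let x , x<n , e′ = count-witness n f h in x , ℕ.m<n⇒m<1+n x<n , e′

⟺-∃ : ∀ {n f} {P : ℕ → Set} → (∀ x → x < n → f x ⟺ P x) → (count n (λ _ → false) <ᵇ count n f + count n f) ⟺ (∃[ x ] x < n × P x)
⟺-∃ {n} {f} {P} h = ⟺-map to from ⟺-<
  where
  none : count n (λ _ → false) ≡ 0
  none = count-none n (λ _ _ → refl)
  to : count n (λ _ → false) < count n f + count n f → ∃[ x ] x < n × P x
  to lt with count n f in e
  ... | suc c = let x , x<n , fx = count-witness n f (subst (0 <_) (sym e) (s≤s z≤n)) in x , x<n , proj₁ (h x x<n) fx
  from : (∃[ x ] x < n × P x) → count n (λ _ → false) < count n f + count n f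
  from (x , x<n , p) = subst (_< count n f + count n f) (sym none)
    (≤-trans (count-some n x x<n (proj₂ (h x x<n) p)) (m≤m+n _ _))

⟺-∀ : ∀ {n f} {P : ℕ → Set} → (∀ x → x < n → f x ⟺ P x) →
      not (count n (λ _ → false) <ᵇ count n (not ∘ f) + count n (not ∘ f)) ⟺ (∀ x → x < n → P x)
⟺-∀ {n} {f} {P} h = ⟺-map to (λ a (x , x<n , np) → np (a x x<n)) (⟺-not (⟺-∃ {P = λ x → ¬ P x} (λ x x<n → ⟺-not (h x x<n))))
  where
  to : ¬ (∃[ x ] x < n × ¬ P x) → ∀ x → x < n → P x
  to no-counter x x<n with f x in e
  ... | true  = proj₁ (h x x<n) e
  ... | false = ⊥-elim (no-counter (x , x<n , ⟺-false (h x x<n) e))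

-- Counts make sense for Boolean tests only, so predicates are compared through all tests that
-- reflect them. Any two such tests agree, which makes the choice immaterial.
AtMostHalf : ℕ → (ℕ → Set) → (ℕ → Set) → Set
AtMostHalf n P Q = ∀ f g → (∀ x → x < n → f x ⟺ P x) → (∀ x → x < n → g x ⟺ Q x) → count n f + count n f ≤ count n g

⟺-half : ∀ {n f g P Q} → (∀ x → x < n → f x ⟺ P x) → (∀ x → x < n → g x ⟺ Q x) →
         not (count n g <ᵇ count n f + count n f) ⟺ AtMostHalf n P Q
⟺-half {n} {f} {g} p q = ⟺-map
  (λ le f′ g′ p′ q′ → subst₂ (λ x y → x + x ≤ y) (count-cong n (λ x x<n → ⟺-unique (p x x<n) (p′ x x<n)))
    (count-cong n (λ x x<n → ⟺-unique (q x x<n) (q′ x x<n))) (ℕ.≮⇒≥ le))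
  (λ half lt → ℕ.<-irrefl refl (ℕ.<-≤-trans lt (half f g p q)))
  (⟺-not (⟺-< {count n g} {count n f + count n f}))

module _ {R D : ℕ} where

  falseF trueF : Formula R D
  falseF = one ≺ one
  trueF  = neg falseF

  infixr 3 _⟹_ _∥_ _⟷_
  infix  5 _≈_

  _⟹_ _∥_ _⟷_ : Formula R D → Formula R D → Formula R D
  φ ⟹ ψ = neg (φ & neg ψ)
  φ ∥ ψ = neg (neg φ & neg ψ)
  φ ⟷ ψ = (φ ⟹ ψ) & (ψ ⟹ φ)

  _≈_ : Term R D → Term R D → Formula R D
  p ≈ q = neg (p ≺ q) & neg (q ≺ p)

  -- No index satisfies `falseF`, and zero is less than twice a count exactly if the count is
  -- positive.
  some every : Fin D → Fin R → Formula R D → Formula R D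
  some i r φ  = fewer i r falseF φ
  every i r φ = neg (some i r (neg φ))

nth-++ : ∀ xs ys t → nth (xs ++ ys) (length xs + t) ≡ nth ys t
nth-++ []       ys t = refl
nth-++ (x ∷ xs) ys t = nth-++ xs ys t

nth-++ˡ : ∀ xs ys t → t < length xs → nth (xs ++ ys) t ≡ nth xs t
nth-++ˡ (x ∷ xs) ys zero    h       = refl
nth-++ˡ (x ∷ xs) ys (suc t) (s≤s h) = nth-++ˡ xs ys t h

nth-[] : ∀ t → nth [] t ≡ false
nth-[] t = cong (is-true ∘ List.head) (List.drop-[] t)

nth-drop : ∀ c t xs → nth xs (c + t) ≡ nth (List.drop c xs) t
nth-drop zero    t xs       = refl
nth-drop (suc c) t []       = trans (nth-[] (suc c + t)) (sym (nth-[] t))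
nth-drop (suc c) t (x ∷ xs) = nth-drop c t xs

leading : List Bool → ℕ
leading (true ∷ w) = suc (leading w)
leading _          = 0

leading-≤ : ∀ w → leading w ≤ length w
leading-≤ []          = z≤n
leading-≤ (true  ∷ w) = s≤s (leading-≤ w)
leading-≤ (false ∷ w) = z≤n

leading-true : ∀ w j → j < leading w → nth w j ≡ true
leading-true (true ∷ w) zero    h       = refl
leading-true (true ∷ w) (suc j) (s≤s h) = leading-true w j h

leading-false : ∀ w → nth w (leading w) ≡ false
leading-false []          = refl
leading-false (true  ∷ w) = leading-false w
leading-false (false ∷ w) = refl

leading-split : ∀ w → leading w < length w → ∃[ v ] w ≡ ones (leading w) ++ false ∷ v
leading-split (true  ∷ w) (s≤s h) = let v , e = leading-split w h in v , cong (true ∷_) e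
leading-split (false ∷ w) h       = w , refl

leading-ones : ∀ n v → leading (ones n ++ false ∷ v) ≡ n
leading-ones zero    v = refl
leading-ones (suc n) v = cong suc (leading-ones n v)

toList-tabulate : ∀ c l → c ≤ length l → toList (tabulate {n = c} (λ j → nth l (toℕ j))) ≡ List.take c l
toList-tabulate zero    l       h       = refl
toList-tabulate (suc c) (x ∷ l) (s≤s h) = cong (x ∷_) (toList-tabulate c l h)

toList-matrix : ∀ r c l → r * c ≤ length l →
  toList (Vec.concat (tabulate {n = r} (λ i → tabulate {n = c} (λ j → nth l (toℕ i * c + toℕ j))))) ≡ List.take (r * c) l
toList-matrix zero    c l h = refl
toList-matrix (suc r) c l h = begin
  toList (tabulate {n = c} (λ j → nth l (toℕ j)) Vec.++ Vec.concat (tabulate {n = r} (λ i → tabulate {n = c} (λ j → nth l (c + toℕ i * c + toℕ j)))))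
    ≡⟨ Vec.toList-++ (tabulate {n = c} (λ j → nth l (toℕ j))) _ ⟩
  toList (tabulate {n = c} (λ j → nth l (toℕ j))) ++ toList (Vec.concat (tabulate {n = r} (λ i → tabulate {n = c} (λ j → nth l (c + toℕ i * c + toℕ j)))))
    ≡⟨ cong₂ _++_ (toList-tabulate c l (≤-trans (m≤m+n c (r * c)) h))
         (cong (toList ∘ Vec.concat) (Vec.tabulate-cong {n = r} (λ i → Vec.tabulate-cong {n = c} (λ j →
           trans (cong (nth l) (ℕ.+-assoc c (toℕ i * c) (toℕ j))) (nth-drop c (toℕ i * c + toℕ j) l))))) ⟩
  List.take c l ++ toList (Vec.concat (tabulate {n = r} (λ i → tabulate {n = c} (λ j → nth (List.drop c l) (toℕ i * c + toℕ j)))))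
    ≡⟨ cong (List.take c l ++_) (toList-matrix r c (List.drop c l)
         (≤-trans (ℕ.m+n≤o⇒m≤o∸n (r * c) (≤-trans (≤-reflexive (ℕ.+-comm (r * c) c)) h)) (≤-reflexive (sym (List.length-drop c l))))) ⟩
  List.take c l ++ List.take (r * c) (List.drop c l)
    ≡⟨ take-take c (r * c) l ⟩
  List.take (c + r * c) l ∎
  where
  open ≡-Reasoning
  take-take : ∀ a b (l : List Bool) → List.take a l ++ List.take b (List.drop a l) ≡ List.take (a + b) l
  take-take zero    b l       = refl
  take-take (suc a) b []      = List.take-[] b
  take-take (suc a) b (x ∷ l) = cong (x ∷_) (take-take a b l)

length-toList : ∀ {A : Set} {m} (v : Vec A m) → length (toList v) ≡ m
length-toList []      = refl
length-toList (x ∷ v) = cong suc (length-toList v)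

nth-toList : ∀ {m} (v : Vec Bool m) (j : Fin m) ys → nth (toList v ++ ys) (toℕ j) ≡ lookup v j
nth-toList (x ∷ v) zero    ys = refl
nth-toList (x ∷ v) (suc j) ys = nth-toList v j ys

nth-matrix : ∀ {r c} (A : Vec (Vec Bool c) r) (i : Fin r) (j : Fin c) ys →
             nth (toList (Vec.concat A) ++ ys) (toℕ i * c + toℕ j) ≡ lookup (lookup A i) j
nth-matrix {c = c} (v ∷ A) i j ys = trans
  (cong (λ l → nth l (toℕ i * c + toℕ j)) (trans (cong (_++ ys) (Vec.toList-++ v (Vec.concat A))) (List.++-assoc (toList v) _ ys)))
  (cases i)
  where
  cases : ∀ i → nth (toList v ++ toList (Vec.concat A) ++ ys) (toℕ i * c + toℕ j) ≡ lookup (lookup (v ∷ A) i) j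
  cases zero    = nth-toList v j _
  cases (suc i) = trans (cong (nth (toList v ++ toList (Vec.concat A) ++ ys))
      (trans (ℕ.+-assoc c (toℕ i * c) (toℕ j)) (cong (_+ (toℕ i * c + toℕ j)) (sym (length-toList v)))))
    (trans (nth-++ (toList v) _ (toℕ i * c + toℕ j)) (nth-matrix A i j ys))

-- Binary numerals

bitsVal : ℕ → (ℕ → Bool) → ℕ
bitsVal zero    f = 0
bitsVal (suc m) f = b2n (f 0) + 2 * bitsVal m (f ∘ suc)

listVal : List Bool → ℕ
listVal []      = 0
listVal (b ∷ l) = b2n b + 2 * listVal l

bitsVal-cong : ∀ m {f g} → (∀ q → q < m → f q ≡ g q) → bitsVal m f ≡ bitsVal m g
bitsVal-cong zero    h = refl
bitsVal-cong (suc m) h = cong₂ (λ x y → b2n x + 2 * y) (h 0 (s≤s z≤n)) (bitsVal-cong m (λ q q<m → h (suc q) (s≤s q<m)))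

bitsVal-list : ∀ m l → length l ≤ m → bitsVal m (nth l) ≡ listVal l
bitsVal-list zero    []      h       = refl
bitsVal-list (suc m) []      h       = cong (2 *_) (trans (bitsVal-cong m (λ q _ → sym (nth-[] q))) (bitsVal-list m [] z≤n))
bitsVal-list (suc m) (b ∷ l) (s≤s h) = cong (λ x → b2n b + 2 * x) (bitsVal-list m l h)

parity-< : ∀ a b {x y} → x < y → b2n a + 2 * x < b2n b + 2 * y
parity-< a b {x} {y} h = ≤-trans (s≤s (ℕ.+-monoˡ-≤ (2 * x) (b2n≤1 a)))
  (≤-trans (≤-reflexive (sym (ℕ.*-suc 2 x))) (≤-trans (ℕ.*-monoʳ-≤ 2 h) (m≤n+m _ (b2n b))))
  where
  b2n≤1 : ∀ b → b2n b ≤ 1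
  b2n≤1 true  = ≤-refl
  b2n≤1 false = z≤n

parity-injective : ∀ a b {x y} → b2n a + 2 * x ≡ b2n b + 2 * y → a ≡ b × x ≡ y
parity-injective a b {x} {y} e with ℕ.<-cmp x y
... | tri< h _ _ = ⊥-elim (ℕ.<-irrefl e (parity-< a b h))
... | tri> _ _ h = ⊥-elim (ℕ.<-irrefl (sym e) (parity-< b a h))
parity-injective true  true  e | tri≈ _ refl _ = refl , refl
parity-injective false false e | tri≈ _ refl _ = refl , refl
parity-injective true  false e | tri≈ _ refl _ = ⊥-elim (ℕ.1+n≢n e)
parity-injective false true  e | tri≈ _ refl _ = ⊥-elim (ℕ.1+n≢n (sym e))

bitsVal-injective : ∀ m {f g} → bitsVal m f ≡ bitsVal m g → ∀ q → q < m → f q ≡ g q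
bitsVal-injective (suc m) {f} {g} e zero    h       = proj₁ (parity-injective (f 0) (g 0) {bitsVal m (f ∘ suc)} {bitsVal m (g ∘ suc)} e)
bitsVal-injective (suc m) {f} {g} e (suc q) (s≤s h) = bitsVal-injective m (proj₂ (parity-injective (f 0) (g 0) {bitsVal m (f ∘ suc)} {bitsVal m (g ∘ suc)} e)) q h

-- The order of numerals expressed at the most significant digit where they differ. Unlike `bitsVal`
-- it is first-order, and `paletteF` states it.
Below : ℕ → (ℕ → Bool) → (ℕ → Bool) → Set
Below m f g = ∃[ p ] p < m × f p ≡ false × g p ≡ true × (∀ q → q < m → p < q → f q ≡ g q)

Below⇒< : ∀ m {f g} → Below m f g → bitsVal m f < bitsVal m g
Below⇒< (suc m) {f} {g} (zero , _ , ef , eg , h)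
  rewrite ef | eg = s≤s (≤-reflexive (cong (2 *_) (bitsVal-cong m (λ q q<m → h (suc q) (s≤s q<m) (s≤s z≤n)))))
Below⇒< (suc m) {f} {g} (suc p , s≤s p<m , ef , eg , h) =
  parity-< (f 0) (g 0) (Below⇒< m (p , p<m , ef , eg , λ q q<m p<q → h (suc q) (s≤s q<m) (s≤s p<q)))

<⇒Below : ∀ m {f g} → bitsVal m f < bitsVal m g → Below m f g
<⇒Below (suc m) {f} {g} lt with ℕ.<-cmp (bitsVal m (f ∘ suc)) (bitsVal m (g ∘ suc))
... | tri< h _ _ = let p , p<m , ef , eg , k = <⇒Below m h in
  suc p , s≤s p<m , ef , eg , λ { (suc q) (s≤s q<m) (s≤s p<q) → k q q<m p<q }
... | tri> _ _ h = ⊥-elim (ℕ.<-asym lt (parity-< (g 0) (f 0) {bitsVal m (g ∘ suc)} {bitsVal m (f ∘ suc)} h))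
... | tri≈ _ e _ with f 0 in ef | g 0 in eg
...   | false | true  = 0 , s≤s z≤n , ef , eg , λ { (suc q) (s≤s q<m) _ → bitsVal-injective m e q q<m }
...   | true  | true  = ⊥-elim (ℕ.<-irrefl (cong (λ x → 1 + 2 * x) e) lt)
...   | true  | false = ⊥-elim (ℕ.<-irrefl refl (ℕ.<-trans (≤-trans (s≤s (≤-reflexive (cong (2 *_) (sym e)))) ≤-refl) lt))
...   | false | false = ⊥-elim (ℕ.<-irrefl (cong (2 *_) e) lt)

halve : ∀ c → ∃[ b ] ∃[ d ] c ≡ b2n b + 2 * d
halve zero    = false , 0 , refl
halve (suc c) with halve c
... | false , d , e = true , d , cong suc e
... | true  , d , e = false , suc d , trans (cong suc e) (sym (ℕ.*-suc 2 d))

-- As `k` fits into `m` digits, so does every color of the palette, and a block of a play can spell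
-- it.
digits : ∀ m g {c} → c ≤ bitsVal m g → ∃[ f ] bitsVal m f ≡ c
digits zero    g z≤n = g , refl
digits (suc m) g {c} h with halve c
... | b , d , refl with d ℕ.≤? bitsVal m (g ∘ suc)
...   | yes d≤ = let f , e = digits m (g ∘ suc) d≤ in
        (λ { zero → b ; (suc q) → f q }) , cong (λ x → b2n b + 2 * x) e
...   | no d≰  = ⊥-elim (ℕ.<-irrefl refl (ℕ.<-≤-trans (parity-< (g 0) b (ℕ.≰⇒> d≰)) h))

-- The lists that end in `true`, which are the numerals of the positive numbers.
data Canonical : List Bool → Set where
  unit : Canonical (true ∷ [])
  _⟨∷⟩_ : ∀ b {l} → Canonical l → Canonical (b ∷ l)

Canonical-increment : ∀ {l} → Canonical l → Canonical (increment l)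
Canonical-increment unit           = false ⟨∷⟩ unit
Canonical-increment (false ⟨∷⟩ l)  = true ⟨∷⟩ l
Canonical-increment (true ⟨∷⟩ l)   = false ⟨∷⟩ Canonical-increment l

Canonical-binary : ∀ k → Canonical (binary (suc k))
Canonical-binary zero    = unit
Canonical-binary (suc k) = Canonical-increment (Canonical-binary k)

listVal-increment : ∀ l → listVal (increment l) ≡ suc (listVal l)
listVal-increment []          = refl
listVal-increment (false ∷ l) = refl
listVal-increment (true  ∷ l) = trans (cong (2 *_) (listVal-increment l)) (ℕ.*-suc 2 (listVal l))

listVal-binary : ∀ k → listVal (binary k) ≡ k
listVal-binary zero    = refl
listVal-binary (suc k) = trans (listVal-increment (binary k)) (cong suc (listVal-binary k))

Canonical-positive : ∀ {l} → Canonical l → 0 < listVal l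
Canonical-positive unit                = s≤s z≤n
Canonical-positive (true  ⟨∷⟩ l)       = s≤s z≤n
Canonical-positive (false ⟨∷⟩ l)       = ≤-trans (Canonical-positive l) (m≤m+n _ _)

Canonical-injective : ∀ {l l′} → Canonical l → Canonical l′ → listVal l ≡ listVal l′ → l ≡ l′
Canonical-injective unit unit e = refl
Canonical-injective unit (b ⟨∷⟩ l′) e =
  ⊥-elim (ℕ.<-irrefl (proj₂ (parity-injective true b {0} e)) (Canonical-positive l′))
Canonical-injective (b ⟨∷⟩ l) unit e =
  ⊥-elim (ℕ.<-irrefl (sym (proj₂ (parity-injective b true {_} {0} e))) (Canonical-positive l))
Canonical-injective (b ⟨∷⟩ l) (b′ ⟨∷⟩ l′) e =
  let eb , el = parity-injective b b′ e in cong₂ _∷_ eb (Canonical-injective l l′ el)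

binary-listVal : ∀ {l} → Canonical l → binary (listVal l) ≡ l
binary-listVal {l} c with listVal l in e
... | zero  = ⊥-elim (ℕ.<-irrefl (sym e) (Canonical-positive c))
... | suc k = Canonical-injective (Canonical-binary k) c (trans (listVal-binary (suc k)) (sym e))

last⇒Canonical : ∀ l t → length l ≡ suc t → nth l t ≡ true → Canonical l
last⇒Canonical (b ∷ [])    zero    e h = subst (λ b → Canonical (b ∷ [])) (sym h) unit
last⇒Canonical (b ∷ c ∷ l) (suc t) e h = b ⟨∷⟩ last⇒Canonical (c ∷ l) t (ℕ.suc-injective e) h

Canonical⇒last : ∀ {l} → Canonical l → ∃[ t ] length l ≡ suc t × nth l t ≡ true
Canonical⇒last unit      = 0 , refl , refl
Canonical⇒last (b ⟨∷⟩ l) = let t , e , h = Canonical⇒last l in suc t , cong suc e , h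

-- Formulas for inputs and plays

-- The first list holds the bits of a play, then come the input and a
-- unary numeral for the number of vertices. A play of the game is coded
-- by length w rounds of 2 · length w bits: one half marks a vertex, the
-- other half spells a color in binary.
play wd ord : Fin 3
play = zero
wd   = suc zero
ord  = suc (suc zero)

i₀ i₁ i₂ i₃ i₄ i₅ i₆ i₇ i₈ : Fin 9
i₀ = zero
i₁ = suc zero
i₂ = suc (suc zero)
i₃ = suc (suc (suc zero))
i₄ = suc (suc (suc (suc zero)))
i₅ = suc (suc (suc (suc (suc zero))))
i₆ = suc (suc (suc (suc (suc (suc zero)))))
i₇ = suc (suc (suc (suc (suc (suc (suc zero))))))
i₈ = suc (suc (suc (suc (suc (suc (suc (suc zero)))))))

-- Terms can measure only lengths of lists, so the order of the graph is extracted as a list of its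
-- own: one bit for each position up to which the input is `true` throughout.
orderG : Gen 3 9
orderG = for i₀ wd (when (every i₁ wd (var i₁ ≺ var i₀ ⊕ one ⟹ bitAt wd (var i₁))) (emit trueF))

adjF : Term 3 9 → Term 3 9 → Formula 3 9
adjF a b = bitAt wd (len ord ⊕ one ⊕ a ⊗ len ord ⊕ b)

kbitF : Term 3 9 → Formula 3 9
kbitF q = bitAt wd (len ord ⊕ one ⊕ len ord ⊗ len ord ⊕ q)

-- The last three conjuncts concern the numeral of `k`. The final bit is `true`, which excludes
-- leading zeros; there are at least two digits; and there are at least three or the lowest is 1,
-- which rules out `k` equal to 2.
validF : Formula 3 9
validF =
  (len ord ⊕ len ord ⊗ len ord ≺ len wd) &
  every i₀ ord (every i₁ ord (adjF (var i₀) (var i₁) ⟹ adjF (var i₁) (var i₀))) &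
  every i₀ ord (neg (adjF (var i₀) (var i₀))) &
  some i₀ wd ((len wd ≺ var i₀ ⊕ one ⊕ one) & bitAt wd (var i₀)) &
  (len ord ⊕ len ord ⊗ len ord ⊕ one ⊕ one ≺ len wd) &
  ((len ord ⊕ len ord ⊗ len ord ⊕ one ⊕ one ⊕ one ≺ len wd) ∥ bitAt wd (len ord ⊕ len ord ⊗ len ord ⊕ one))

marksF colorF : Term 3 9 → Term 3 9 → Formula 3 9
marksF t u = bitAt play (t ⊗ (len wd ⊕ len wd) ⊕ u)
colorF t q = bitAt play (t ⊗ (len wd ⊕ len wd) ⊕ len wd ⊕ q)

-- A block chooses a vertex only if it marks no other, so malformed blocks choose nothing. In
-- `legalF t b`, block `b` is judged in the position after the first `t` rounds; the two differ when
-- Alice answers a claim. The bound is tested for the new color alone, as the other classes do not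
-- change.
choosesF coloredF sameF legalF : Term 3 9 → Term 3 9 → Formula 3 9
choosesF t v = marksF t v & every i₆ ord (marksF t (var i₆) ⟹ var i₆ ≈ v)
coloredF t v = some i₅ wd ((var i₅ ≺ t) & choosesF (var i₅) v)
sameF t b    = every i₇ wd (colorF t (var i₇) ⟷ colorF b (var i₇))

paletteF : Term 3 9 → Formula 3 9
paletteF b = some i₇ wd (neg (colorF b (var i₇)) & kbitF (var i₇) &
  every i₈ wd (var i₇ ≺ var i₈ ⟹ (colorF b (var i₈) ⟷ kbitF (var i₈))))

legalF t b = some i₂ ord (choosesF b (var i₂) & neg (coloredF t (var i₂)) & paletteF b &
  every i₃ ord (neg (fewer i₄ ord (adjF (var i₃) (var i₄)) (adjF (var i₃) (var i₄) &
    (var i₄ ≈ var i₂ ∥ some i₅ wd ((var i₅ ≺ t) & choosesF (var i₅) (var i₄) & sameF (var i₅) b))))))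

evenF : Formula 3 9
evenF = some i₁ wd (var i₀ ≈ var i₁ ⊕ var i₁)

-- An illegal move of Bob is a claim that the chosen vertex is stuck. It is
-- refuted if the vertex has a color already or if the next move of Alice
-- gives it one.
opaque
  leafF : Formula 3 9
  leafF = validF & some i₀ wd
    (every i₁ wd (var i₁ ≺ var i₀ ⟹ legalF (var i₁) (var i₁)) &
      (every i₂ ord (coloredF (var i₀) (var i₂)) ∥
        (neg evenF & neg (legalF (var i₀) (var i₀)) &
          (every i₂ ord (choosesF (var i₀) (var i₂) ⟹ coloredF (var i₀) (var i₂)) ∥
            (legalF (var i₀) (var i₀ ⊕ one) &
              every i₂ ord (choosesF (var i₀) (var i₂) ⟹ choosesF (var i₀ ⊕ one) (var i₂)))))))

-- Emitting twice in the inner loop yields the two halves of a block. Even rounds belong to Alice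
-- and are existential.
prefixG : Gen 3 9
prefixG = for i₀ wd (for i₂ wd (emit evenF ▸ emit evenF))

⟺-resp : ∀ {a b P} → a ≡ b → b ⟺ P → a ⟺ P
⟺-resp refl h = h

module Meaning (w o : List Bool) where

  m n : ℕ
  m = length w
  n = length o

  Adj : ℕ → ℕ → Set
  Adj a b = nth w (n + 1 + a * n + b) ≡ true

  kb : ℕ → Bool
  kb q = nth w (n + 1 + n * n + q)

  Valid : Set
  Valid = n + n * n < m ×
    (∀ a → a < n → ∀ b → b < n → Adj a b → Adj b a) ×
    (∀ a → a < n → ¬ Adj a a) ×
    (∃[ a ] a < m × m < a + 1 + 1 × nth w a ≡ true) ×
    n + n * n + 1 + 1 < m ×
    (n + n * n + 1 + 1 + 1 < m ⊎ nth w (n + n * n + 1) ≡ true)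

  Even : ℕ → Set
  Even i = ∃[ h ] h < m × i ≡ h + h

  module _ (p : List Bool) where

    ρ : Vec (List Bool) 3
    ρ = p ∷ w ∷ o ∷ []

    Marks : ℕ → ℕ → Set
    Marks j u = nth p (j * (m + m) + u) ≡ true

    color : ℕ → ℕ → Bool
    color j q = nth p (j * (m + m) + m + q)

    Chooses : ℕ → ℕ → Set
    Chooses j v = Marks j v × (∀ u → u < n → Marks j u → u ≡ v)

    Colored : ℕ → ℕ → Set
    Colored i v = ∃[ j ] j < m × j < i × Chooses j v

    Same : ℕ → ℕ → Set
    Same j b = ∀ q → q < m → color j q ≡ color b q

    Recolored : ℕ → ℕ → ℕ → ℕ → ℕ → Set
    Recolored i b v u x = Adj u x × (x ≡ v ⊎ ∃[ j ] j < m × j < i × Chooses j x × Same j b)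

    Legal : ℕ → ℕ → Set
    Legal i b = ∃[ v ] v < n × Chooses b v × ¬ Colored i v × Below m (color b) kb ×
      (∀ u → u < n → AtMostHalf n (Recolored i b v u) (Adj u))

    Refuted : ℕ → Set
    Refuted i = (∀ v → v < n → Chooses i v → Colored i v) ⊎
                (Legal i (i + 1) × ∀ v → v < n → Chooses i v → Chooses (i + 1) v)

    -- A leaf is judged at one round `i`, where the graph is complete or Bob makes a refuted illegal
    -- move. Apart from Alice's answer in round `i + 1`, the later bits are irrelevant.
    Won : Set
    Won = ∃[ i ] i < m × (∀ j → j < m → j < i → Legal j j) ×
      ((∀ v → v < n → Colored i v) ⊎ (¬ Even i × ¬ Legal i i × Refuted i))

    valid-⟺ : ∀ {ι₂ ι₃ ι₄ ι₅ ι₆ ι₇ ι₈} →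
              holds ρ validF (0 ∷ 0 ∷ ι₂ ∷ ι₃ ∷ ι₄ ∷ ι₅ ∷ ι₆ ∷ ι₇ ∷ ι₈ ∷ []) ⟺ Valid
    valid-⟺ = ⟺-∧ ⟺-< (⟺-∧ (⟺-∀ λ a _ → ⟺-∀ λ b _ → ⟺-⇒ ⟺-id ⟺-id) (⟺-∧ (⟺-∀ λ a _ → ⟺-not ⟺-id)
      (⟺-∧ (⟺-∃ λ a _ → ⟺-∧ ⟺-< ⟺-id) (⟺-∧ ⟺-< (⟺-∨ ⟺-< ⟺-id)))))

    module _ (i j : ℕ) where

      even-⟺ : ∀ {ι₂ ι₃ ι₄ ι₅ ι₆ ι₇ ι₈} →
               holds ρ evenF (i ∷ 0 ∷ ι₂ ∷ ι₃ ∷ ι₄ ∷ ι₅ ∷ ι₆ ∷ ι₇ ∷ ι₈ ∷ []) ⟺ Even i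
      even-⟺ = ⟺-∃ λ h _ → ⟺-=

      module _ (v u x : ℕ) where

        -- The hypotheses on `t` and `tv` say that their values ignore the variable bound in the
        -- formula, so nothing is captured. Variables bound further inside are 0 here, as the
        -- semantics of binders requires.
        chooses-⟺ : ∀ y {a s} t tv →
          (∀ z → val ρ t (i ∷ j ∷ v ∷ u ∷ x ∷ y ∷ z ∷ 0 ∷ 0 ∷ []) ≡ a) →
          (∀ z → val ρ tv (i ∷ j ∷ v ∷ u ∷ x ∷ y ∷ z ∷ 0 ∷ 0 ∷ []) ≡ s) →
          holds ρ (choosesF t tv) (i ∷ j ∷ v ∷ u ∷ x ∷ y ∷ 0 ∷ 0 ∷ 0 ∷ []) ⟺ Chooses a s
        chooses-⟺ y t tv et ev = ⟺-∧
          (⟺-resp (cong₂ (λ a s → nth p (a * (m + m) + s)) (et 0) (ev 0)) ⟺-id)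
          (⟺-∀ λ z _ → ⟺-⇒ (⟺-resp (cong (λ a → nth p (a * (m + m) + z)) (et z)) ⟺-id)
            (⟺-resp (cong (λ s → not (z <ᵇ s) ∧ not (s <ᵇ z)) (ev z)) ⟺-=))

        colored-⟺ : ∀ {a s} t tv →
          (∀ y z → val ρ t (i ∷ j ∷ v ∷ u ∷ x ∷ y ∷ z ∷ 0 ∷ 0 ∷ []) ≡ a) →
          (∀ y z → val ρ tv (i ∷ j ∷ v ∷ u ∷ x ∷ y ∷ z ∷ 0 ∷ 0 ∷ []) ≡ s) →
          holds ρ (coloredF t tv) (i ∷ j ∷ v ∷ u ∷ x ∷ 0 ∷ 0 ∷ 0 ∷ 0 ∷ []) ⟺ Colored a s
        colored-⟺ t tv et ev = ⟺-∃ λ y _ → ⟺-∧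
          (⟺-resp (cong (y <ᵇ_) (et y 0)) ⟺-<) (chooses-⟺ y (var i₅) tv (λ _ → refl) (ev y))

        same-⟺ : ∀ y {b} s → (∀ z → val ρ s (i ∷ j ∷ v ∷ u ∷ x ∷ y ∷ 0 ∷ z ∷ 0 ∷ []) ≡ b) →
          holds ρ (sameF (var i₅) s) (i ∷ j ∷ v ∷ u ∷ x ∷ y ∷ 0 ∷ 0 ∷ 0 ∷ []) ⟺ Same y b
        same-⟺ y s es = ⟺-∀ λ q _ → ⟺-map
          (λ e → trans e (cong (λ b → color b q) (es q))) (λ e → trans e (sym (cong (λ b → color b q) (es q)))) ⟺-≡

        palette-⟺ : ∀ y {b} s → (∀ z z′ → val ρ s (i ∷ j ∷ v ∷ u ∷ x ∷ y ∷ 0 ∷ z ∷ z′ ∷ []) ≡ b) →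
          holds ρ (paletteF s) (i ∷ j ∷ v ∷ u ∷ x ∷ y ∷ 0 ∷ 0 ∷ 0 ∷ []) ⟺ Below m (color b) kb
        palette-⟺ y s es = ⟺-∃ λ q _ → ⟺-∧
          (⟺-map (λ ne → trans (sym (cong (λ b → color b q) (es q 0))) (¬-not ne))
                 (λ e e′ → contradiction (trans (sym e) (trans (sym (cong (λ b → color b q) (es q 0))) e′)) λ ()) (⟺-not ⟺-id))
          (⟺-∧ ⟺-id (⟺-∀ λ q′ _ → ⟺-⇒ ⟺-< (⟺-map
            (λ e → trans (sym (cong (λ b → color b q′) (es q q′))) e)
            (λ e → trans (cong (λ b → color b q′) (es q q′)) e) ⟺-≡)))

      legal-⟺ : ∀ {a b} t s →
        (∀ v u x y z c d → val ρ t (i ∷ j ∷ v ∷ u ∷ x ∷ y ∷ z ∷ c ∷ d ∷ []) ≡ a) →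
        (∀ v u x y z c d → val ρ s (i ∷ j ∷ v ∷ u ∷ x ∷ y ∷ z ∷ c ∷ d ∷ []) ≡ b) →
        holds ρ (legalF t s) (i ∷ j ∷ 0 ∷ 0 ∷ 0 ∷ 0 ∷ 0 ∷ 0 ∷ 0 ∷ []) ⟺ Legal a b
      legal-⟺ t s et es = ⟺-∃ λ v _ → ⟺-∧
        (chooses-⟺ v 0 0 0 s (var i₂) (λ z → es v 0 0 0 z 0 0) (λ _ → refl))
        (⟺-∧ (⟺-not (colored-⟺ v 0 0 t (var i₂) (λ y z → et v 0 0 y z 0 0) (λ _ _ → refl)))
        (⟺-∧ (palette-⟺ v 0 0 0 s (λ c d → es v 0 0 0 0 c d))
        (⟺-∀ λ u _ → ⟺-half
          (λ x _ → ⟺-∧ ⟺-id (⟺-∨ ⟺-= (⟺-∃ λ y _ → ⟺-∧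
            (⟺-resp (cong (y <ᵇ_) (et v u x y 0 0 0)) ⟺-<)
            (⟺-∧ (chooses-⟺ v u x y (var i₅) (var i₄) (λ _ → refl) (λ _ → refl))
                 (same-⟺ v u x y s (λ z → es v u x y 0 z 0))))))
          (λ x _ → ⟺-id))))

    opaque
      unfolding leafF

      won-⟺ : holds ρ leafF (Vec.replicate 9 0) ⟺ Valid × Won
      won-⟺ = ⟺-∧ (valid-⟺ {0} {0} {0} {0} {0} {0} {0}) (⟺-∃ λ i _ → ⟺-∧
        (⟺-∀ λ j _ → ⟺-⇒ ⟺-< (legal-⟺ i j (var i₁) (var i₁) (λ _ _ _ _ _ _ _ → refl) (λ _ _ _ _ _ _ _ → refl)))
        (⟺-∨ (⟺-∀ λ v _ → colored-⟺ i 0 v 0 0 (var i₀) (var i₂) (λ _ _ → refl) (λ _ _ → refl))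
        (⟺-∧ (⟺-not (even-⟺ i 0 {0} {0} {0} {0} {0} {0} {0}))
        (⟺-∧ (⟺-not (legal-⟺ i 0 (var i₀) (var i₀) (λ _ _ _ _ _ _ _ → refl) (λ _ _ _ _ _ _ _ → refl)))
        (⟺-∨ (⟺-∀ λ v _ → ⟺-⇒ (chooses-⟺ i 0 v 0 0 0 (var i₀) (var i₂) (λ _ → refl) (λ _ → refl))
                                (colored-⟺ i 0 v 0 0 (var i₀) (var i₂) (λ _ _ → refl) (λ _ _ → refl)))
             (⟺-∧ (legal-⟺ i 0 (var i₀) (var i₀ ⊕ one) (λ _ _ _ _ _ _ _ → refl) (λ _ _ _ _ _ _ _ → refl))
                   (⟺-∀ λ v _ → ⟺-⇒ (chooses-⟺ i 0 v 0 0 0 (var i₀) (var i₂) (λ _ → refl) (λ _ → refl))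
                                      (chooses-⟺ i 0 v 0 0 0 (var i₀ ⊕ one) (var i₂) (λ _ → refl) (λ _ → refl)))))))))

concat-ones : ∀ t {b : ℕ → Bool} c → (∀ k → k < t → b k ⟺ k < c) →
              concatBelow t (λ k → if b k then true ∷ [] else []) ≡ ones (t ⊓ c)
concat-ones zero    c h = refl
concat-ones (suc t) {b} c h
  rewrite concat-ones t c (λ k k<t → h k (ℕ.m<n⇒m<1+n k<t)) with b t in e
... | true  = trans (cong (λ z → ones z ++ true ∷ []) (ℕ.m≤n⇒m⊓n≡m (ℕ.<⇒≤ t<c)))
  (trans (ones-snoc t []) (trans (cong (true ∷_) (List.++-identityʳ (ones t))) (cong ones (sym (ℕ.m≤n⇒m⊓n≡m t<c)))))
  where
  t<c : t < c
  t<c = proj₁ (h t ≤-refl) e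
... | false = trans (List.++-identityʳ _) (cong ones (trans (ℕ.m≥n⇒m⊓n≡n c≤t) (sym (ℕ.m≥n⇒m⊓n≡n (ℕ.m≤n⇒m≤1+n c≤t)))))
  where
  c≤t : c ≤ t
  c≤t = ℕ.≮⇒≥ (⟺-false (h t ≤-refl) e)

list-order : ∀ w o → list ([] ∷ w ∷ o ∷ []) orderG (Vec.replicate 9 0) ≡ ones (leading w)
list-order w o = trans
  (concat-ones (length w) (leading w) λ k k<m → ⟺-map (to k k<m) (from k)
    (⟺-∀ λ j _ → ⟺-⇒ (⟺-< {j} {k + 1}) (⟺-id {nth w j})))
  (cong ones (ℕ.m≥n⇒m⊓n≡n (leading-≤ w)))
  where
  to : ∀ k → k < length w → (∀ j → j < length w → j < k + 1 → nth w j ≡ true) → k < leading w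
  to k k<m h = ℕ.≰⇒> λ le → contradiction
    (trans (sym (h (leading w) (ℕ.≤-<-trans le k<m) (≤-trans (s≤s le) (≤-reflexive (ℕ.+-comm 1 k))))) (leading-false w)) λ ()
  from : ∀ k → k < leading w → ∀ j → j < length w → j < k + 1 → nth w j ≡ true
  from k k<l j _ j<k+1 = leading-true w j (ℕ.≤-<-trans (ℕ.≤-pred (≤-trans j<k+1 (≤-reflexive (ℕ.+-comm k 1)))) k<l)

-- Valid words and encodings

nth-encoded : ∀ n tail t → nth (ones n ++ false ∷ tail) (n + 1 + t) ≡ nth tail t
nth-encoded zero    tail t = refl
nth-encoded (suc n) tail t = nth-encoded n tail t

length-encoded : ∀ n tail → length (ones n ++ false ∷ tail) ≡ n + suc (length tail)
length-encoded n tail = trans (List.length-++ (ones n)) (cong (_+ suc (length tail)) (List.length-replicate n))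

Canonical-3≤ : ∀ {l} → Canonical l → 2 ≤ length l → 3 ≤ length l ⊎ nth l 0 ≡ true → 3 ≤ listVal l
Canonical-3≤ unit (s≤s ()) h
Canonical-3≤ (true ⟨∷⟩ l) _ h = s≤s (ℕ.*-monoʳ-≤ 2 (Canonical-positive l))
Canonical-3≤ (false ⟨∷⟩ unit) _ (inj₁ (s≤s (s≤s ())))
Canonical-3≤ (false ⟨∷⟩ (b ⟨∷⟩ l)) _ h = ≤-trans (s≤s (s≤s (s≤s z≤n)))
  (ℕ.*-monoʳ-≤ 2 (≤-trans (ℕ.*-monoʳ-≤ 2 (Canonical-positive l)) (m≤n+m _ (b2n b))))

3≤-Canonical : ∀ {l} → Canonical l → 3 ≤ listVal l → 2 ≤ length l × (3 ≤ length l ⊎ nth l 0 ≡ true)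
3≤-Canonical unit (s≤s ())
3≤-Canonical (true  ⟨∷⟩ unit)              h = s≤s (s≤s z≤n) , inj₂ refl
3≤-Canonical (false ⟨∷⟩ unit)              (s≤s (s≤s ()))
3≤-Canonical (_ ⟨∷⟩ (_ ⟨∷⟩ unit))          h = s≤s (s≤s z≤n) , inj₁ (s≤s (s≤s (s≤s z≤n)))
3≤-Canonical (_ ⟨∷⟩ (_ ⟨∷⟩ (_ ⟨∷⟩ _)))     h = s≤s (s≤s z≤n) , inj₁ (s≤s (s≤s (s≤s z≤n)))

Canonical-binary-3≤ : ∀ {k} → 3 ≤ k → Canonical (binary k)
Canonical-binary-3≤ {suc k} _ = Canonical-binary k

module Decode (w o : List Bool) (order : length o ≡ leading w) where
  open Meaning w o

  valid⇒encoded : Valid → ∃[ n ] ∃[ G ] ∃[ k ] 3 ≤ k × w ≡ encode {n} G k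
  valid⇒encoded (v₁ , v₂ , v₃ , (a , a<m , m<a , ea) , v₅ , v₆) = n , G , listVal ks , 3≤k , sym encoded
    where
    found : ∃[ v ] w ≡ ones (leading w) ++ false ∷ v
    found = leading-split w (subst (_< m) order (ℕ.≤-<-trans (m≤m+n n (n * n)) v₁))
    tail ks : List Bool
    tail = proj₁ found
    w≡ : w ≡ ones n ++ false ∷ tail
    w≡ = trans (proj₂ found) (cong (λ z → ones z ++ false ∷ tail) (sym order))
    ks = List.drop (n * n) tail
    at-tail : ∀ t → nth w (n + 1 + t) ≡ nth tail t
    at-tail t = trans (cong (λ z → nth z (n + 1 + t)) w≡) (nth-encoded n tail t)
    at-adj : ∀ a b → nth w (n + 1 + a * n + b) ≡ nth tail (a * n + b)
    at-adj a b = trans (cong (nth w) (ℕ.+-assoc (n + 1) (a * n) b)) (at-tail (a * n + b))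
    m≡ : m ≡ n + suc (length tail)
    m≡ = trans (cong length w≡) (length-encoded n tail)
    room : n * n + 2 ≤ length tail
    room = ℕ.≤-pred (ℕ.+-cancelˡ-≤ n _ _ (≤-trans (≤-reflexive (arith n (n * n))) (≤-trans v₅ (≤-reflexive m≡))))
      where
      arith : ∀ x y → x + suc (y + 2) ≡ suc (x + y + 1 + 1)
      arith = solve-∀
    tail≡ : length tail ≡ n * n + length ks
    tail≡ = trans (sym (ℕ.m+[n∸m]≡n (≤-trans (m≤m+n _ 2) room))) (cong (n * n +_) (sym (List.length-drop (n * n) tail)))
    ks≥2 : 2 ≤ length ks
    ks≥2 = ℕ.+-cancelˡ-≤ (n * n) _ _ (≤-trans room (≤-reflexive tail≡))
    G : Graph n
    G .Graph.neighborhoods = tabulate (λ i → tabulate (λ j → nth tail (toℕ i * n + toℕ j)))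
    G .Graph.symmetric {u} {v} h = Vec.lookup⇒[]= v _ (trans (entry-at u v) (trans (sym (at-adj (toℕ u) (toℕ v)))
      (v₂ (toℕ v) (Fin.toℕ<n v) (toℕ u) (Fin.toℕ<n u) (trans (at-adj (toℕ v) (toℕ u)) (trans (sym (entry-at v u)) (Vec.[]=⇒lookup h))))))
      where
      entry-at : ∀ i j → lookup (lookup (tabulate (λ i → tabulate (λ j → nth tail (toℕ i * n + toℕ j)))) i) j ≡ nth tail (toℕ i * n + toℕ j)
      entry-at i j = trans (cong (λ r → lookup r j) (Vec.lookup∘tabulate _ i)) (Vec.lookup∘tabulate _ j)
    G .Graph.irreflexive {v} h = v₃ (toℕ v) (Fin.toℕ<n v) (trans (at-adj (toℕ v) (toℕ v))
      (trans (sym (trans (cong (λ r → lookup r v) (Vec.lookup∘tabulate (λ i → tabulate (λ j → nth tail (toℕ i * n + toℕ j))) v))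
                         (Vec.lookup∘tabulate _ v))) (Vec.[]=⇒lookup h)))
    t : ℕ
    t = pred (length ks)
    ks≡ : length ks ≡ suc t
    ks≡ = sym (ℕ.suc-pred (length ks) {{>-nonZero (≤-trans (s≤s z≤n) ks≥2)}})
    -- The bounds on `a` make it the last position of the word, hence the leading digit of the
    -- numeral.
    a≡ : a ≡ n + 1 + (n * n + t)
    a≡ = ℕ.suc-injective (trans (ℕ.≤-antisym a<m (ℕ.≤-pred (≤-trans m<a (≤-reflexive (two a)))))
      (trans m≡ (trans (cong (λ z → n + suc z) (trans tail≡ (cong (n * n +_) ks≡))) (arith n (n * n) t))))
      where
      two : ∀ a → a + 1 + 1 ≡ suc (suc a)
      two = solve-∀
      arith : ∀ x y t → x + suc (y + suc t) ≡ suc (x + 1 + (y + t))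
      arith = solve-∀
    canonical : Canonical ks
    canonical = last⇒Canonical ks t ks≡ (trans (sym (trans (cong (nth w) a≡) (trans (at-tail (n * n + t)) (nth-drop (n * n) t tail)))) ea)
    3≤k : 3 ≤ listVal ks
    3≤k = Canonical-3≤ canonical ks≥2 (Sum.map
      (λ h → ℕ.+-cancelˡ-≤ (n * n) _ _ (ℕ.≤-pred (ℕ.+-cancelˡ-≤ n _ _
        (≤-trans (≤-reflexive (arith n (n * n))) (≤-trans h (≤-reflexive (trans m≡ (cong (λ z → n + suc z) tail≡))))))))
      (λ h → trans (sym (trans (trans (cong (nth w) (arith′ n (n * n))) (at-tail (n * n + 0))) (nth-drop (n * n) 0 tail))) h) v₆)
      where
      arith : ∀ x y → x + suc (y + 3) ≡ suc (x + y + 1 + 1 + 1)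
      arith = solve-∀
      arith′ : ∀ x y → x + y + 1 ≡ x + 1 + (y + 0)
      arith′ = solve-∀
    encoded : encode G (listVal ks) ≡ w
    encoded = trans (cong (λ z → ones n ++ false ∷ z) (trans
      (cong₂ _++_ (toList-matrix n n tail (≤-trans (m≤m+n _ 2) room)) (binary-listVal canonical))
      (List.take++drop≡id (n * n) tail))) (sym w≡)

module Encoded {N : ℕ} (G : Graph N) (k : ℕ) (3≤k : 3 ≤ k) where
  open Graph G using (neighborhoods; symmetric; irreflexive)

  code tail : List Bool
  code = encode G k
  tail = toList (Vec.concat neighborhoods) ++ binary k

  nth-adjacent : ∀ i j → nth code (N + 1 + toℕ i * N + toℕ j) ≡ lookup (lookup neighborhoods i) j
  nth-adjacent i j = trans (cong (nth code) (ℕ.+-assoc (N + 1) (toℕ i * N) (toℕ j)))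
    (trans (nth-encoded N tail (toℕ i * N + toℕ j)) (nth-matrix neighborhoods i j (binary k)))

  nth-colors : ∀ q → nth code (N + 1 + N * N + q) ≡ nth (binary k) q
  nth-colors q = trans (cong (nth code) (ℕ.+-assoc (N + 1) (N * N) q))
    (trans (nth-encoded N tail (N * N + q))
      (trans (cong (λ z → nth tail (z + q)) (sym (length-toList (Vec.concat neighborhoods))))
        (nth-++ (toList (Vec.concat neighborhoods)) (binary k) q)))

  length-code : length code ≡ N + suc (N * N + length (binary k))
  length-code = trans (length-encoded N tail) (cong (λ z → N + suc z)
    (trans (List.length-++ (toList (Vec.concat neighborhoods))) (cong (_+ length (binary k)) (length-toList (Vec.concat neighborhoods)))))

  valid-code : ∀ o → length o ≡ N → Meaning.Valid code o
  valid-code o refl = v₁ , v₂ , v₃ , (N + 1 + N * N + t , a<m , m<a , trans (nth-colors t) last) , v₅ ,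
    Sum.map (λ h → ≤-trans (≤-reflexive (trans (cong suc (arith₆ N (N * N))) (sym (ℕ.+-suc N _))))
                    (≤-trans (ℕ.+-monoʳ-≤ N (s≤s (ℕ.+-monoʳ-≤ (N * N) h))) (≤-reflexive (sym length-code))))
            (λ h → trans (cong (nth code) (arith₇ N (N * N))) (trans (nth-colors 0) h)) big
    where
    canonical = Canonical-binary-3≤ 3≤k
    t = proj₁ (Canonical⇒last canonical)
    lenᵏ : length (binary k) ≡ suc t
    lenᵏ = proj₁ (proj₂ (Canonical⇒last canonical))
    last : nth (binary k) t ≡ true
    last = proj₂ (proj₂ (Canonical⇒last canonical))
    sizes = 3≤-Canonical canonical (≤-trans 3≤k (≤-reflexive (sym (listVal-binary k))))
    two : 2 ≤ length (binary k)
    two = proj₁ sizes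
    big : 3 ≤ length (binary k) ⊎ nth (binary k) 0 ≡ true
    big = proj₂ sizes
    length≡ : length code ≡ suc (N + 1 + N * N + t)
    length≡ = trans length-code (trans (cong (λ z → N + suc (N * N + z)) lenᵏ) (arith N (N * N) t))
      where
      arith : ∀ x y t → x + suc (y + suc t) ≡ suc (x + 1 + y + t)
      arith = solve-∀
    arith₅ : ∀ x y → x + y + 1 + 1 ≡ x + suc (y + 1)
    arith₅ = solve-∀
    arith₆ : ∀ x y → x + y + 1 + 1 + 1 ≡ x + (y + 3)
    arith₆ = solve-∀
    arith₇ : ∀ x y → x + y + 1 ≡ x + 1 + y + 0
    arith₇ = solve-∀
    v₅ : N + N * N + 1 + 1 < length code
    v₅ = ≤-trans (≤-reflexive (trans (cong suc (arith₅ N (N * N))) (sym (ℕ.+-suc N _))))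
      (≤-trans (ℕ.+-monoʳ-≤ N (s≤s (≤-trans (≤-reflexive (sym (ℕ.+-suc (N * N) 1))) (ℕ.+-monoʳ-≤ (N * N) two))))
        (≤-reflexive (sym length-code)))
    v₁ : N + N * N < length code
    v₁ = ≤-trans (s≤s (≤-trans (m≤m+n _ 1) (m≤m+n _ 1))) v₅
    a<m : N + 1 + N * N + t < length code
    a<m = ≤-reflexive (sym length≡)
    m<a : length code < N + 1 + N * N + t + 1 + 1
    m<a = ≤-reflexive (trans (cong suc length≡) (arith (N + 1 + N * N + t)))
      where
      arith : ∀ a → suc (suc a) ≡ a + 1 + 1
      arith = solve-∀
    entry-at : ∀ a b (a<N : a < N) (b<N : b < N) →
               nth code (N + 1 + a * N + b) ≡ lookup (lookup neighborhoods (fromℕ< a<N)) (fromℕ< b<N)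
    entry-at a b a<N b<N = trans
      (cong₂ (λ a b → nth code (N + 1 + a * N + b)) (sym (Fin.toℕ-fromℕ< a<N)) (sym (Fin.toℕ-fromℕ< b<N)))
      (nth-adjacent (fromℕ< a<N) (fromℕ< b<N))
    v₂ : ∀ a → a < N → ∀ b → b < N → nth code (N + 1 + a * N + b) ≡ true → nth code (N + 1 + b * N + a) ≡ true
    v₂ a a<N b b<N h = trans (entry-at b a b<N a<N) (Vec.[]=⇒lookup
      (symmetric (Vec.lookup⇒[]= (fromℕ< b<N) _ (trans (sym (entry-at a b a<N b<N)) h))))
    v₃ : ∀ a → a < N → ¬ (nth code (N + 1 + a * N + a) ≡ true)
    v₃ a a<N h = irreflexive (Vec.lookup⇒[]= (fromℕ< a<N) _ (trans (sym (entry-at a a a<N a<N)) h))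

-- The value of the strong majority coloring game as a quantified formula

count-shift : ∀ n f → count (suc n) f ≡ b2n (f 0) + count n (f ∘ suc)
count-shift zero    f = refl
count-shift (suc n) f = trans (cong (b2n (f (suc n)) +_) (count-shift n f))
  (arith (b2n (f (suc n))) (b2n (f 0)) (count n (f ∘ suc)))
  where
  arith : ∀ a b c → a + (b + c) ≡ b + (a + c)
  arith = solve-∀

count-subset : ∀ {n} (s : Subset n) → count n (nth (toList s)) ≡ ∣ s ∣
count-subset {zero}  []      = refl
count-subset {suc n} (b ∷ s) = trans (count-shift n (nth (toList (b ∷ s))))
  (trans (cong (b2n b +_) (count-subset s)) (sym (∣∷∣ b s)))

nth-subset : ∀ {n} (s : Subset n) x → nth (toList s) (toℕ x) ≡ lookup s x
nth-subset s x = trans (cong (λ l → nth l (toℕ x)) (sym (List.++-identityʳ (toList s)))) (nth-toList s x [])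

bitsList : ℕ → (ℕ → Bool) → List Bool
bitsList m f = toList (tabulate {n = m} (f ∘ toℕ))

length-bitsList : ∀ m f → length (bitsList m f) ≡ m
length-bitsList m f = length-toList (tabulate {n = m} (f ∘ toℕ))

nth-bitsList : ∀ m f ys q → q < m → nth (bitsList m f ++ ys) q ≡ f q
nth-bitsList m f ys q q<m = trans (cong (nth (bitsList m f ++ ys)) (sym (Fin.toℕ-fromℕ< q<m)))
  (trans (nth-toList (tabulate {n = m} (f ∘ toℕ)) (fromℕ< q<m) ys)
    (trans (Vec.lookup∘tabulate (f ∘ toℕ) (fromℕ< q<m)) (cong f (Fin.toℕ-fromℕ< q<m))))

⟺-dec : ∀ {b P} → b ⟺ P → Dec P
⟺-dec {true}  h = yes (proj₁ h refl)
⟺-dec {false} h = no (⟺-false h refl)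

parity : ℕ → Bool
parity zero    = true
parity (suc i) = not (parity i)

parity-+ : ∀ h → parity (h + h) ≡ true
parity-+ zero    = refl
parity-+ (suc h) = trans (cong (not ∘ parity) (ℕ.+-suc h h)) (trans (not-not (parity (h + h))) (parity-+ h))
  where
  not-not : ∀ b → not (not b) ≡ b
  not-not true  = refl
  not-not false = refl

parity-half : ∀ i → parity i ≡ true → ∃[ h ] h ≤ i × i ≡ h + h
parity-half zero          e = 0 , z≤n , refl
parity-half (suc (suc i)) e = let h , le , eq = parity-half i (trans (sym (not-not (parity i))) e) in
  suc h , s≤s (ℕ.m≤n⇒m≤1+n le) , cong suc (trans (cong suc eq) (sym (ℕ.+-suc h h)))
  where
  not-not : ∀ b → not (not b) ≡ b
  not-not true  = refl
  not-not false = refl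

replicate-++ : ∀ {A : Set} a c (x : A) → List.replicate a x ++ List.replicate c x ≡ List.replicate (a + c) x
replicate-++ zero    c x = refl
replicate-++ (suc a) c x = cong (x ∷_) (replicate-++ a c x)

concatBelow-cong : ∀ t {g g′} → (∀ i → i < t → g i ≡ g′ i) → concatBelow t g ≡ concatBelow t g′
concatBelow-cong zero    h = refl
concatBelow-cong (suc t) h = cong₂ _++_ (concatBelow-cong t (λ i i<t → h i (ℕ.m<n⇒m<1+n i<t))) (h t ≤-refl)

concatBelow-twice : ∀ t b → concatBelow t (λ _ → b ∷ b ∷ []) ≡ List.replicate (t + t) b
concatBelow-twice zero    b = refl
concatBelow-twice (suc t) b = trans (cong (_++ b ∷ b ∷ []) (concatBelow-twice t b))
  (trans (replicate-++ (t + t) 2 b) (cong (λ z → List.replicate z b) (arith t)))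
  where
  arith : ∀ t → t + t + 2 ≡ suc t + suc t
  arith = solve-∀

∨-elim : ∀ {a b} → (a ∨ b) ≡ true → a ≡ true ⊎ b ≡ true
∨-elim {true}  e = inj₁ refl
∨-elim {false} e = inj₂ e

∨-intro : ∀ {a b} → a ≡ true ⊎ b ≡ true → (a ∨ b) ≡ true
∨-intro {true}  _        = refl
∨-intro {false} (inj₂ e) = e

∧-elim : ∀ {a b} → (a ∧ b) ≡ true → a ≡ true × b ≡ true
∧-elim {true} e = refl , e

∧-intro : ∀ {a b} → a ≡ true → b ≡ true → (a ∧ b) ≡ true
∧-intro refl e = e

module GameValue (o : List Bool) (G : Graph (length o)) (k : ℕ) (3≤k : 3 ≤ k) where
  open Graph G
  open Encoded G k 3≤k
  open Meaning code o hiding (ρ)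
  open Programs 2 9 using (reverse-twice)
  open Programs.Quantified 2 9 leafF using (qeval)

  Col : Set
  Col = Coloring n k

  LegalSM : Col → Fin n → Fin k → Set
  LegalSM = LegalStrongMajority G

  kb-value : bitsVal m kb ≡ k
  kb-value = trans (bitsVal-cong m (λ q _ → nth-colors q)) (trans (bitsVal-list m (binary k) short) (listVal-binary k))
    where
    short : length (binary k) ≤ m
    short = ≤-trans (m≤n+m _ (n * n)) (≤-trans (ℕ.n≤1+n _) (≤-trans (m≤n+m _ n) (≤-reflexive (sym length-code))))

  valid : Valid
  valid = valid-code o refl

  n<m : n < m
  n<m = ℕ.≤-<-trans (m≤m+n n (n * n)) (proj₁ valid)

  value : List Bool → ℕ → ℕ
  value p j = bitsVal m (color p j)

  Chooses-unique : ∀ p j {a b} → a < n → Chooses p j a → Chooses p j b → a ≡ b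
  Chooses-unique p j a<n (ma , _) (_ , ub) = ub _ a<n ma

  record Invariant (p : List Bool) (i : ℕ) (col : Col) : Set where
    field
      hit  : ∀ v c → lookup col v ≡ just c → ∃[ j ] j < m × j < i × Chooses p j (toℕ v) × value p j ≡ toℕ c
      back : ∀ v j → j < m → j < i → Chooses p j (toℕ v) → ∃[ c ] lookup col v ≡ just c × value p j ≡ toℕ c

  open Invariant

  uncolored-¬Colored : ∀ {p i col v} → Invariant p i col → Uncolored col v → ¬ Colored p i (toℕ v)
  uncolored-¬Colored {v = v} I un (j , j<m , j<i , ch) =
    let c , e , _ = back I v j j<m j<i ch in contradiction (trans (sym un) e) λ ()

  ¬Colored-uncolored : ∀ {p i col} v → Invariant p i col → ¬ Colored p i (toℕ v) → Uncolored col v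
  ¬Colored-uncolored {col = col} v I nc with lookup col v in e
  ... | nothing = refl
  ... | just c  = let j , j<m , j<i , ch , _ = hit I v c e in ⊥-elim (nc (j , j<m , j<i , ch))

  is-⟺ : ∀ (c : Fin k) x → is c x ⟺ x ≡ just c
  is-⟺ c x = is-sound c x , λ { refl → is-refl c }

  recolored-⟺ : ∀ {p i col v c} b → Invariant p i col → value p b ≡ toℕ c → Uncolored col v → ∀ u x →
    lookup (N u ∩ colorClass (col [ v ]≔ just c) c) x ⟺ Recolored p i b (toℕ v) (toℕ u) (toℕ x)
  recolored-⟺ {p} {i} {col} {v} {c} b I ec un u x = ⟺-resp
    (trans (Vec.lookup-zipWith _∧_ x (N u) (colorClass (col [ v ]≔ just c) c)) (cong (lookup (N u) x ∧_) (lookup-class (col [ v ]≔ just c) c x)))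
    (⟺-∧ (⟺-resp (sym (nth-adjacent u x)) ⟺-id) (⟺-map to from (is-⟺ c _)))
    where
    Earlier : Set
    Earlier = ∃[ j ] j < m × j < i × Chooses p j (toℕ x) × Same p j b
    to : lookup (col [ v ]≔ just c) x ≡ just c → toℕ x ≡ toℕ v ⊎ Earlier
    to e with x Fin.≟ v
    ... | yes refl = inj₁ refl
    ... | no x≢v   = let j , j<m , j<i , ch , ev = hit I x c (trans (sym (set-other col v x x≢v)) e) in
      inj₂ (j , j<m , j<i , ch , bitsVal-injective m (trans ev (sym ec)))
    from : toℕ x ≡ toℕ v ⊎ Earlier → lookup (col [ v ]≔ just c) x ≡ just c
    from (inj₁ e) = trans (cong (lookup (col [ v ]≔ just c)) (Fin.toℕ-injective e)) (set-same col v)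
    from (inj₂ (j , j<m , j<i , ch , sa)) with back I x j j<m j<i ch
    ... | c′ , e , ev with Fin.toℕ-injective (trans (sym ev) (trans (bitsVal-cong m sa) ec))
    ...   | refl = trans (set-other col v x λ { refl → contradiction (trans (sym un) e) λ () }) e

  by-Fin : ∀ {s : Subset n} {P : ℕ → Set} → (∀ x → lookup s x ⟺ P (toℕ x)) → ∀ x → x < n → nth (toList s) x ⟺ P x
  by-Fin {s} {P} h x x<n = subst (λ y → nth (toList s) y ⟺ P y) (Fin.toℕ-fromℕ< x<n)
    (⟺-resp (nth-subset s (fromℕ< x<n)) (h (fromℕ< x<n)))

  adj-⟺ : ∀ u x → x < n → nth (toList (N u)) x ⟺ Adj (toℕ u) x
  adj-⟺ u = by-Fin (λ x → ⟺-resp (sym (nth-adjacent u x)) ⟺-id)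

  legal⇒ : ∀ {p i col} b → Invariant p i col → StrongMajority G col → Legal p i b →
    ∃[ v ] ∃[ c ] Chooses p b (toℕ v) × value p b ≡ toℕ c × LegalSM col v c
  legal⇒ {p} {i} {col} b I sm (v , v<n , ch , nc , be , maj) = x , c , ch′ , ec , un , majority
    where
    x = fromℕ< v<n
    x≡ : toℕ x ≡ v
    x≡ = Fin.toℕ-fromℕ< v<n
    c<k : value p b < k
    c<k = subst (value p b <_) kb-value (Below⇒< m be)
    c = fromℕ< c<k
    ec : value p b ≡ toℕ c
    ec = sym (Fin.toℕ-fromℕ< c<k)
    ch′ : Chooses p b (toℕ x)
    ch′ = subst (Chooses p b) (sym x≡) ch
    un : Uncolored col x
    un = ¬Colored-uncolored x I (subst (λ z → ¬ Colored p i z) (sym x≡) nc)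
    majority : StrongMajority G (col [ x ]≔ just c)
    majority u d with c Fin.≟ d
    -- `Legal` tests only the new color; for all others the condition is inherited from `sm`.
    ... | no c≢d   = ≤-trans (≤-reflexive (cong (2 *_) (class-≢ (N u) col x un c≢d))) (sm u d)
    ... | yes refl = subst₂ _≤_
      (trans (cong (λ z → z + z) (count-subset (N u ∩ colorClass (col [ x ]≔ just c) c)))
        (cong (∣ N u ∩ colorClass (col [ x ]≔ just c) c ∣ +_) (sym (ℕ.+-identityʳ _))))
      (count-subset (N u))
      (maj (toℕ u) (Fin.toℕ<n u) _ _
        (by-Fin (λ y → subst (λ z → lookup (N u ∩ colorClass (col [ x ]≔ just c) c) y ⟺ Recolored p i b z (toℕ u) (toℕ y)) x≡
          (recolored-⟺ b I ec un u y)))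
        (adj-⟺ u))

  legal⇐ : ∀ {p i col v c} b → Invariant p i col → Chooses p b (toℕ v) → value p b ≡ toℕ c → LegalSM col v c → Legal p i b
  legal⇐ {p} {i} {col} {v} {c} b I ch ec (un , sm) =
    toℕ v , Fin.toℕ<n v , ch , uncolored-¬Colored {v = v} I un ,
    <⇒Below m (≤-trans (≤-trans (s≤s (≤-reflexive ec)) (Fin.toℕ<n c)) (≤-reflexive (sym kb-value))) , at-most
    where
    at-most : ∀ u → u < n → AtMostHalf n (Recolored p i b (toℕ v) u) (Adj u)
    at-most u u<n f g hf hg = subst₂ _≤_
      (trans (cong (∣ s ∣ +_) (ℕ.+-identityʳ _)) (cong (λ z → z + z) (trans (sym (count-subset s))
        (count-cong n (λ x x<n → ⟺-unique (by-Fin {s} {Recolored p i b (toℕ v) (toℕ u′)} (recolored-⟺ b I ec un u′) x x<n)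
          (subst (λ z → f x ⟺ Recolored p i b (toℕ v) z x) (sym u≡) (hf x x<n)))))))
      (trans (sym (count-subset (N u′))) (count-cong n (λ x x<n →
        ⟺-unique (adj-⟺ u′ x x<n) (subst (λ z → g x ⟺ Adj z x) (sym u≡) (hg x x<n)))))
      (sm u′ c)
      where
      u′ = fromℕ< u<n
      u≡ : toℕ u′ ≡ u
      u≡ = Fin.toℕ-fromℕ< u<n
      s = N u′ ∩ colorClass (col [ v ]≔ just c) c

  Invariant-step : ∀ {p i col v c} → Invariant p i col → i < m → Chooses p i (toℕ v) → value p i ≡ toℕ c →
                   Uncolored col v → Invariant p (suc i) (col [ v ]≔ just c)
  Invariant-step {p} {i} {col} {v} {c} I i<m ch ec un .hit x d e with x Fin.≟ v
  ... | yes refl with refl ← Maybe.just-injective (trans (sym (set-same col v)) e) = i , i<m , ≤-refl , ch , ec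
  ... | no x≢v = let j , j<m , j<i , rest = hit I x d (trans (sym (set-other col v x x≢v)) e) in
    j , j<m , ℕ.m<n⇒m<1+n j<i , rest
  Invariant-step {p} {i} {col} {v} {c} I i<m ch ec un .back x j j<m j<1+i chj with j ℕ.≟ i
  ... | yes refl = c , trans (cong (lookup (col [ v ]≔ just c)) (Fin.toℕ-injective (Chooses-unique p i (Fin.toℕ<n x) chj ch))) (set-same col v) , ec
  ... | no j≢i   = let d , e , ev = back I x j j<m (ℕ.≤∧≢⇒< (ℕ.≤-pred j<1+i) j≢i) chj in
    d , trans (set-other col v x λ { refl → contradiction (trans (sym un) e) λ () }) e , ev

  mark : Fin n → ℕ → Bool
  mark v q = does (q ℕ.≟ toℕ v)

  block : Fin n → (ℕ → Bool) → List Bool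
  block v f = bitsList m (mark v) ++ bitsList m f

  length-block : ∀ v f → length (block v f) ≡ m + m
  length-block v f = trans (List.length-++ (bitsList m (mark v))) (cong₂ _+_ (length-bitsList m (mark v)) (length-bitsList m f))

  module _ (i : ℕ) (h : List Bool) (lh : length h ≡ i * (m + m)) where

    nth-block : ∀ s e t → t < length s → nth (h ++ s ++ e) (i * (m + m) + t) ≡ nth s t
    nth-block s e t t< = trans (cong (λ z → nth (h ++ s ++ e) (z + t)) (sym lh))
      (trans (nth-++ h (s ++ e) t) (nth-++ˡ s e t t<))

    module _ (s : List Bool) (ls : length s ≡ m + m) where

      marks-block : ∀ e u → u < n → nth (h ++ s ++ e) (i * (m + m) + u) ≡ nth s u
      marks-block e u u<n = nth-block s e u (≤-trans (ℕ.<-trans u<n n<m) (≤-trans (m≤m+n m m) (≤-reflexive (sym ls))))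

      color-block : ∀ e q → q < m → color (h ++ s ++ e) i q ≡ nth s (m + q)
      color-block e q q<m = trans (cong (nth (h ++ s ++ e)) (ℕ.+-assoc (i * (m + m)) m q))
        (nth-block s e (m + q) (≤-trans (ℕ.+-monoʳ-< m q<m) (≤-reflexive (sym ls))))

      Chooses-block : ∀ e e′ {v} → v < n → Chooses (h ++ s ++ e) i v → Chooses (h ++ s ++ e′) i v
      Chooses-block e e′ {v} v<n (mk , un) = trans (same v v<n) mk , λ u u<n mu → un u u<n (trans (sym (same u u<n)) mu)
        where
        same : ∀ u → u < n → nth (h ++ s ++ e′) (i * (m + m) + u) ≡ nth (h ++ s ++ e) (i * (m + m) + u)
        same u u<n = trans (marks-block e′ u u<n) (sym (marks-block e u u<n))

      value-block : ∀ e e′ → value (h ++ s ++ e) i ≡ value (h ++ s ++ e′) i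
      value-block e e′ = bitsVal-cong m (λ q q<m → trans (color-block e q q<m) (sym (color-block e′ q q<m)))

    block-chooses : ∀ v f e → Chooses (h ++ block v f ++ e) i (toℕ v)
    block-chooses v f e = trans (marked (toℕ v) (Fin.toℕ<n v)) (yes-refl (toℕ v)) ,
      λ u u<n mu → yes-sound u (trans (sym (marked u u<n)) mu)
      where
      marked : ∀ u → u < n → nth (h ++ block v f ++ e) (i * (m + m) + u) ≡ does (u ℕ.≟ toℕ v)
      marked u u<n = trans (marks-block (block v f) (length-block v f) e u u<n) (nth-bitsList m (mark v) (bitsList m f) u (ℕ.<-trans u<n n<m))
      yes-refl : ∀ u → does (u ℕ.≟ u) ≡ true
      yes-refl u = Dec.dec-true (u ℕ.≟ u) refl
      yes-sound : ∀ u → does (u ℕ.≟ toℕ v) ≡ true → u ≡ toℕ v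
      yes-sound u e = ℕ.≡ᵇ⇒≡ u (toℕ v) (subst T (sym e) tt)

    block-value : ∀ v f e → value (h ++ block v f ++ e) i ≡ bitsVal m f
    block-value v f e = bitsVal-cong m λ q q<m → trans (color-block (block v f) (length-block v f) e q q<m)
      (trans (cong (λ z → nth (block v f) (z + q)) (sym (length-bitsList m (mark v))))
        (trans (nth-++ (bitsList m (mark v)) (bitsList m f) q)
          (trans (cong (λ l → nth l q) (sym (List.++-identityʳ (bitsList m f)))) (nth-bitsList m f [] q q<m))))

  -- The leaf formula reads the whole play, so the facts about the past `h` are stated for every
  -- future `e`.
  record Position (i : ℕ) (h : List Bool) (col : Col) : Set where
    field
      position  : length h ≡ i * (m + m)
      invariant : ∀ e → Invariant (h ++ e) i col
      legals    : ∀ e j → j < m → j < i → Legal (h ++ e) j j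
      majority  : StrongMajority G col
      size      : i + uncoloredCount col ≡ n

  open Position

  advance : ∀ {i h col s v c} → Position i h col → i < m → length s ≡ m + m →
    (∀ e → Chooses (h ++ s ++ e) i (toℕ v)) → (∀ e → value (h ++ s ++ e) i ≡ toℕ c) → LegalSM col v c →
    Position (suc i) (h ++ s) (col [ v ]≔ just c)
  advance {i} {h} {col} {s} {v} {c} pos i<m ls ch ev (un , sm) = record
    { position  = trans (List.length-++ h) (trans (cong₂ _+_ (position pos) ls) (ℕ.+-comm (i * (m + m)) (m + m)))
    ; invariant = λ e → subst (λ p → Invariant p (suc i) (col [ v ]≔ just c)) (sym (List.++-assoc h s e))
        (Invariant-step (invariant pos (s ++ e)) i<m (ch e) (ev e) un)
    ; legals    = λ e j j<m j<1+i → subst (λ p → Legal p j j) (sym (List.++-assoc h s e)) (legal-at e j j<m j<1+i)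
    ; majority  = sm
    ; size      = trans (sym (ℕ.+-suc i _)) (trans (cong (i +_) (sym (uncoloredCount-set col v un))) (size pos))
    }
    where
    legal-at : ∀ e j → j < m → j < suc i → Legal (h ++ s ++ e) j j
    legal-at e j j<m j<1+i with j ℕ.≟ i
    ... | yes refl = legal⇐ i (invariant pos (s ++ e)) (ch e) (ev e) (un , sm)
    ... | no j≢i   = legals pos (s ++ e) j j<m (ℕ.≤∧≢⇒< (ℕ.≤-pred j<1+i) j≢i)

  -- Truth of the remaining prefix `y` once the bits `h` are fixed. Here `h` is in the order of
  -- play, whereas `qeval` keeps its path reversed.
  Q : List Bool → List Bool → Set
  Q y h = qeval (code ∷ o ∷ []) y (h ʳ++ []) ≡ true

  Q-bit : ∀ y h b → Q y (h ++ b ∷ []) ≡ (qeval (code ∷ o ∷ []) y (b ∷ (h ʳ++ [])) ≡ true)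
  Q-bit y h b = cong (λ z → qeval (code ∷ o ∷ []) y z ≡ true) (List.++-ʳ++ h)

  snoc-++ : ∀ h (b : Bool) s → (h ++ b ∷ []) ++ s ≡ h ++ b ∷ s
  snoc-++ h b s = List.++-assoc h (b ∷ []) s

  Q-∃⇒ : ∀ d y h → Q (List.replicate d true ++ y) h → ∃[ s ] length s ≡ d × Q y (h ++ s)
  Q-∃⇒ zero    y h q = [] , refl , subst (Q y) (sym (List.++-identityʳ h)) q
  Q-∃⇒ (suc d) y h q with ∨-elim {qeval (code ∷ o ∷ []) (List.replicate d true ++ y) (false ∷ (h ʳ++ []))} q
  ... | inj₁ e = let s , l , r = Q-∃⇒ d y (h ++ false ∷ []) (subst id (sym (Q-bit (List.replicate d true ++ y) h false)) e) in
    false ∷ s , cong suc l , subst (Q y) (snoc-++ h false s) r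
  ... | inj₂ e = let s , l , r = Q-∃⇒ d y (h ++ true ∷ []) (subst id (sym (Q-bit (List.replicate d true ++ y) h true)) e) in
    true ∷ s , cong suc l , subst (Q y) (snoc-++ h true s) r

  Q-∃⇐ : ∀ s y h → Q y (h ++ s) → Q (List.replicate (length s) true ++ y) h
  Q-∃⇐ []          y h q = subst (Q y) (List.++-identityʳ h) q
  Q-∃⇐ (false ∷ s) y h q = ∨-intro (inj₁ (subst id (Q-bit (List.replicate (length s) true ++ y) h false)
    (Q-∃⇐ s y (h ++ false ∷ []) (subst (Q y) (sym (snoc-++ h false s)) q))))
  Q-∃⇐ (true  ∷ s) y h q = ∨-intro {qeval (code ∷ o ∷ []) (List.replicate (length s) true ++ y) (false ∷ (h ʳ++ []))}
    (inj₂ (subst id (Q-bit (List.replicate (length s) true ++ y) h true)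
    (Q-∃⇐ s y (h ++ true ∷ []) (subst (Q y) (sym (snoc-++ h true s)) q))))

  Q-∀⇒ : ∀ s y h → Q (List.replicate (length s) false ++ y) h → Q y (h ++ s)
  Q-∀⇒ []          y h q = subst (Q y) (sym (List.++-identityʳ h)) q
  Q-∀⇒ (false ∷ s) y h q = subst (Q y) (snoc-++ h false s)
    (Q-∀⇒ s y (h ++ false ∷ []) (subst id (sym (Q-bit (List.replicate (length s) false ++ y) h false)) (proj₁ (∧-elim q))))
  Q-∀⇒ (true  ∷ s) y h q = subst (Q y) (snoc-++ h true s)
    (Q-∀⇒ s y (h ++ true ∷ []) (subst id (sym (Q-bit (List.replicate (length s) false ++ y) h true)) (proj₂ (∧-elim q))))

  Q-∀⇐ : ∀ d y h → (∀ s → length s ≡ d → Q y (h ++ s)) → Q (List.replicate d false ++ y) h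
  Q-∀⇐ zero    y h q = subst (Q y) (List.++-identityʳ h) (q [] refl)
  Q-∀⇐ (suc d) y h q = ∧-intro
    (subst id (Q-bit (List.replicate d false ++ y) h false)
      (Q-∀⇐ d y (h ++ false ∷ []) (λ s l → subst (Q y) (sym (snoc-++ h false s)) (q (false ∷ s) (cong suc l)))))
    (subst id (Q-bit (List.replicate d false ++ y) h true)
      (Q-∀⇐ d y (h ++ true ∷ []) (λ s l → subst (Q y) (sym (snoc-++ h true s)) (q (true ∷ s) (cong suc l)))))

  -- Closes the formula once the outcome is settled before the blocks are used up.
  Q-all : ∀ y h → (∀ e → Q [] (h ++ e)) → Q y h
  Q-all []          h q = subst (Q []) (List.++-identityʳ h) (q [])
  Q-all (true ∷ y)  h q = Q-∃⇐ (false ∷ []) y h (Q-all y (h ++ false ∷ []) (λ e → subst (Q []) (sym (snoc-++ h false e)) (q (false ∷ e))))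
  Q-all (false ∷ y) h q = Q-∀⇐ 1 y h λ s _ → Q-all y (h ++ s) (λ e → subst (Q []) (sym (List.++-assoc h s e)) (q (s ++ e)))

  Q-some : ∀ y h → Q y h → ∃[ e ] Q [] (h ++ e)
  Q-some []          h q = [] , subst (Q []) (sym (List.++-identityʳ h)) q
  Q-some (true ∷ y)  h q = let s , _ , r = Q-∃⇒ 1 y h q
                               e , z = Q-some y (h ++ s) r in s ++ e , subst (Q []) (List.++-assoc h s e) z
  Q-some (false ∷ y) h q = let e , z = Q-some y (h ++ false ∷ []) (Q-∀⇒ (false ∷ []) y h q) in
    false ∷ e , subst (Q []) (snoc-++ h false e) z

  leaf⇐ : ∀ p → Won p → Q [] p
  leaf⇐ p won = subst (λ z → holds (z ∷ code ∷ o ∷ []) leafF (Vec.replicate 9 0) ≡ true) (sym (reverse-twice p))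
    (proj₂ (won-⟺ p) (valid , won))

  leaf⇒ : ∀ p → Q [] p → Won p
  leaf⇒ p q = proj₂ (proj₁ (won-⟺ p)
    (subst (λ z → holds (z ∷ code ∷ o ∷ []) leafF (Vec.replicate 9 0) ≡ true) (reverse-twice p) q))

  rounds : ℕ → ℕ → List Bool
  rounds i zero    = []
  rounds i (suc r) = List.replicate (m + m) (parity i) ++ rounds (suc i) r

  rounds-snoc : ∀ i r → rounds i (suc r) ≡ rounds i r ++ List.replicate (m + m) (parity (i + r))
  rounds-snoc i zero    = trans (List.++-identityʳ _) (cong (λ z → List.replicate (m + m) (parity z)) (sym (ℕ.+-identityʳ i)))
  rounds-snoc i (suc r) = trans (cong (List.replicate (m + m) (parity i) ++_) (rounds-snoc (suc i) r))
    (trans (sym (List.++-assoc (List.replicate (m + m) (parity i)) (rounds (suc i) r) _))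
      (cong (λ z → (List.replicate (m + m) (parity i) ++ rounds (suc i) r) ++ List.replicate (m + m) (parity z)) (sym (ℕ.+-suc i r))))

  parity-⟺ : ∀ i → i < m → parity i ⟺ Even i
  parity-⟺ i i<m = (λ e → let h , le , eq = parity-half i e in h , ℕ.≤-<-trans le i<m , eq) ,
    λ { (h , _ , refl) → parity-+ h }

  list-prefix : list ([] ∷ code ∷ o ∷ []) prefixG (Vec.replicate 9 0) ≡ rounds 0 m
  list-prefix = trans (concatBelow-cong m λ i i<m → trans
      (concatBelow-cong m λ j _ → cong (λ b → b ∷ b ∷ [])
        (⟺-unique (even-⟺ [] i 0 {j} {0} {0} {0} {0} {0} {0}) (parity-⟺ i i<m)))
      (concatBelow-twice m (parity i)))
    (unfold m)
    where
    unfold : ∀ r → concatBelow r (λ i → List.replicate (m + m) (parity i)) ≡ rounds 0 r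
    unfold zero    = refl
    unfold (suc r) = trans (cong (_++ List.replicate (m + m) (parity r)) (unfold r)) (sym (rounds-snoc 0 r))

  turnOf : Bool → Player
  turnOf true  = alice
  turnOf false = bob

  Wins : Player → Col → Set
  Wins = AliceWins LegalSM (SomeVertexStuck G)

  opaque
    legal? : ∀ p i → Dec (Legal p i i)
    legal? p i = ⟺-dec (legal-⟺ p i 0 (var i₀) (var i₀) (λ _ _ _ _ _ _ _ → refl) (λ _ _ _ _ _ _ _ → refl))

    chooses? : ∀ p i v → Dec (Chooses p i v)
    chooses? p i v = ⟺-dec (chooses-⟺ p i 0 v 0 0 0 (var i₀) (var i₂) (λ _ → refl) (λ _ → refl))

    majority? : (col : Col) → Dec (StrongMajority G col)
    majority? col = Fin.all? λ v → Fin.all? λ c → 2 * ∣ N v ∩ colorClass col c ∣ ℕ.≤? ∣ N v ∣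

  spell : (c : Fin k) → ∃[ f ] bitsVal m f ≡ toℕ c
  spell c = digits m kb (≤-trans (ℕ.<⇒≤ (Fin.toℕ<n c)) (≤-reflexive (sym kb-value)))

  color-of : ∀ {col : Col} v → ¬ Uncolored col v → ∃[ c ] lookup col v ≡ just c
  color-of {col} v nu with lookup col v
  ... | just c  = c , refl
  ... | nothing = ⊥-elim (nu refl)

  module _ {i : ℕ} {h : List Bool} {col : Col} (pos : Position i h col) where

    early : i < m
    early = ℕ.≤-<-trans (≤-trans (m≤m+n i _) (≤-reflexive (size pos))) n<m

    all-colored : ∀ e → Complete col → ∀ v → v < n → Colored (h ++ e) i v
    all-colored e full v v<n = let c , ec = color-of {col} (fromℕ< v<n) (full (fromℕ< v<n))
                                   j , j<m , j<i , ch , _ = hit (invariant pos e) (fromℕ< v<n) c ec in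
      j , j<m , j<i , subst (Chooses (h ++ e) j) (Fin.toℕ-fromℕ< v<n) ch

    complete-wins : Complete col → ∀ y → Q y h
    complete-wins full y = Q-all y h λ e → leaf⇐ (h ++ e)
      (i , early , legals pos e , inj₁ (all-colored e full))

    not-complete : ∀ {v} → Uncolored col v → ∀ e i′ → i′ ≤ i → ¬ (∀ v → v < n → Colored (h ++ e) i′ v)
    not-complete {v} un e i′ le all = let j , j<m , j<i′ , ch = all (toℕ v) (Fin.toℕ<n v) in
      uncolored-¬Colored {v = v} (invariant pos e) un (j , j<m , ≤-trans j<i′ le , ch)

    -- The round at which such a leaf is won must be `i`: a later one would need round `i` to be
    -- legal, and at an earlier one the graph is incomplete and the block legal.
    illegal-leaf : ∀ {v} → Uncolored col v → ∀ e → ¬ Legal (h ++ e) i i → Won (h ++ e) → ¬ Even i × Refuted (h ++ e) i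
    illegal-leaf un e nl (i′ , i′<m , legal , cases) with ℕ.<-cmp i′ i
    ... | tri> _ _ i<i′ = ⊥-elim (nl (legal i early i<i′))
    ... | tri≈ _ refl _ = [ (λ all → ⊥-elim (not-complete un e i ≤-refl all)) , (λ (ne , _ , ref) → ne , ref) ]′ cases
    ... | tri< i′<i _ _ = [ (λ all → ⊥-elim (not-complete un e i′ (ℕ.<⇒≤ i′<i) all)) ,
                            (λ (_ , nl′ , _) → ⊥-elim (nl′ (legals pos e i′ i′<m i′<i))) ]′ cases

    play-on : ∀ {v c} → LegalSM col v c →
      ∃[ s ] length s ≡ m + m × Position (suc i) (h ++ s) (col [ v ]≔ just c)
    play-on {v} {c} legal = let f , ef = spell c in
      block v f , length-block v f ,
      advance pos early (length-block v f) (block-chooses i h (position pos) v f)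
        (λ e → trans (block-value i h (position pos) v f e) ef) legal

    respond : ∀ s → length s ≡ m + m → Legal (h ++ s ++ []) i i →
      ∃[ v ] ∃[ c ] LegalSM col v c × Position (suc i) (h ++ s) (col [ v ]≔ just c)
    respond s ls legal = let v , c , ch , ev , sm = legal⇒ i (invariant pos _) (majority pos) legal in
      v , c , sm , advance pos early ls (λ e → Chooses-block i h (position pos) s ls [] e (Fin.toℕ<n v) ch)
        (λ e → trans (value-block i h (position pos) s ls e []) ev) sm

    -- Legality of a block depends on the play only up to this block: the move it spells is the same
    -- under every continuation.
    still-illegal : ∀ s → length s ≡ m + m → ¬ Legal (h ++ s ++ []) i i → ∀ e → ¬ Legal (h ++ s ++ e) i i
    still-illegal s ls nl e legal = let v , c , ch , ev , sm = legal⇒ i (invariant pos _) (majority pos) legal in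
      nl (legal⇐ i (invariant pos _) (Chooses-block i h (position pos) s ls e [] (Fin.toℕ<n v) ch)
        (trans (value-block i h (position pos) s ls [] e) ev) sm)

  odd-not-even : ∀ {i} → i < m → parity i ≡ false → ¬ Even i
  odd-not-even i<m e = ⟺-false (parity-⟺ _ i<m) e

  -- As `n < m`, an uncolored vertex guarantees two further rounds: one for the move and one for the
  -- answer if the move is a claim of Bob.
  one-more : ∀ {i u r} → i + suc u ≡ n → i + r ≡ m → ∃[ r′ ] r ≡ suc (suc r′)
  one-more {i} {u} {zero} en em = ⊥-elim (ℕ.<-asym n<m (≤-trans (≤-trans (s≤s (≤-reflexive (trans (sym em) (ℕ.+-identityʳ i))))
    (≤-trans (≤-reflexive (ℕ.+-comm 1 i)) (ℕ.+-monoʳ-≤ i (s≤s (z≤n {u}))))) (≤-reflexive en)))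
  one-more {i} {u} {suc zero} en em = ⊥-elim (ℕ.<-irrefl refl (ℕ.<-≤-trans n<m
    (≤-trans (≤-reflexive (sym em)) (≤-trans (ℕ.+-monoʳ-≤ i (s≤s (z≤n {u}))) (≤-reflexive en)))))
  one-more {i} {u} {suc (suc r)} en em = r , refl

  -- Alice disproves the claim that `v` is stuck by spelling a legal color for it in the next round,
  -- judged in the position before the claim.
  challenge : ∀ {i h col s v} (pos : Position i h col) → parity i ≡ false → ∀ {r} → suc i + suc r ≡ m → length s ≡ m + m →
    ¬ Legal (h ++ s ++ []) i i → Chooses (h ++ s ++ []) i (toℕ v) →
    ∃ (LegalSM col v) → Q (rounds (suc i) (suc r)) (h ++ s)
  challenge {i} {h} {col} {s} {v} pos odd {r} em ls nl ch (c , legal) =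
    subst (λ b → Q (List.replicate (m + m) b ++ rounds (suc (suc i)) r) (h ++ s)) (sym (cong not odd))
      (subst (λ d → Q (List.replicate d true ++ rounds (suc (suc i)) r) (h ++ s)) ls₂
        (Q-∃⇐ s₂ (rounds (suc (suc i)) r) (h ++ s) (Q-all (rounds (suc (suc i)) r) ((h ++ s) ++ s₂) λ e →
          subst (Q []) (reassoc e) (leaf⇐ (h ++ s ++ s₂ ++ e) (won e)))))
    where
    lhs : length (h ++ s) ≡ suc i * (m + m)
    lhs = trans (List.length-++ h) (trans (cong₂ _+_ (position pos) ls) (ℕ.+-comm (i * (m + m)) (m + m)))
    f  = proj₁ (spell c)
    s₂ = block v f
    ls₂ = length-block v f
    reassoc : ∀ e → h ++ s ++ s₂ ++ e ≡ ((h ++ s) ++ s₂) ++ e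
    reassoc e = trans (sym (List.++-assoc h s (s₂ ++ e))) (sym (List.++-assoc (h ++ s) s₂ e))
    chosen : ∀ e → Chooses (h ++ s ++ s₂ ++ e) (suc i) (toℕ v)
    chosen e = subst (λ p → Chooses p (suc i) (toℕ v)) (List.++-assoc h s (s₂ ++ e)) (block-chooses (suc i) (h ++ s) lhs v f e)
    valued : ∀ e → value (h ++ s ++ s₂ ++ e) (suc i) ≡ toℕ c
    valued e = trans (subst (λ p → value p (suc i) ≡ bitsVal m f) (List.++-assoc h s (s₂ ++ e)) (block-value (suc i) (h ++ s) lhs v f e)) (proj₂ (spell c))
    next≡ : suc i ≡ i + 1
    next≡ = ℕ.+-comm 1 i
    won : ∀ e → Won (h ++ s ++ s₂ ++ e)
    won e = i , early pos , legals pos (s ++ s₂ ++ e) , inj₂ (odd-not-even (early pos) odd ,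
      still-illegal pos s ls nl (s₂ ++ e) ,
      inj₂ (subst (Legal (h ++ s ++ s₂ ++ e) i) next≡ (legal⇐ (suc i) (invariant pos (s ++ s₂ ++ e)) (chosen e) (valued e) legal) ,
        λ v′ v′<n ch′ → subst₂ (λ j x → Chooses (h ++ s ++ s₂ ++ e) j x) next≡
          (Chooses-unique (h ++ s ++ s₂ ++ e) i (Fin.toℕ<n v) (Chooses-block i h (position pos) s ls [] (s₂ ++ e) (Fin.toℕ<n v) ch) ch′) (chosen e)))

  wins⇒ : ∀ u i r {h col} b → parity i ≡ b → uncoloredCount col ≡ u → i + r ≡ m → Position i h col →
          Wins (turnOf b) col → Q (rounds i r) h
  wins⇒ zero    i r {col = col} b eb eu em pos t = complete-wins pos (uncoloredCount-zero col eu) (rounds i r)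
  wins⇒ (suc u) i r {h} {col} b eb eu em pos t
    with one-more (trans (cong (i +_) (sym eu)) (size pos)) em
  ... | r′ , refl = go-on b eb t
    where
    em′ : suc i + suc r′ ≡ m
    em′ = trans (sym (ℕ.+-suc i (suc r′))) em
    eu′ : ∀ {v c} → LegalSM col v c → uncoloredCount (col [ v ]≔ just c) ≡ u
    eu′ {v} (un , _) = ℕ.suc-injective (trans (sym (uncoloredCount-set col v un)) eu)
    some-left : ¬ Complete col
    some-left full = let v , un = uncoloredCount-suc col eu in full v un
    go-on : ∀ b → parity i ≡ b → Wins (turnOf b) col → Q (rounds i (suc (suc r′))) h
    go-on true  eb (complete full) = ⊥-elim (some-left full)
    go-on false eb (complete full) = ⊥-elim (some-left full)
    go-on true eb (aliceMoves ns v c legal t) = let s , ls , pos′ = play-on pos legal in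
      subst (λ z → Q (List.replicate (m + m) z ++ rounds (suc i) (suc r′)) h) (sym eb)
        (subst (λ d → Q (List.replicate d true ++ rounds (suc i) (suc r′)) h) ls
          (Q-∃⇐ s (rounds (suc i) (suc r′)) h (wins⇒ u (suc i) (suc r′) false (cong not eb) (eu′ legal) em′ pos′ t)))
    go-on false eb (bobMoves ns f) =
      subst (λ z → Q (List.replicate (m + m) z ++ rounds (suc i) (suc r′)) h) (sym eb)
        (Q-∀⇐ (m + m) (rounds (suc i) (suc r′)) h reply)
      where
      reply : ∀ s → length s ≡ m + m → Q (rounds (suc i) (suc r′)) (h ++ s)
      reply s ls with legal? (h ++ s ++ []) i
      ... | yes legal = let v , c , sm , pos′ = respond pos s ls legal in
        wins⇒ u (suc i) (suc r′) true (cong not eb) (eu′ sm) em′ pos′ (f v c sm)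
      -- An illegal block falls into two cases. If it chooses an uncolored vertex, that vertex has a
      -- legal color because nothing is stuck, and Alice shows it; otherwise the block refutes
      -- itself.
      ... | no nl with Fin.any? (λ v → chooses? (h ++ s ++ []) i (toℕ v) Dec.×-dec Maybe.≡-dec Fin._≟_ (lookup col v) nothing)
      ...   | yes (v , ch , un) with Fin.any? (λ c → majority? (col [ v ]≔ just c))
      ...     | yes (c , sm) = challenge pos eb em′ ls nl ch (c , un , sm)
      ...     | no none      = ⊥-elim (ns (v , un , λ c (_ , sm) → none (c , sm)))
      reply s ls | no nl | no none = Q-all (rounds (suc i) (suc r′)) (h ++ s) λ e →
        subst (Q []) (sym (List.++-assoc h s e)) (leaf⇐ (h ++ s ++ e)
          (i , early pos , legals pos (s ++ e) , inj₂ (odd-not-even (early pos) eb , still-illegal pos s ls nl e , inj₁ (spent e))))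
        where
        spent : ∀ e v → v < n → Chooses (h ++ s ++ e) i v → Colored (h ++ s ++ e) i v
        spent e v v<n ch = let x = fromℕ< v<n
                               c , ec = color-of {col} x λ un → none (x ,
                                 subst (Chooses (h ++ s ++ []) i) (sym (Fin.toℕ-fromℕ< v<n)) (Chooses-block i h (position pos) s ls e [] v<n ch) , un)
                               j , j<m , j<i , ch′ , _ = hit (invariant pos (s ++ e)) x c ec in
          j , j<m , j<i , subst (Chooses (h ++ s ++ e) j) (Fin.toℕ-fromℕ< v<n) ch′

  class-grows : ∀ {l} (p : Subset l) (b : Coloring l k) x c d → Uncolored b x →
                ∣ p ∩ colorClass b d ∣ ≤ ∣ p ∩ colorClass (b [ x ]≔ just c) d ∣
  class-grows (false ∷ p) (nothing ∷ b) zero    c d un = ≤-refl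
  class-grows (true  ∷ p) (nothing ∷ b) zero    c d un with is d (just c)
  ... | true  = ℕ.n≤1+n _
  ... | false = ≤-refl
  class-grows (a ∷ p) (y ∷ b) (suc x) c d un with a ∧ is d y
  ... | true  = s≤s (class-grows p b x c d un)
  ... | false = class-grows p b x c d un

  -- Color classes only grow, so a move that violates the condition violates it in every later
  -- position.
  still-stuck : ∀ {col : Col} {v c x} → Uncolored col v → v ≢ x → (∀ d → ¬ LegalSM col x d) → ∀ d → ¬ LegalSM (col [ v ]≔ just c) x d
  still-stuck {col} {v} {c} {x} un v≢x none d (ux , sm) = none d
    (trans (sym (set-other col v x (v≢x ∘ sym))) ux , λ u e → ≤-trans (ℕ.*-monoʳ-≤ 2
      (subst (λ z → ∣ N u ∩ colorClass (col [ x ]≔ just d) e ∣ ≤ ∣ N u ∩ colorClass z e ∣) (Vec.[]≔-commutes col x v (v≢x ∘ sym))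
        (class-grows (N u) (col [ x ]≔ just d) v c e (trans (set-other col x v v≢x) un)))) (sm u e))

  -- The formula reports stuck vertices in Bob's rounds only. This suffices: a vertex stuck before
  -- Alice's move is still stuck after it, where the strategy from Bob's turn excludes it.
  not-stuck : ∀ {col : Col} {v c} → LegalSM col v c → Wins bob (col [ v ]≔ just c) → ¬ SomeVertexStuck G col
  not-stuck {col} {v} {c} legal t (x , ux , none) with v Fin.≟ x
  ... | yes refl = none c legal
  ... | no v≢x   = refute t
    where
    ux′ : Uncolored (col [ v ]≔ just c) x
    ux′ = trans (set-other col v x (v≢x ∘ sym)) ux
    refute : Wins bob (col [ v ]≔ just c) → ⊥
    refute (complete full) = full x ux′
    refute (bobMoves ns _) = ns (x , ux′ , still-stuck (proj₁ legal) v≢x none)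

  wins⇐ : ∀ u i r {h col} b → parity i ≡ b → uncoloredCount col ≡ u → i + r ≡ m → Position i h col →
          Q (rounds i r) h → Wins (turnOf b) col
  wins⇐ zero    i r {col = col} b eb eu em pos q = complete (uncoloredCount-zero col eu)
  wins⇐ (suc u) i r {h} {col} b eb eu em pos q
    with one-more (trans (cong (i +_) (sym eu)) (size pos)) em
  ... | r′ , refl = go-on b eb (subst (λ z → Q (List.replicate (m + m) z ++ rounds (suc i) (suc r′)) h) eb q)
    where
    em′ : suc i + suc r′ ≡ m
    em′ = trans (sym (ℕ.+-suc i (suc r′))) em
    eu′ : ∀ {v c} → LegalSM col v c → uncoloredCount (col [ v ]≔ just c) ≡ u
    eu′ {v} (un , _) = ℕ.suc-injective (trans (sym (uncoloredCount-set col v un)) eu)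
    free : ∃ (Uncolored col)
    free = uncoloredCount-suc col eu
    leaf-of : ∀ s → Q (rounds (suc i) (suc r′)) (h ++ s) → ∃[ e ] Won (h ++ s ++ e)
    leaf-of s q = let e , z = Q-some (rounds (suc i) (suc r′)) (h ++ s) q in
      e , leaf⇒ (h ++ s ++ e) (subst (Q []) (List.++-assoc h s e) z)
    go-on : ∀ b → parity i ≡ b → Q (List.replicate (m + m) b ++ rounds (suc i) (suc r′)) h → Wins (turnOf b) col
    go-on true eb q with Q-∃⇒ (m + m) (rounds (suc i) (suc r′)) h q
    ... | s , ls , q′ with legal? (h ++ s ++ []) i
    ...   | no nl = let e , won = leaf-of s q′
                        ne , _ = illegal-leaf pos (proj₂ free) (s ++ e) (still-illegal pos s ls nl e) won in
      ⊥-elim (ne (proj₁ (parity-⟺ i (early pos)) eb))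
    ...   | yes legal = let v , c , sm , pos′ = respond pos s ls legal
                            t = wins⇐ u (suc i) (suc r′) false (cong not eb) (eu′ sm) em′ pos′ q′ in
      aliceMoves (not-stuck sm t) v c sm t
    go-on false eb q = bobMoves unstuck λ v c legal → let s , ls , pos′ = play-on pos legal in
      wins⇐ u (suc i) (suc r′) true (cong not eb) (eu′ legal) em′ pos′
        (Q-∀⇒ s (rounds (suc i) (suc r′)) h (subst (λ d → Q (List.replicate d false ++ rounds (suc i) (suc r′)) h) (sym ls) q))
      where
      unstuck : ¬ SomeVertexStuck G col
      unstuck (v , un , none) = [ unclaimed , (λ (legal , same) → answered legal same) ]′
        (proj₂ (illegal-leaf pos un (s ++ e) illegal (proj₂ leaf)))
        where
        lh = position pos
        -- Bob claims that `v` is stuck. The color bits are arbitrary, since no color is legal at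
        -- `v`.
        s  = block v kb
        leaf = leaf-of s (Q-∀⇒ s (rounds (suc i) (suc r′)) h
          (subst (λ d → Q (List.replicate d false ++ rounds (suc i) (suc r′)) h) (sym (length-block v kb)) q))
        e = proj₁ leaf
        p = h ++ s ++ e
        I = invariant pos (s ++ e)
        chosen : Chooses p i (toℕ v)
        chosen = block-chooses i h lh v kb e
        none-at : ∀ b → Chooses p b (toℕ v) → ¬ Legal p i b
        none-at b ch legal = let x , c , ch′ , _ , sm = legal⇒ b I (majority pos) legal in
          none c (subst (λ y → LegalSM col y c) (Fin.toℕ-injective (Chooses-unique p b (Fin.toℕ<n x) ch′ ch)) sm)
        illegal : ¬ Legal p i i
        illegal = none-at i chosen
        unclaimed : (∀ v → v < n → Chooses p i v → Colored p i v) → ⊥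
        unclaimed all = uncolored-¬Colored {v = v} I un (all (toℕ v) (Fin.toℕ<n v) chosen)
        answered : Legal p i (i + 1) → (∀ v → v < n → Chooses p i v → Chooses p (i + 1) v) → ⊥
        answered legal same = none-at (i + 1) (same (toℕ v) (Fin.toℕ<n v) chosen) legal

  start : Position 0 [] (uncolored {n} {k})
  start = record
    { position  = refl
    ; invariant = λ e → record
        { hit  = λ v c e → contradiction (trans (sym (Vec.lookup-replicate v nothing)) e) λ ()
        ; back = λ _ _ _ () }
    ; legals    = λ _ _ _ ()
    ; majority  = λ v c → ≤-trans (≤-reflexive (cong (2 *_) (nobody (N v) c))) z≤n
    ; size      = uncoloredCount-uncolored n
    }
    where
    nobody : ∀ {l} (p : Subset l) c → ∣ p ∩ colorClass (uncolored {l} {k}) c ∣ ≡ 0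
    nobody []          c = refl
    nobody (true  ∷ p) c = nobody p c
    nobody (false ∷ p) c = nobody p c

  game-value : (qeval (code ∷ o ∷ []) (rounds 0 m) [] ≡ true) ⇔ AliceWinsStrongMajority G k
  game-value = mk⇔
    (wins⇐ n 0 m true refl (uncoloredCount-uncolored n) refl start)
    (wins⇒ n 0 m true refl (uncoloredCount-uncolored n) refl start)

-- Writing down the subdivided graph

-- Generated lists are defined by growth at the end, vectors by growth at the front; this mediates
-- between them.
concatBelow-front : ∀ n g → concatBelow (suc n) g ≡ g 0 ++ concatBelow n (g ∘ suc)
concatBelow-front zero    g = sym (List.++-identityʳ (g 0))
concatBelow-front (suc n) g = trans (cong (_++ g (suc n)) (concatBelow-front n g))
  (List.++-assoc (g 0) (concatBelow n (g ∘ suc)) (g (suc n)))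

concatBelow-+ : ∀ a r g → concatBelow (a + r) g ≡ concatBelow a g ++ concatBelow r (λ j → g (a + j))
concatBelow-+ a zero    g = trans (cong (λ z → concatBelow z g) (ℕ.+-identityʳ a)) (sym (List.++-identityʳ _))
concatBelow-+ a (suc r) g = trans (cong (λ z → concatBelow z g) (ℕ.+-suc a r))
  (trans (cong (_++ g (a + r)) (concatBelow-+ a r g)) (List.++-assoc (concatBelow a g) _ (g (a + r))))

concatBelow-[] : ∀ n {g} → (∀ i → i < n → g i ≡ []) → concatBelow n g ≡ []
concatBelow-[] zero    h = refl
concatBelow-[] (suc n) h = cong₂ _++_ (concatBelow-[] n (λ i i<n → h i (ℕ.m<n⇒m<1+n i<n))) (h n ≤-refl)

concatBelow-nth : ∀ l → concatBelow (length l) (λ j → nth l j ∷ []) ≡ l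
concatBelow-nth []      = refl
concatBelow-nth (b ∷ l) = trans (concatBelow-front (length l) (λ j → nth (b ∷ l) j ∷ [])) (cong (b ∷_) (concatBelow-nth l))

concatBelow-replicate : ∀ a c (b : Bool) → concatBelow a (λ _ → List.replicate c b) ≡ List.replicate (a * c) b
concatBelow-replicate zero    c b = refl
concatBelow-replicate (suc a) c b = trans (cong (_++ List.replicate c b) (concatBelow-replicate a c b))
  (trans (replicate-++ (a * c) c b) (cong (λ z → List.replicate z b) (ℕ.+-comm (a * c) c)))

concatBelow-constant : ∀ a (b : Bool) → concatBelow a (λ _ → b ∷ []) ≡ List.replicate a b
concatBelow-constant a b = trans (concatBelow-replicate a 1 b) (cong (λ z → List.replicate z b) (ℕ.*-identityʳ a))

toList-concat-++ : ∀ {m n c} (xs : Vec (Vec Bool c) m) (ys : Vec (Vec Bool c) n) →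
                   toList (Vec.concat (xs Vec.++ ys)) ≡ toList (Vec.concat xs) ++ toList (Vec.concat ys)
toList-concat-++ []       ys = refl
toList-concat-++ (x ∷ xs) ys = trans (Vec.toList-++ x (Vec.concat (xs Vec.++ ys)))
  (trans (cong (toList x ++_) (toList-concat-++ xs ys))
    (trans (sym (List.++-assoc (toList x) _ _)) (cong (_++ toList (Vec.concat ys)) (sym (Vec.toList-++ x (Vec.concat xs))))))

toList-concat-tabulate : ∀ r {c} (f : Fin r → Vec Bool c) (g : ℕ → List Bool) → (∀ i → toList (f i) ≡ g (toℕ i)) →
                         toList (Vec.concat (tabulate f)) ≡ concatBelow r g
toList-concat-tabulate zero    f g h = refl
toList-concat-tabulate (suc r) f g h = trans (Vec.toList-++ (f zero) _)
  (trans (cong₂ _++_ (h zero) (toList-concat-tabulate r (f ∘ suc) (g ∘ suc) (h ∘ suc))) (sym (concatBelow-front r g)))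

toList-concat²-tabulate : ∀ r {s c} (f : Fin r → Vec (Vec Bool c) s) (g : ℕ → List Bool) → (∀ i → toList (Vec.concat (f i)) ≡ g (toℕ i)) →
                          toList (Vec.concat (Vec.concat (tabulate f))) ≡ concatBelow r g
toList-concat²-tabulate zero    f g h = refl
toList-concat²-tabulate (suc r) f g h = trans (toList-concat-++ (f zero) _)
  (trans (cong₂ _++_ (h zero) (toList-concat²-tabulate r (f ∘ suc) (g ∘ suc) (h ∘ suc))) (sym (concatBelow-front r g)))

toList-tabulate-below : ∀ r (f : Fin r → Bool) (g : ℕ → Bool) → (∀ i → f i ≡ g (toℕ i)) →
                        toList (tabulate f) ≡ concatBelow r (λ j → g j ∷ [])
toList-tabulate-below zero    f g h = refl
toList-tabulate-below (suc r) f g h = trans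
  (cong₂ _∷_ (h zero) (toList-tabulate-below r (f ∘ suc) (g ∘ suc) (h ∘ suc))) (sym (concatBelow-front r (λ j → g j ∷ [])))

tabulate-+ : ∀ {A : Set} m n (f : Fin (m + n) → A) → tabulate f ≡ tabulate (f ∘ (_↑ˡ n)) Vec.++ tabulate (f ∘ (m ↑ʳ_))
tabulate-+ zero    n f = refl
tabulate-+ (suc m) n f = cong (f zero ∷_) (tabulate-+ m n (f ∘ suc))

-- Splitting an index into quotient and remainder enumerates pairs in the same order as two nested
-- loops, the form in which the generator writes them.
tabulate-remQuot : ∀ {A : Set} r c (f : Fin r × Fin c → A) →
                   tabulate (f ∘ remQuot {r} c) ≡ Vec.concat (tabulate (λ i → tabulate (λ j → f (i , j))))
tabulate-remQuot zero    c f = refl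
tabulate-remQuot (suc r) c f = trans (tabulate-+ c (r * c) (f ∘ remQuot {suc r} c))
  (cong₂ Vec._++_
    (Vec.tabulate-cong (λ j → cong (f ∘ row) (Fin.splitAt-↑ˡ c j (r * c))))
    (trans (Vec.tabulate-cong (λ j → cong (f ∘ row) (Fin.splitAt-↑ʳ c (r * c) j)))
      (tabulate-remQuot r c (f ∘ map₁ suc))))
  where
  -- This is what `remQuot` at `suc r` does with the result of `splitAt`.
  row : Fin c ⊎ Fin (r * c) → Fin (suc r) × Fin c
  row s = proj₂ (swapped s) , proj₁ (swapped s)
    where
    swapped : Fin c ⊎ Fin (r * c) → Fin c × Fin (suc r)
    swapped = [ (_, zero) , (λ y → proj₁ (Fin.quotRem {r} c y) , suc (proj₂ (Fin.quotRem {r} c y))) ]′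

∨-⟺ : ∀ {a b P Q} → a ⟺ P → b ⟺ Q → a ∨ b ⟺ P ⊎ Q
∨-⟺ {true}  p q = (λ _ → inj₁ (proj₁ p refl)) , λ _ → refl
∨-⟺ {false} p q = (λ e → inj₂ (proj₁ q e)) , [ (λ x → proj₂ p x ⟨absurd⟩) , proj₂ q ]′
  where
  _⟨absurd⟩ : ∀ {b} → false ≡ true → b ≡ true
  () ⟨absurd⟩

==-⟺ : ∀ {n} (i j : Fin n) → (i == j) ⟺ toℕ i ≡ toℕ j
==-⟺ i j = (λ e → cong toℕ (==-sound i j e)) , λ e → subst (λ z → (i == z) ≡ true) (Fin.toℕ-injective e) (==-refl i)

incidentF : Formula 3 9
incidentF = adjF (var i₁) (var i₂) & (var i₀ ≈ var i₁ ∥ var i₀ ≈ var i₂)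

-- The generators follow the block structure of `rows`. A word that encodes nothing must be sent
-- outside the language, and the empty word, which is no encoding, serves for this.
edgesG zerosG onesG verticesRowsG edgesRowsG colorsG bodyG subdivisionG : Gen 3 9
edgesG        = for i₁ ord (for i₂ ord (emit incidentF))
zerosG        = for i₃ ord (for i₄ ord (emit falseF))
onesG         = for i₃ ord (for i₄ ord (emit trueF))
verticesRowsG = for i₀ ord (for i₁ ord (emit falseF) ▸ edgesG ▸ edgesG)
edgesRowsG    = for i₁ ord (for i₂ ord (for i₀ ord (emit incidentF) ▸ zerosG ▸ zerosG))
colorsG       = for i₀ wd (when (len ord ⊕ len ord ⊗ len ord ≺ var i₀) (emit (bitAt wd (var i₀))))
bodyG         = for i₀ ord (emit trueF) ▸ onesG ▸ onesG ▸ emit falseF ▸ verticesRowsG ▸ edgesRowsG ▸ edgesRowsG ▸ colorsG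
subdivisionG  = when validF bodyG

module Output (o : List Bool) (G : Graph (length o)) (k : ℕ) (3≤k : 3 ≤ k) where
  open Encoded G k 3≤k
  open Meaning code o using (n; m; Adj; valid-⟺)
  open Subdivision G

  ρ₀ : Vec (List Bool) 3
  ρ₀ = [] ∷ code ∷ o ∷ []

  incidentᵇ : ℕ → ℕ → ℕ → Bool
  incidentᵇ i a b = holds ρ₀ incidentF (i ∷ a ∷ b ∷ 0 ∷ 0 ∷ 0 ∷ 0 ∷ 0 ∷ 0 ∷ [])

  incident≡ : ∀ i a b → incident i (a , b) ≡ incidentᵇ (toℕ i) (toℕ a) (toℕ b)
  incident≡ i a b = ⟺-unique
    (⟺-∧ (⟺-resp (sym (nth-adjacent a b)) ⟺-id) (∨-⟺ (==-⟺ i a) (==-⟺ i b)))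
    (⟺-∧ ⟺-id (⟺-∨ ⟺-= ⟺-=))

  edgeBits : ℕ → List Bool
  edgeBits i = concatBelow n (λ a → concatBelow n (λ b → incidentᵇ i a b ∷ []))

  noneBits : List Bool
  noneBits = concatBelow n (λ _ → concatBelow n (λ _ → false ∷ []))

  endBits : ℕ → ℕ → List Bool
  endBits a b = concatBelow n (λ i → incidentᵇ i a b ∷ []) ++ noneBits ++ noneBits

  list-edges : ∀ i → toList (half i) ≡ edgeBits (toℕ i)
  list-edges i = trans (cong toList (tabulate-remQuot n n (incident i)))
    (toList-concat-tabulate n (λ a → tabulate (λ b → incident i (a , b))) (λ a → concatBelow n (λ b → incidentᵇ (toℕ i) a b ∷ []))
      λ a → toList-tabulate-below n (λ b → incident i (a , b)) (incidentᵇ (toℕ i) (toℕ a)) (incident≡ i a))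

  list-none : noneBits ++ noneBits ≡ toList (Vec.replicate M false)
  list-none = trans (cong₂ _++_ square square) (trans (replicate-++ (n * n) (n * n) false) (sym (Vec.toList-replicate M false)))
    where
    square : noneBits ≡ List.replicate (n * n) false
    square = trans (concatBelow-cong n (λ _ _ → concatBelow-constant n false)) (concatBelow-replicate n n false)

  list-vertices : toList (Vec.concat (tabulate (λ i → Vec.replicate n false Vec.++ edgesAt i))) ≡ list ρ₀ verticesRowsG (Vec.replicate 9 0)
  list-vertices = toList-concat-tabulate n (λ i → Vec.replicate n false Vec.++ edgesAt i)
    (λ i → concatBelow n (λ _ → false ∷ []) ++ edgeBits i ++ edgeBits i) λ i →
    trans (Vec.toList-++ (Vec.replicate n false) (edgesAt i)) (cong₂ _++_
      (trans (Vec.toList-replicate n false) (sym (concatBelow-constant n false)))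
      (trans (Vec.toList-++ (half i) (half i)) (cong₂ _++_ (list-edges i) (list-edges i))))

  list-edgeRows : toList (Vec.concat (tabulate edgeRow)) ≡ list ρ₀ edgesRowsG (Vec.replicate 9 0)
  list-edgeRows = trans (cong (toList ∘ Vec.concat) (tabulate-remQuot n n row))
    (toList-concat²-tabulate n (λ a → tabulate (λ b → row (a , b))) (λ a → concatBelow n (endBits a)) λ a →
      toList-concat-tabulate n (λ b → row (a , b)) (endBits (toℕ a)) λ b →
        trans (Vec.toList-++ (endsOf (a , b)) (Vec.replicate M false)) (cong₂ _++_
          (toList-tabulate-below n (λ i → incident i (a , b)) (λ i → incidentᵇ i (toℕ a) (toℕ b)) (λ i → incident≡ i a b))
          (sym list-none)))
    where
    row : Fin n × Fin n → Vec Bool (n + M)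
    row e = endsOf e Vec.++ Vec.replicate M false

  list-rows : toList (Vec.concat rows) ≡
    list ρ₀ verticesRowsG (Vec.replicate 9 0) ++ list ρ₀ edgesRowsG (Vec.replicate 9 0) ++ list ρ₀ edgesRowsG (Vec.replicate 9 0)
  list-rows = trans (toList-concat-++ (tabulate (λ i → Vec.replicate n false Vec.++ edgesAt i)) _)
    (cong₂ _++_ list-vertices (trans (toList-concat-++ (tabulate edgeRow) (tabulate edgeRow)) (cong₂ _++_ list-edgeRows list-edgeRows)))

  list-colors : list ρ₀ colorsG (Vec.replicate 9 0) ≡ binary k
  list-colors = trans (cong (λ z → concatBelow z g) m≡) (trans (concatBelow-+ (suc c) (length (binary k)) g)
    (trans (cong₂ _++_ (concatBelow-[] (suc c) before) (concatBelow-cong (length (binary k)) (λ j _ → after j))) (concatBelow-nth (binary k))))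
    where
    c = n + n * n
    g : ℕ → List Bool
    g i = if c <ᵇ i then nth code i ∷ [] else []
    m≡ : m ≡ suc c + length (binary k)
    m≡ = trans length-code (arith n (n * n) (length (binary k)))
      where
      arith : ∀ x y z → x + suc (y + z) ≡ suc (x + y) + z
      arith = solve-∀
    before : ∀ i → i < suc c → g i ≡ []
    before i (s≤s i≤c) = cong (λ b → if b then nth code i ∷ [] else []) (¬-not (λ e → ℕ.<-irrefl refl (ℕ.<-≤-trans (proj₁ (⟺-< {c} {i}) e) i≤c)))
    after : ∀ j → g (suc c + j) ≡ nth (binary k) j ∷ []
    after j = trans (cong (λ b → if b then nth code (suc c + j) ∷ [] else []) (proj₂ (⟺-< {c} {suc c + j}) (m≤m+n (suc c) j)))
      (cong (_∷ []) (trans (cong (nth code) (arith n (n * n) j)) (nth-colors j)))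
      where
      arith : ∀ x y j → suc (x + y) + j ≡ x + 1 + y + j
      arith = solve-∀

  list-subdivision : list ρ₀ subdivisionG (Vec.replicate 9 0) ≡ encode subdivided k
  list-subdivision = trans (cong (λ b → if b then body else []) (proj₂ (valid-⟺ [] {0} {0} {0} {0} {0} {0} {0}) (valid-code o refl)))
    (trans (cong₂ _++_ (concatBelow-constant n true) (cong₂ _++_ square (cong₂ _++_ square (cong (false ∷_) tail≡))))
      (trans (cong (ones n ++_) (sym (List.++-assoc (ones (n * n)) (ones (n * n)) _)))
        (trans (sym (List.++-assoc (ones n) _ _))
          (cong (_++ false ∷ toList (Vec.concat rows) ++ binary k)
            (trans (cong (ones n ++_) (replicate-++ (n * n) (n * n) true)) (replicate-++ n M true))))))
    where
    R₀ E₀ C₀ body : List Bool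
    R₀ = list ρ₀ verticesRowsG (Vec.replicate 9 0)
    E₀ = list ρ₀ edgesRowsG (Vec.replicate 9 0)
    C₀ = list ρ₀ colorsG (Vec.replicate 9 0)
    square : list ρ₀ onesG (Vec.replicate 9 0) ≡ ones (n * n)
    square = trans (concatBelow-cong n (λ _ _ → concatBelow-constant n true)) (concatBelow-replicate n n true)
    body = concatBelow n (λ _ → true ∷ []) ++ list ρ₀ onesG (Vec.replicate 9 0) ++ list ρ₀ onesG (Vec.replicate 9 0) ++
           false ∷ R₀ ++ E₀ ++ E₀ ++ C₀
    tail≡ : R₀ ++ E₀ ++ E₀ ++ C₀ ≡ toList (Vec.concat rows) ++ binary k
    tail≡ = trans (cong (R₀ ++_) (sym (List.++-assoc E₀ E₀ C₀)))
      (trans (sym (List.++-assoc R₀ (E₀ ++ E₀) C₀)) (cong₂ _++_ (sym list-rows) list-colors))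

-- Membership and the reduction

open Programs 2 9
open Quantified leafF using (qeval; PSPACE-quantified)

order : List Bool → List Bool
order w = ones (leading w)

length-order : ∀ {n} (G : Graph n) k → length (order (encode G k)) ≡ n
length-order {n} G k = trans (List.length-replicate (leading (encode G k))) (leading-ones n _)

gameValue : List Bool → List Bool → Bool
gameValue w o = qeval (w ∷ o ∷ []) (list ([] ∷ w ∷ o ∷ []) prefixG zeros) []

gameValue-correct : ∀ {n} (G : Graph n) k → 3 ≤ k → (gameValue (encode G k) (order (encode G k)) ≡ true) ⇔ AliceWinsStrongMajority G k
gameValue-correct G k 3≤k = general (order (encode G k)) G (length-order G k)
  where
  -- With the numeral `o` arbitrary, its length can be identified with the number of vertices, as
  -- `GameValue` requires.
  general : ∀ {n} o (G : Graph n) → length o ≡ n → (gameValue (encode G k) o ≡ true) ⇔ AliceWinsStrongMajority G k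
  general o G refl = subst (λ y → (qeval (encode G k ∷ o ∷ []) y [] ≡ true) ⇔ AliceWinsStrongMajority G k)
    (sym (GameValue.list-prefix o G k 3≤k)) (GameValue.game-value o G k 3≤k)

-- A true formula has a true leaf, and each leaf includes `validF`; words that encode nothing are
-- rejected for this reason.
qeval-leaf : ∀ ρ y x → qeval ρ y x ≡ true → ∃[ x′ ] qeval ρ [] x′ ≡ true
qeval-leaf ρ []          x e = x , e
qeval-leaf ρ (true ∷ y)  x e = [ qeval-leaf ρ y (false ∷ x) , qeval-leaf ρ y (true ∷ x) ]′ (∨-elim {qeval ρ y (false ∷ x)} e)
qeval-leaf ρ (false ∷ y) x e = qeval-leaf ρ y (false ∷ x) (proj₁ (∧-elim {qeval ρ y (false ∷ x)} e))

Code : List Bool → Set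
Code w = ∃[ n ] ∃[ G ] ∃[ k ] 3 ≤ k × w ≡ encode {n} G k

valid⇒code : ∀ w → Meaning.Valid w (order w) → Code w
valid⇒code w = Decode.valid⇒encoded w (order w) (List.length-replicate (leading w))

gameValue⇒game : ∀ {w} → Code w → gameValue w (order w) ≡ true → StrongMajorityColoringGame w
gameValue⇒game (n , G , k , 3≤k , refl) e = n , G , k , 3≤k , refl , Equivalence.to (gameValue-correct G k 3≤k) e

gameValue⇒valid : ∀ w → gameValue w (order w) ≡ true → Meaning.Valid w (order w)
gameValue⇒valid w e = let x , leaf = qeval-leaf (w ∷ order w ∷ []) (list ([] ∷ w ∷ order w ∷ []) prefixG zeros) [] e in
  proj₁ (proj₁ (Meaning.won-⟺ w (order w) (x ʳ++ [])) leaf)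

gameValue-language : ∀ w → (gameValue w (order w) ≡ true) ⇔ StrongMajorityColoringGame w
gameValue-language w = mk⇔ (λ e → gameValue⇒game (valid⇒code w (gameValue⇒valid w e)) e) from
  where
  from : StrongMajorityColoringGame w → gameValue w (order w) ≡ true
  from (n , G , k , 3≤k , refl , wins) = Equivalence.from (gameValue-correct G k 3≤k) wins

orderP : Program
orderP = (suc zero , orderG) ∷ []

run-order : ∀ w → run orderP (inputs zero w) ≡ w ∷ order w ∷ []
run-order w = cong (λ o → w ∷ o ∷ []) (list-order w [])

membership : PSPACE StrongMajorityColoringGame
membership = PSPACE-quantified orderP zero prefixG λ w →
  subst (λ ρ → (qeval ρ (list ([] ∷ ρ) prefixG zeros) [] ≡ true) ⇔ StrongMajorityColoringGame w)
    (sym (run-order w)) (gameValue-language w)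

reductionP : Program
reductionP = (suc zero , orderG) ∷ (zero , subdivisionG) ∷ []

reduction : List Bool → List Bool
reduction w = lookup (run reductionP (inputs zero w)) zero

reduction≡ : ∀ w → reduction w ≡ list ([] ∷ w ∷ order w ∷ []) subdivisionG zeros
reduction≡ w = cong (λ o → list ([] ∷ w ∷ o ∷ []) subdivisionG zeros) (list-order w [])

reduction-encode : ∀ {n} (G : Graph n) k → 3 ≤ k → reduction (encode G k) ≡ encode (Subdivision.subdivided G) k
reduction-encode G k 3≤k = trans (reduction≡ (encode G k)) (general (order (encode G k)) G (length-order G k))
  where
  general : ∀ {n} o (G : Graph n) → length o ≡ n →
            list ([] ∷ encode G k ∷ o ∷ []) subdivisionG zeros ≡ encode (Subdivision.subdivided G) k
  general o G refl = Output.list-subdivision o G k 3≤k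

encode-nonempty : ∀ {n} (G : Graph n) k → encode G k ≢ []
encode-nonempty {zero}  G k ()
encode-nonempty {suc n} G k ()

-- Membership of the word in the language supplies some graph and number that it encodes, not the
-- given ones. The detour through `gameValue`, which depends on the word alone, replaces an argument
-- that `encode` is injective.
game⇒proper : ∀ {w} → Code w → StrongMajorityColoringGame (reduction w) → ProperColoringGame w
game⇒proper (n , G , k , 3≤k , refl) game = n , G , k , 3≤k , refl ,
  Equivalence.from (Subdivision.subdivision-wins G 3≤k)
    (Equivalence.to (gameValue-correct (Subdivision.subdivided G) k 3≤k)
      (Equivalence.from (gameValue-language (encode (Subdivision.subdivided G) k))
        (subst StrongMajorityColoringGame (reduction-encode G k 3≤k) game)))

reduction-correct : ∀ w → ProperColoringGame w ⇔ StrongMajorityColoringGame (reduction w)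
reduction-correct w = mk⇔ to (from _ refl)
  where
  to : ProperColoringGame w → StrongMajorityColoringGame (reduction w)
  to (n , G , k , 3≤k , refl , wins) = _ , Subdivision.subdivided G , k , 3≤k , reduction-encode G k 3≤k ,
    Equivalence.to (Subdivision.subdivision-wins G 3≤k) wins
  from : ∀ b → holds ([] ∷ w ∷ order w ∷ []) validF zeros ≡ b → StrongMajorityColoringGame (reduction w) → ProperColoringGame w
  from false e (_ , G , k , _ , eq , _) = ⊥-elim (encode-nonempty G k (trans (sym eq)
    (trans (reduction≡ w) (cong (λ b → if b then list ([] ∷ w ∷ order w ∷ []) bodyG zeros else []) e))))
  from true e game = game⇒proper (valid⇒code w (proj₁ (Meaning.valid-⟺ w (order w) [] {0} {0} {0} {0} {0} {0} {0}) e)) game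

theorem11 : PSPACE-hard ProperColoringGame → PSPACE-complete StrongMajorityColoringGame
theorem11 hard = membership , λ L inPSPACE →
  let g , g-poly , g-correct = hard L inPSPACE in
  reduction ∘ g , PolyTime-run reductionP zero g-poly ,
  λ w → mk⇔ (Equivalence.to (reduction-correct (g w)) ∘ Equivalence.to (g-correct w))
            (Equivalence.from (g-correct w) ∘ Equivalence.from (reduction-correct (g w)))
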